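{- Let $G=(V,E)$ be a finite connected undirected graph with maximum degree $\Delta$ and diameter $D$, let $k$ be an integer with $1<k<|V|$, and let $0<\varepsilon<1$. The mixing time $\tau(\varepsilon)$ of the MCMCSampling Markov chain on $V^{(k)}$ satisfies $$\tau(\varepsilon)\le \tfrac12\, k!\,\Delta^{k}\,(D+k-1)\,|V|\,\bigl(k\ln|V|+\ln\varepsilon^{ -1}\bigr),$$ and hence, for fixed $\varepsilon$, it is $O\bigl(k!\,k\,\Delta^{k}(D+k)\,|V|\ln|V|\bigr)$.
   Context: Graphs are simple. A connected $k$-subgraph of $G$ is a connected vertex-induced subgraph of $G$ with exactly $k$ nodes. The $k$-state graph $G^{(k)}=(V^{(k)},E^{(k)})$ has as node set $V^{(k)}$ the set of all connected $k$-subgraphs of $G$; two nodes $H,F$ are adjacent iff their vertex sets satisfy $|V_H\cap V_F|=k-1$. For $H\in V^{(k)}$, $d(H)$ is the degree of $H$ in $G^{(k)}$. MCMCSampling Markov chain: the state space is $V^{(k)}$. From the current state $v$, with probability $1/2$ stay at $v$; otherwise choose a neighbor $u$ of $v$ in $G^{(k)}$ uniformly at random and move to $u$ with probability $\min\{1,d(v)/d(u)\}$, staying at $v$ if the move is not accepted. Its stationary distribution $\pi$ is uniform on $V^{(k)}$. Mixing time: for a Markov chain on a finite set $\Omega$ with transition matrix $\mathbf P$ and stationary distribution $\pi$, let $\tau_x(\varepsilon)$ be the least $t\in\mathbb N$ such that $\frac12\sum_{y\in\Omega}|(\mathbf P^{\ell})_{x,y}-\pi_y|\le\varepsilon$ for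 all $\ell\ge t$, and let $\tau(\varepsilon)=\max_{x\in\Omega}\tau_x(\varepsilon)$. -}

module Defs where

open import Data.Nat as ℕ using (ℕ; zero; suc)
import Data.Nat.Properties as ℕ
open import Data.Integer using (+_; -[1+_])
import Data.Integer as ℤ
import Data.Integer.Properties as ℤ
open import Data.Rational as ℚ
  using (ℚ; 0ℚ; 1ℚ; ½; _+_; _*_; _-_; -_; _<_; _≤_; _⊓_; ∣_∣; 1/_; _/_;
         mkℚ; *<*; Positive; NonNegative; positive; nonNegative)
open import Data.Rational.Properties as ℚ
  using (<-trans; ≤-<-trans; <-≤-trans; <-dense; <-cmp; <-irrefl; <⇒≤; ≤-refl;
         ≤-trans; ≤-reflexive; +-mono-<; positive⁻¹; nonNegative⁻¹; +-*-commutativeRing;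
         +-0-commutativeMonoid)
open import Data.Rational.Solver using (module +-*-Solver)
open import Data.Fin as Fin using (Fin; zero; suc; _≟_)
open import Data.Fin.Properties using (any?; all?)
open import Data.Fin.Subset as Subset
  using (Subset; inside; outside; _∈_; _∩_)
open import Data.Fin.Subset.Properties using (_∈?_; ∩-comm; ∩-idem)
open import Data.List as List
  using (List; []; _∷_; _++_; filter; length; lookup; allFin)
open import Data.List.Extrema.Nat using (max)
open import Data.List.Membership.Propositional.Properties using (∈-lookup; ∈-filter⁻)
open import Data.Vec using ([]; _∷_)
open import Data.Product using (Σ; ∃; ∃₂; _×_; _,_; proj₁; proj₂)
import Data.Sum as Sum
open import Data.Sum using (_⊎_; inj₁; inj₂; [_,_]′)
open import Algebra using (CommutativeRing)
open import Algebra.Properties.CommutativeMonoid.Sum +-0-commutativeMonoid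
  using (sum)
open import Algebra.Properties.CommutativeSemiring.Exp
  (CommutativeRing.commutativeSemiring +-*-commutativeRing)
  using (_^_; ^-assocʳ; ^-distrib-*)
open import Function using (_∘_; id)
open import Level using (0ℓ)
open import Relation.Binary using (Rel; Decidable; Symmetric; tri<; tri≈; tri>)
open import Relation.Binary.Construct.Closure.ReflexiveTransitive
  using (Star; ε; _◅_; _◅◅_)
open import Relation.Binary.PropositionalEquality
  using (_≡_; refl; sym; trans; cong; cong₂; subst; subst₂)
open import Relation.Nullary using (¬_; yes; no; contradiction)
open import Relation.Nullary.Decidable using (_×-dec_; _→-dec_; _⊎-dec_; map′)
import Relation.Unary as Unary
import Data.Rational.Unnormalised as ℚᵘ
import Data.Rational.Unnormalised.Properties as ℚᵘ

------------------------------------------------------------------------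
-- Graphs

record Graph (n : ℕ) : Set₁ where
  field
    Adj    : Rel (Fin n) 0ℓ
    adj?   : Decidable Adj
    symm   : Symmetric Adj
    irrefl : ∀ {u} → ¬ Adj u u

open Graph public

degree : ∀ {n} → Graph n → Fin n → ℕ
degree G u = length (filter (adj? G u) (allFin _))

maxDegree : ∀ {n} → Graph n → ℕ
maxDegree G = max 0 (List.map (degree G) (allFin _))

Walk : ∀ {n} → Graph n → Rel (Fin n) 0ℓ
Walk G = Star (Adj G)

walkLength : ∀ {A : Set} {R : Rel A 0ℓ} {u v} → Star R u v → ℕ
walkLength ε       = 0
walkLength (_ ◅ p) = suc (walkLength p)

Connected : ∀ {n} → Graph n → Set
Connected G = ∀ u v → Walk G u v

IsDistance : ∀ {n} → Graph n → Fin n → Fin n → ℕ → Set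
IsDistance G u v d =
  (∃ λ (p : Walk G u v) → walkLength p ≡ d) ×
  (∀ (p : Walk G u v) → d ℕ.≤ walkLength p)

IsDiameter : ∀ {n} → Graph n → ℕ → Set
IsDiameter G D =
  (∀ u v → ∃ λ d → IsDistance G u v d × d ℕ.≤ D) ×
  (∃₂ λ u v → IsDistance G u v D)

-- Adjacency in the subgraph induced by S, kept as a relation on all vertices.

InducedAdj : ∀ {n} → Graph n → Subset n → Rel (Fin n) 0ℓ
InducedAdj G S u v = u ∈ S × v ∈ S × Adj G u v

ConnectedOn : ∀ {n} → Graph n → Subset n → Set
ConnectedOn G S = ∀ u v → u ∈ S → v ∈ S → Star (InducedAdj G S) u v

-- A vertex-induced subgraph is identified with its vertex set.

IsConnectedSubgraph : ∀ {n} → Graph n → ℕ → Subset n → Set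
IsConnectedSubgraph G k S = Subset.∣ S ∣ ≡ k × ConnectedOn G S

-- Reachability in a finite relation is decided by eliminating the vertex 0:
-- u → 0 → v is replaced by a direct edge u → v.

module _ {n} (R : Rel (Fin (suc n)) 0ℓ) where

  Shortcut : Rel (Fin n) 0ℓ
  Shortcut i j = R (suc i) (suc j) ⊎ (R (suc i) zero × R zero (suc j))

  shortcut⁻ : ∀ {i j} → Star Shortcut i j → Star R (suc i) (suc j)
  shortcut⁻ ε                    = ε
  shortcut⁻ (inj₁ r ◅ p)         = r ◅ shortcut⁻ p
  shortcut⁻ (inj₂ (r , r′) ◅ p)  = r ◅ r′ ◅ shortcut⁻ p

  mutual
    shortcut⁺ : ∀ {i j} → Star R (suc i) (suc j) → Star Shortcut i j
    shortcut⁺ ε                        = ε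
    shortcut⁺ (_◅_ {j = zero}  r p) with from0 p
    ... | _ , r′ , q                   = inj₂ (r , r′) ◅ q
    shortcut⁺ (_◅_ {j = suc _} r p)    = inj₁ r ◅ shortcut⁺ p

    from0 : ∀ {j} → Star R zero (suc j) →
            ∃ λ i → R zero (suc i) × Star Shortcut i j
    from0 (_◅_ {j = zero}  _ p) = from0 p
    from0 (_◅_ {j = suc i} r p) = i , r , shortcut⁺ p

  to0 : ∀ {i} → Star R (suc i) zero →
        ∃ λ j → Star Shortcut i j × R (suc j) zero
  to0 (_◅_ {j = zero}  r _) = _ , ε , r
  to0 (_◅_ {j = suc _} r p) with to0 p
  ... | _ , q , r′          = _ , inj₁ r ◅ q , r′

star? : ∀ {n} {R : Rel (Fin n) 0ℓ} → Decidable R → Decidable (Star R)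
star? {suc n} {R} R? = reach
  where
  shortcut? : Decidable (Shortcut R)
  shortcut? i j =
    R? (suc i) (suc j) ⊎-dec (R? (suc i) zero ×-dec R? zero (suc j))

  reach : Decidable (Star R)
  reach zero    zero    = yes ε
  reach zero    (suc j) =
    map′ (λ (_ , r , q) → r ◅ shortcut⁻ R q) (from0 R)
      (any? λ i → R? zero (suc i) ×-dec star? shortcut? i j)
  reach (suc i) zero    =
    map′ (λ (_ , q , r) → shortcut⁻ R q ◅◅ (r ◅ ε)) (to0 R)
      (any? λ j → star? shortcut? i j ×-dec R? (suc j) zero)
  reach (suc i) (suc j) =
    map′ (shortcut⁻ R) (shortcut⁺ R) (star? shortcut? i j)

isConnectedSubgraph? : ∀ {n} (G : Graph n) k →
                       Unary.Decidable (IsConnectedSubgraph G k)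
isConnectedSubgraph? G k S =
  (Subset.∣ S ∣ ℕ.≟ k) ×-dec
  (all? λ u → all? λ v → (u ∈? S) →-dec ((v ∈? S) →-dec
     star? (λ a b → (a ∈? S) ×-dec ((b ∈? S) ×-dec adj? G a b)) u v))

allSubsets : ∀ n → List (Subset n)
allSubsets zero    = [] ∷ []
allSubsets (suc n) =
  List.map (outside ∷_) (allSubsets n) ++ List.map (inside ∷_) (allSubsets n)

-- V^(k): states are indexed by their position in this duplicate-free list.

states : ∀ {n} → Graph n → ℕ → List (Subset n)
states {n} G k = filter (isConnectedSubgraph? G k) (allSubsets n)

numStates : ∀ {n} → Graph n → ℕ → ℕ
numStates G k = length (states G k)

state : ∀ {n} (G : Graph n) k → Fin (numStates G k) → Subset n
state G k = lookup (states G k)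

state-isConnectedSubgraph : ∀ {n} (G : Graph n) k i →
                            IsConnectedSubgraph G k (state G k i)
state-isConnectedSubgraph {n} G k i =
  proj₂ (∈-filter⁻ (isConnectedSubgraph? G k) {xs = allSubsets n}
          (∈-lookup {xs = states G k} i))

-- ∣ S ∩ T ∣ = k − 1 is written 1 + ∣ S ∩ T ∣ = k, so that no state is adjacent
-- to itself even for k = 0.

stateGraph : ∀ {n} (G : Graph n) k → Graph (numStates G k)
stateGraph G k = record
  { Adj    = λ i j → suc Subset.∣ state G k i ∩ state G k j ∣ ≡ k
  ; adj?   = λ i j → suc Subset.∣ state G k i ∩ state G k j ∣ ℕ.≟ k
  ; symm   = λ {i} {j} e →
      trans (cong (suc ∘ Subset.∣_∣) (∩-comm (state G k j) (state G k i))) e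
  ; irrefl = λ {i} e → ℕ.1+n≢n
      (trans (sym (cong (suc ∘ Subset.∣_∣) (∩-idem (state G k i))))
        (trans e (sym (proj₁ (state-isConnectedSubgraph G k i)))))
  }

------------------------------------------------------------------------
-- Order lemmas for ℚ

open +-*-Solver using (solve; _:+_; _:*_; _:-_; :-_; _:=_; con)

fromℕ : ℕ → ℚ
fromℕ n = + n / 1

0<1 : 0ℚ < 1ℚ
0<1 = positive⁻¹ 1ℚ

diff⁺ : ∀ {p q} → p < q → 0ℚ < q - p
diff⁺ {p} {q} p<q =
  subst₂ _<_ (ℚ.+-inverseʳ p) refl (ℚ.+-monoˡ-< (- p) p<q)

diff⁻ : ∀ {p q} → 0ℚ < q - p → p < q
diff⁻ {p} {q} 0<q-p =
  subst₂ _<_ (ℚ.+-identityʳ p)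
    (solve 2 (λ p q → p :+ (q :- p) := q) refl p q)
    (ℚ.+-monoʳ-< p 0<q-p)

+-pos : ∀ {p q} → 0ℚ < p → 0ℚ < q → 0ℚ < p + q
+-pos {p} {q} 0<p 0<q = subst (_< p + q) (ℚ.+-identityʳ 0ℚ) (+-mono-< 0<p 0<q)

*-pos : ∀ {p q} → 0ℚ < p → 0ℚ < q → 0ℚ < p * q
*-pos {p} {q} 0<p 0<q =
  subst (_< p * q) (ℚ.*-zeroʳ p) (ℚ.*-monoʳ-<-pos p {{positive 0<p}} 0<q)

*-monoˡ-< : ∀ {r p q} → 0ℚ < r → p < q → r * p < r * q
*-monoˡ-< {r} 0<r = ℚ.*-monoʳ-<-pos r {{positive 0<r}}

*-monoʳ-< : ∀ {r p q} → 0ℚ < r → p < q → p * r < q * r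
*-monoʳ-< {r} 0<r = ℚ.*-monoˡ-<-pos r {{positive 0<r}}

*-mono-≤-pos : ∀ {p q r s} → 0ℚ ≤ p → 0ℚ ≤ s → p ≤ q → r ≤ s → p * r ≤ q * s
*-mono-≤-pos {p} {q} {r} {s} 0≤p 0≤s p≤q r≤s =
  ≤-trans (ℚ.*-monoˡ-≤-nonNeg p {{nonNegative 0≤p}} r≤s)
          (ℚ.*-monoʳ-≤-nonNeg s {{nonNegative 0≤s}} p≤q)

inverse : ∀ {p} → 0ℚ < p → ∃ λ r → 0ℚ < r × p * r ≡ 1ℚ
inverse {p} 0<p =
  1/ p , positive⁻¹ (1/ p) {{ℚ.1/pos⇒pos p}} , ℚ.*-inverseʳ p
  where instance
    p-pos = positive 0<p
    p-nz  = ℚ.pos⇒nonZero p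

0<fromℕ-suc : ∀ n → 0ℚ < fromℕ (suc n)
0<fromℕ-suc n = positive⁻¹ (fromℕ (suc n)) {{ℚ.normalize-pos (suc n) 1}}

fromℕ-suc : ∀ n → fromℕ (suc n) ≡ 1ℚ + fromℕ n
fromℕ-suc n = ℚ.toℚᵘ-injective (begin
  ℚ.toℚᵘ (fromℕ (suc n))                 ≈⟨ ℚ.toℚᵘ-fromℚᵘ (ℚᵘ.mkℚᵘ (+ suc n) 0) ⟩
  ℚᵘ.mkℚᵘ (+ suc n) 0                    ≈⟨ ℚᵘ.*≡* (cong (ℤ._* + 1) (cong (λ m → + 1 ℤ.+ m) (sym (ℤ.*-identityʳ (+ n))))) ⟩
  ℚ.toℚᵘ 1ℚ ℚᵘ.+ ℚᵘ.mkℚᵘ (+ n) 0         ≈⟨ ℚᵘ.+-congʳ (ℚ.toℚᵘ 1ℚ) (ℚᵘ.≃-sym (ℚ.toℚᵘ-fromℚᵘ (ℚᵘ.mkℚᵘ (+ n) 0))) ⟩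
  ℚ.toℚᵘ 1ℚ ℚᵘ.+ ℚ.toℚᵘ (fromℕ n)        ≈⟨ ℚᵘ.≃-sym (ℚ.toℚᵘ-homo-+ 1ℚ (fromℕ n)) ⟩
  ℚ.toℚᵘ (1ℚ + fromℕ n)                  ∎)
  where open ℚᵘ.≃-Reasoning

1/suc : ℕ → ℚ
1/suc m = + 1 / suc m

0<1/suc : ∀ m → 0ℚ < 1/suc m
0<1/suc m = positive⁻¹ (1/suc m) {{ℚ.normalize-pos 1 (suc m)}}

suc*1/suc : ∀ m → fromℕ (suc m) * 1/suc m ≡ 1ℚ
suc*1/suc m = ℚ.toℚᵘ-injective (begin
  ℚ.toℚᵘ (fromℕ (suc m) * 1/suc m)            ≈⟨ ℚ.toℚᵘ-homo-* (fromℕ (suc m)) (1/suc m) ⟩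
  ℚ.toℚᵘ (fromℕ (suc m)) ℚᵘ.* ℚ.toℚᵘ (1/suc m) ≈⟨ ℚᵘ.*-cong (ℚ.toℚᵘ-fromℚᵘ (ℚᵘ.mkℚᵘ (+ suc m) 0)) (ℚ.toℚᵘ-fromℚᵘ (ℚᵘ.mkℚᵘ (+ 1) m)) ⟩
  ℚᵘ.mkℚᵘ (+ suc m) 0 ℚᵘ.* ℚᵘ.mkℚᵘ (+ 1) m    ≈⟨ ℚᵘ.*≡* (trans (ℤ.*-identityʳ _) (trans (ℤ.*-identityʳ (+ suc m)) (sym (trans (ℤ.*-identityˡ _) (ℤ.*-identityˡ (+ suc m)))))) ⟩
  ℚ.toℚᵘ 1ℚ                                   ∎)
  where open ℚᵘ.≃-Reasoning

archimedean : ∀ p → ∃ λ n → p < fromℕ (suc n)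
archimedean p@(mkℚ -[1+ _ ] _ _) = 0 , <-trans (ℚ.negative⁻¹ p) 0<1
archimedean p@(mkℚ (+ n) d _)    = n , ℚ.toℚᵘ-cancel-<
  (ℚᵘ.<-respʳ-≃ (ℚᵘ.≃-sym (ℚ.toℚᵘ-fromℚᵘ (ℚᵘ.mkℚᵘ (+ suc n) 0)))
    (ℚᵘ.*<* (subst₂ ℤ._<_ (ℤ.pos-* n 1) (ℤ.pos-* (suc n) (suc d))
      (ℤ.+<+ (ℕ.<-≤-trans (subst (ℕ._< suc n) (sym (ℕ.*-identityʳ n)) ℕ.≤-refl)
        (ℕ.m≤m*n (suc n) (suc d)))))))

^-pos : ∀ {s} n → 0ℚ < s → 0ℚ < s ^ n
^-pos zero    0<s = 0<1
^-pos (suc n) 0<s = *-pos 0<s (^-pos n 0<s)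

^-mono-≤ : ∀ {r s} n → 0ℚ < r → r ≤ s → r ^ n ≤ s ^ n
^-mono-≤ zero    0<r r≤s = ≤-refl
^-mono-≤ (suc n) 0<r r≤s =
  *-mono-≤-pos (<⇒≤ 0<r) (<⇒≤ (^-pos n (<-≤-trans 0<r r≤s))) r≤s
    (^-mono-≤ n 0<r r≤s)

1^n≡1 : ∀ n → 1ℚ ^ n ≡ 1ℚ
1^n≡1 zero    = refl
1^n≡1 (suc n) = trans (ℚ.*-identityˡ _) (1^n≡1 n)

0≤p*p : ∀ p → 0ℚ ≤ p * p
0≤p*p p with ℚ.≤-total 0ℚ p
... | inj₁ 0≤p = subst (_≤ p * p) (ℚ.*-zeroʳ p)
                   (ℚ.*-monoˡ-≤-nonNeg p {{nonNegative 0≤p}} 0≤p)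
... | inj₂ p≤0 = subst (_≤ p * p) (ℚ.*-zeroʳ p)
                   (ℚ.*-monoˡ-≤-nonPos p {{ℚ.nonPositive p≤0}} p≤0)

0≤fromℕ : ∀ n → 0ℚ ≤ fromℕ n
0≤fromℕ zero    = ≤-refl
0≤fromℕ (suc n) = <⇒≤ (0<fromℕ-suc n)

bernoulli : ∀ n {t} → 0ℚ < 1ℚ + t → 1ℚ + fromℕ n * t ≤ (1ℚ + t) ^ n
bernoulli zero    {t} _     =
  ≤-reflexive (trans (cong (λ p → 1ℚ + p) (ℚ.*-zeroˡ t)) (ℚ.+-identityʳ 1ℚ))
bernoulli (suc n) {t} 0<1+t = ≤-trans
  (subst₂ _≤_ (ℚ.+-identityʳ _)
    (trans
      (solve 2 (λ N t → (con 1ℚ :+ (con 1ℚ :+ N) :* t) :+ N :* (t :* t)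
                     := (con 1ℚ :+ t) :* (con 1ℚ :+ N :* t)) refl (fromℕ n) t)
      refl)
    (≤-trans
      (≤-reflexive (cong (λ p → 1ℚ + p * t + 0ℚ) (fromℕ-suc n)))
      (ℚ.+-monoʳ-≤ (1ℚ + (1ℚ + fromℕ n) * t) 0≤nt²)))
  (ℚ.*-monoˡ-≤-nonNeg (1ℚ + t) {{nonNegative (<⇒≤ 0<1+t)}} (bernoulli n 0<1+t))
  where
  0≤nt² : 0ℚ ≤ fromℕ n * (t * t)
  0≤nt² = subst (_≤ fromℕ n * (t * t)) (ℚ.*-zeroʳ (fromℕ n))
            (ℚ.*-monoˡ-≤-nonNeg (fromℕ n) {{nonNegative (0≤fromℕ n)}} (0≤p*p t))

<-or-≥ : ∀ p q → p < q ⊎ q ≤ p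
<-or-≥ p q with p ℚ.<? q
... | yes p<q = inj₁ p<q
... | no  p≮q = inj₂ (ℚ.≮⇒≥ p≮q)

join : ∀ {p q r} → p < r → q < r → ∃ λ s → p ≤ s × q ≤ s × s < r
join {p} {q} p<r q<r with ℚ.≤-total p q
... | inj₁ p≤q = q , p≤q , ≤-refl , q<r
... | inj₂ q≤p = p , ≤-refl , q≤p , p<r

^-open : ∀ n {y s} → 0ℚ < s → y < s ^ n →
         ∃ λ s′ → 0ℚ < s′ × s′ < s × y < s′ ^ n
^-open zero    0<s y<1 with <-dense 0<s
... | s′ , 0<s′ , s′<s = s′ , 0<s′ , s′<s , y<1
^-open (suc n) {y} {s} 0<s y<ss^n with 0ℚ ℚ.<? y
... | no 0≮y with <-dense 0<s
...   | s′ , 0<s′ , s′<s =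
  s′ , 0<s′ , s′<s , ≤-<-trans (ℚ.≮⇒≥ 0≮y) (^-pos (suc n) 0<s′)
^-open (suc n) {y} {s} 0<s y<ss^n | yes 0<y =
  s′ , <-≤-trans 0<s₁ s₁≤s′ , s′<s ,
  <-≤-trans y<s₂w
    (*-mono-≤-pos (<⇒≤ 0<s₂) (<⇒≤ (^-pos n (<-≤-trans 0<s₁ s₁≤s′))) s₂≤s′
      (≤-trans (<⇒≤ w<s₁^n) (^-mono-≤ n 0<s₁ s₁≤s′)))
  where
  t    = proj₁ (inverse 0<s)
  0<t  = proj₁ (proj₂ (inverse 0<s))
  st≡1 = proj₂ (proj₂ (inverse 0<s))

  yt<s^n : y * t < s ^ n
  yt<s^n = subst (y * t <_)
    (trans (solve 3 (λ s t u → s :* u :* t := s :* t :* u) refl s t (s ^ n))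
      (trans (cong (_* s ^ n) st≡1) (ℚ.*-identityˡ _)))
    (*-monoʳ-< 0<t y<ss^n)

  w      = proj₁ (<-dense yt<s^n)
  yt<w   = proj₁ (proj₂ (<-dense yt<s^n))
  w<s^n  = proj₂ (proj₂ (<-dense yt<s^n))
  0<w    = <-trans (*-pos 0<y 0<t) yt<w

  ih     = ^-open n 0<s w<s^n
  s₁     = proj₁ ih
  0<s₁   = proj₁ (proj₂ ih)
  s₁<s   = proj₁ (proj₂ (proj₂ ih))
  w<s₁^n = proj₂ (proj₂ (proj₂ ih))

  u      = proj₁ (inverse 0<w)
  0<u    = proj₁ (proj₂ (inverse 0<w))
  wu≡1   = proj₂ (proj₂ (inverse 0<w))

  y<sw : y < s * w
  y<sw = subst (_< s * w)
    (trans (solve 3 (λ s t y → s :* (y :* t) := s :* t :* y) refl s t y)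
      (trans (cong (_* y) st≡1) (ℚ.*-identityˡ y)))
    (*-monoˡ-< 0<s yt<w)

  yu<s : y * u < s
  yu<s = subst (y * u <_)
    (trans (ℚ.*-assoc s w u) (trans (cong (s *_) wu≡1) (ℚ.*-identityʳ s)))
    (*-monoʳ-< 0<u y<sw)

  s₂     = proj₁ (<-dense yu<s)
  yu<s₂  = proj₁ (proj₂ (<-dense yu<s))
  s₂<s   = proj₂ (proj₂ (<-dense yu<s))
  0<s₂   = <-trans (*-pos 0<y 0<u) yu<s₂

  y<s₂w : y < s₂ * w
  y<s₂w = subst (_< s₂ * w)
    (trans (solve 3 (λ y u w → y :* u :* w := y :* (w :* u)) refl y u w)
      (trans (cong (y *_) wu≡1) (ℚ.*-identityʳ y)))
    (*-monoʳ-< 0<w yu<s₂)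

  s′     = proj₁ (join s₁<s s₂<s)
  s₁≤s′  = proj₁ (proj₂ (join s₁<s s₂<s))
  s₂≤s′  = proj₁ (proj₂ (proj₂ (join s₁<s s₂<s)))
  s′<s   = proj₂ (proj₂ (proj₂ (join s₁<s s₂<s)))

------------------------------------------------------------------------
-- Real numbers, as two-sided Dedekind cuts

record ℝ : Set₁ where
  field
    L U     : ℚ → Set
    L-inh   : ∃ L
    U-inh   : ∃ U
    L-down  : ∀ {p q} → p < q → L q → L p
    U-up    : ∀ {p q} → p < q → U p → U q
    L-open  : ∀ {p} → L p → ∃ λ q → p < q × L q
    U-open  : ∀ {q} → U q → ∃ λ p → p < q × U p
    disj    : ∀ {q} → L q → ¬ U q
    located : ∀ {p q} → p < q → L p ⊎ U q

  L<U : ∀ {p q} → L p → U q → p < q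
  L<U {p} {q} Lp Uq with <-cmp p q
  ... | tri< p<q _ _  = p<q
  ... | tri≈ _ refl _ = contradiction Uq (disj Lp)
  ... | tri> _ _ q<p  = contradiction Uq (disj (L-down q<p Lp))

  approx : ∀ {δ} → 0ℚ < δ → ∃₂ λ a b → L a × U b × b < a + δ
  approx {δ} 0<δ = go N La₀ (U-up b₀<a₀+Nh Ub₀)
    where
    h   = δ * (½ * ½)
    0<h = *-pos 0<δ (positive⁻¹ (½ * ½))
    h+h<δ : h + h < δ
    h+h<δ = subst₂ _<_
      (solve 1 (λ d → d :* con ½ := d :* con (½ * ½) :+ d :* con (½ * ½)) refl δ)
      (ℚ.*-identityʳ δ) (*-monoˡ-< 0<δ (ℚ.*<* (ℤ.+<+ (ℕ.s≤s (ℕ.s≤s ℕ.z≤n)))))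

    a₀  = proj₁ L-inh
    La₀ = proj₂ L-inh
    b₀  = proj₁ U-inh
    Ub₀ = proj₂ U-inh
    i    = proj₁ (inverse 0<h)
    hi≡1 = proj₂ (proj₂ (inverse 0<h))
    N    = suc (proj₁ (archimedean ((b₀ - a₀) * i)))

    b₀<a₀+Nh : b₀ < a₀ + fromℕ N * h
    b₀<a₀+Nh = subst (_< a₀ + fromℕ N * h)
      (trans (cong (λ p → a₀ + p)
               (trans (solve 3 (λ d i h → d :* i :* h := d :* (h :* i)) refl (b₀ - a₀) i h)
                 (trans (cong ((b₀ - a₀) *_) hi≡1) (ℚ.*-identityʳ _))))
        (solve 2 (λ a b → a :+ (b :- a) := b) refl a₀ b₀))
      (ℚ.+-monoʳ-< a₀ (*-monoʳ-< 0<h (proj₂ (archimedean ((b₀ - a₀) * i)))))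

    step : ∀ a n → a + fromℕ (suc n) * h ≡ (a + h) + fromℕ n * h
    step a n = trans (cong (λ p → a + p * h) (fromℕ-suc n))
      (solve 3 (λ a n h → a :+ (con 1ℚ :+ n) :* h := (a :+ h) :+ n :* h)
        refl a (fromℕ n) h)

    a+h<a+2h : ∀ a → a + h < a + (h + h)
    a+h<a+2h a = ℚ.+-monoʳ-< a
      (subst (_< h + h) (ℚ.+-identityʳ h) (ℚ.+-monoʳ-< h 0<h))

    go : ∀ n {a} → L a → U (a + fromℕ n * h) → ∃₂ λ a b → L a × U b × b < a + δ
    go zero    {a} La Ub = contradiction
      (subst U (trans (cong (λ p → a + p) (ℚ.*-zeroˡ h)) (ℚ.+-identityʳ a)) Ub)
      (disj La)
    go (suc n) {a} La Ub with located (a+h<a+2h a)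
    ... | inj₁ La+h  = go n La+h (subst U (step a n) Ub)
    ... | inj₂ Ua+2h = a , a + (h + h) , La , Ua+2h , ℚ.+-monoʳ-< a h+h<δ

open ℝ public

infix 4 _<ℝ_ _≤ℝ_

_<ℝ_ : ℝ → ℝ → Set
x <ℝ y = ∃ λ q → U x q × L y q

_≤ℝ_ : ℝ → ℝ → Set
x ≤ℝ y = ∀ q → L x q → L y q

fromℚ : ℚ → ℝ
fromℚ p = record
  { L       = _< p
  ; U       = p <_
  ; L-inh   = p - 1ℚ , diff⁻ (subst (0ℚ <_) (solve 1 (λ p → con 1ℚ := p :- (p :- con 1ℚ)) refl p) 0<1)
  ; U-inh   = p + 1ℚ , diff⁻ (subst (0ℚ <_) (solve 1 (λ p → con 1ℚ := (p :+ con 1ℚ) :- p) refl p) 0<1)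
  ; L-down  = <-trans
  ; U-up    = λ q<r p<q → <-trans p<q q<r
  ; L-open  = <-dense
  ; U-open  = λ p<q → let r , p<r , r<q = <-dense p<q in r , r<q , p<r
  ; disj    = ℚ.<-asym
  ; located = loc
  }
  where
  loc : ∀ {q r} → q < r → q < p ⊎ p < r
  loc {q} q<r = Sum.map id (λ p≤q → ≤-<-trans p≤q q<r) (<-or-≥ q p)

infixl 6 _+ℝ_
infixl 7 _·_

_+ℝ_ : ℝ → ℝ → ℝ
x +ℝ y = record
  { L       = λ q → ∃₂ λ a b → L x a × L y b × q < a + b
  ; U       = λ q → ∃₂ λ a b → U x a × U y b × a + b < q
  ; L-inh   = let a , La = L-inh x ; b , Lb = L-inh y
                  q , q<a+b = L-inh (fromℚ (a + b))
              in q , a , b , La , Lb , q<a+b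
  ; U-inh   = let a , Ua = U-inh x ; b , Ub = U-inh y
                  q , a+b<q = U-inh (fromℚ (a + b))
              in q , a , b , Ua , Ub , a+b<q
  ; L-down  = λ p<q (a , b , La , Lb , q<a+b) → a , b , La , Lb , <-trans p<q q<a+b
  ; U-up    = λ p<q (a , b , Ua , Ub , a+b<p) → a , b , Ua , Ub , <-trans a+b<p p<q
  ; L-open  = λ (a , b , La , Lb , p<a+b) →
      let q , p<q , q<a+b = <-dense p<a+b in q , p<q , a , b , La , Lb , q<a+b
  ; U-open  = λ (a , b , Ua , Ub , a+b<q) →
      let p , a+b<p , p<q = <-dense a+b<q in p , p<q , a , b , Ua , Ub , a+b<p
  ; disj    = λ (a , b , La , Lb , q<a+b) (a′ , b′ , Ua′ , Ub′ , a′+b′<q) →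
      ℚ.<-asym (<-trans a′+b′<q q<a+b) (+-mono-< (L<U x La Ua′) (L<U y Lb Ub′))
  ; located = loc
  }
  where
  loc : ∀ {q r} → q < r →
        (∃₂ λ a b → L x a × L y b × q < a + b) ⊎
        (∃₂ λ a b → U x a × U y b × a + b < r)
  loc {q} {r} q<r =
    let 0<h = *-pos (diff⁺ q<r) (positive⁻¹ ½)
        a , a′ , La , Ua′ , a′<a+h = approx x 0<h
        b , b′ , Lb , Ub′ , b′<b+h = approx y 0<h
    in Sum.map
      (λ q<a+b → a , b , La , Lb , q<a+b)
      (λ a+b≤q → a′ , b′ , Ua′ , Ub′ ,
        <-≤-trans (+-mono-< a′<a+h b′<b+h) (bound a b q r a+b≤q))
      (<-or-≥ q (a + b))
    where
    bound : ∀ a b q r → a + b ≤ q → (a + (r - q) * ½) + (b + (r - q) * ½) ≤ r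
    bound a b q r a+b≤q = subst₂ _≤_
      (solve 4 (λ a b q r → (a :+ b) :+ (r :- q)
         := (a :+ (r :- q) :* con ½) :+ (b :+ (r :- q) :* con ½)) refl a b q r)
      (solve 2 (λ q r → q :+ (r :- q) := r) refl q r)
      (ℚ.+-monoˡ-≤ (r - q) a+b≤q)

scale : (c : ℚ) .{{_ : NonNegative c}} → ℝ → ℝ
scale c x = record
  { L       = λ q → ∃ λ a → L x a × q < c * a
  ; U       = λ q → ∃ λ a → U x a × c * a < q
  ; L-inh   = let a , La = L-inh x ; q , q<ca = L-inh (fromℚ (c * a))
              in q , a , La , q<ca
  ; U-inh   = let a , Ua = U-inh x ; q , ca<q = U-inh (fromℚ (c * a))
              in q , a , Ua , ca<q
  ; L-down  = λ p<q (a , La , q<ca) → a , La , <-trans p<q q<ca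
  ; U-up    = λ p<q (a , Ua , ca<p) → a , Ua , <-trans ca<p p<q
  ; L-open  = λ (a , La , p<ca) →
      let q , p<q , q<ca = <-dense p<ca in q , p<q , a , La , q<ca
  ; U-open  = λ (a , Ua , ca<q) →
      let p , ca<p , p<q = <-dense ca<q in p , p<q , a , Ua , ca<p
  ; disj    = λ (a , La , q<ca) (b , Ub , cb<q) → <-irrefl refl
      (<-trans q<ca (≤-<-trans (ℚ.*-monoˡ-≤-nonNeg c (<⇒≤ (L<U x La Ub))) cb<q))
  ; located = loc
  }
  where
  loc : ∀ {q r} → q < r →
        (∃ λ a → L x a × q < c * a) ⊎ (∃ λ a → U x a × c * a < r)
  loc {q} {r} q<r =
    let u , 0<u , [1+c]u≡1 = inverse 0<1+c
        0<δ = *-pos (diff⁺ q<r) 0<u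
        a , b , La , Ub , b<a+δ = approx x 0<δ
    in Sum.map
      (λ q<ca → a , La , q<ca)
      (λ ca≤q → b , Ub ,
        ≤-<-trans (ℚ.*-monoˡ-≤-nonNeg c (<⇒≤ b<a+δ))
          (bound a u [1+c]u≡1 0<δ ca≤q))
      (<-or-≥ q (c * a))
    where
    0<1+c : 0ℚ < 1ℚ + c
    0<1+c = <-≤-trans 0<1
      (subst (_≤ 1ℚ + c) (ℚ.+-identityʳ 1ℚ) (ℚ.+-monoʳ-≤ 1ℚ (nonNegative⁻¹ c)))

    bound : ∀ a u → (1ℚ + c) * u ≡ 1ℚ → 0ℚ < (r - q) * u → c * a ≤ q →
            c * (a + (r - q) * u) < r
    bound a u [1+c]u≡1 0<δ ca≤q = subst (_< r) (sym (ℚ.*-distribˡ-+ c a _))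
      (≤-<-trans (ℚ.+-monoˡ-≤ (c * ((r - q) * u)) ca≤q)
        (diff⁻ (subst (0ℚ <_) eq 0<δ)))
      where
      eq : (r - q) * u ≡ r - (q + c * ((r - q) * u))
      eq = trans
        (solve 3 (λ d c u → d :* u
            := d :* ((con 1ℚ :+ c) :* u) :- c :* (d :* u)) refl (r - q) c u)
        (trans (cong (λ p → (r - q) * p - c * ((r - q) * u)) [1+c]u≡1)
          (solve 3 (λ q r w → (r :- q) :* con 1ℚ :- w := r :- (q :+ w))
            refl q r (c * ((r - q) * u))))

_·_ : ℕ → ℝ → ℝ
m · x = scale (fromℕ m) {{ℚ.normalize-nonNeg m 1}} x

record ℝ⁺ : Set₁ where
  field
    value : ℝ
    pos   : fromℚ 0ℚ <ℝ value

open ℝ⁺ public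

U⇒0< : ∀ (x : ℝ⁺) {q} → U (value x) q → 0ℚ < q
U⇒0< x Uq = let _ , 0<p , Lp = pos x in <-trans 0<p (L<U (value x) Lp Uq)

fromℕ⁺ : (n : ℕ) .{{_ : ℕ.NonZero n}} → ℝ⁺
fromℕ⁺ (suc n) = record
  { value = fromℚ (fromℕ (suc n)) ; pos = <-dense (0<fromℕ-suc n) }

infix 8 _⁻¹

_⁻¹ : ℝ⁺ → ℝ⁺
x ⁻¹ = record
  { value = record
    { L       = λ q → ∃ λ b → U X b × q * b < 1ℚ
    ; U       = λ q → ∃ λ a → L X a × 0ℚ < a × 1ℚ < a * q
    ; L-inh   = 0ℚ , L0
    ; U-inh   = U-inh′
    ; L-down  = λ p<q (b , Ub , qb<1) →
        b , Ub , <-trans (*-monoʳ-< (U⇒0< x Ub) p<q) qb<1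
    ; U-up    = λ p<q (a , La , 0<a , 1<ap) →
        a , La , 0<a , <-trans 1<ap (*-monoˡ-< 0<a p<q)
    ; L-open  = λ {p} (b , Ub , pb<1) → L-open′ p b Ub pb<1
    ; U-open  = λ {q} (a , La , 0<a , 1<aq) → U-open′ q a La 0<a 1<aq
    ; disj    = λ {q} (b , Ub , qb<1) (a , La , 0<a , 1<aq) →
        let 0<q = ℚ.*-cancelˡ-<-nonNeg a {{nonNegative (<⇒≤ 0<a)}}
                    (subst (_< a * q) (sym (ℚ.*-zeroʳ a)) (<-trans 0<1 1<aq))
        in <-irrefl refl (<-trans 1<aq (<-trans
             (subst (a * q <_) (ℚ.*-comm b q) (*-monoʳ-< 0<q (L<U X La Ub)))
             qb<1))
    ; located = loc
    }
  ; pos = L-open′ 0ℚ (proj₁ L0) (proj₁ (proj₂ L0)) (proj₂ (proj₂ L0))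
  }
  where
  X = value x

  L0 : ∃ λ b → U X b × 0ℚ * b < 1ℚ
  L0 = let b , Ub = U-inh X in b , Ub , subst (_< 1ℚ) (sym (ℚ.*-zeroˡ b)) 0<1

  U-inh′ : ∃ λ q → ∃ λ a → L X a × 0ℚ < a × 1ℚ < a * q
  U-inh′ =
    let a , 0<a , La = pos x
        r , _ , ar≡1 = inverse 0<a
    in r + 1ℚ , a , La , 0<a , bound a r ar≡1 0<a
    where
    bound : ∀ a r → a * r ≡ 1ℚ → 0ℚ < a → 1ℚ < a * (r + 1ℚ)
    bound a r ar≡1 0<a = subst₂ _<_ (ℚ.+-identityʳ 1ℚ)
      (trans (cong (λ p → p + a) (sym ar≡1))
        (solve 2 (λ a r → a :* r :+ a := a :* (r :+ con 1ℚ)) refl a r))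
      (ℚ.+-monoʳ-< 1ℚ 0<a)

  L-open′ : ∀ p b → U X b → p * b < 1ℚ →
            ∃ λ q → p < q × ∃ λ b → U X b × q * b < 1ℚ
  L-open′ p b Ub pb<1 =
    let s , pb<s , s<1 = <-dense pb<1
        i , 0<i , bi≡1 = inverse (U⇒0< x Ub)
    in s * i ,
       subst (_< s * i) (cancel p b i bi≡1) (*-monoʳ-< 0<i pb<s) ,
       b , Ub , subst (_< 1ℚ) (sym (cancel′ s i b bi≡1)) s<1
    where
    cancel : ∀ p b i → b * i ≡ 1ℚ → p * b * i ≡ p
    cancel p b i bi≡1 =
      trans (ℚ.*-assoc p b i) (trans (cong (p *_) bi≡1) (ℚ.*-identityʳ p))
    cancel′ : ∀ s i b → b * i ≡ 1ℚ → s * i * b ≡ s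
    cancel′ s i b bi≡1 = cancel s i b (trans (ℚ.*-comm i b) bi≡1)

  U-open′ : ∀ q a → L X a → 0ℚ < a → 1ℚ < a * q →
            ∃ λ p → p < q × ∃ λ a → L X a × 0ℚ < a × 1ℚ < a * p
  U-open′ q a La 0<a 1<aq =
    let s , 1<s , s<aq = <-dense 1<aq
        i , 0<i , ai≡1 = inverse 0<a
    in i * s ,
       subst (i * s <_) (cancel i a q (trans (ℚ.*-comm i a) ai≡1)) (*-monoˡ-< 0<i s<aq) ,
       a , La , 0<a , subst (1ℚ <_) (sym (cancel a i s ai≡1)) 1<s
    where
    cancel : ∀ i a q → i * a ≡ 1ℚ → i * (a * q) ≡ q
    cancel i a q ia≡1 =
      trans (sym (ℚ.*-assoc i a q)) (trans (cong (_* q) ia≡1) (ℚ.*-identityˡ q))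

  inverse-< : ∀ q r q′ r′ → q * q′ ≡ 1ℚ → r * r′ ≡ 1ℚ →
              0ℚ < q′ → 0ℚ < r′ → q < r → r′ < q′
  inverse-< q r q′ r′ qq′≡1 rr′≡1 0<q′ 0<r′ q<r = subst₂ _<_
    (trans (solve 3 (λ r′ q q′ → r′ :* (q :* q′) := q :* q′ :* r′) refl r′ q q′)
      (trans (cong (_* r′) qq′≡1) (ℚ.*-identityˡ r′)))
    (trans (solve 3 (λ r′ r q′ → r′ :* (r :* q′) := r :* r′ :* q′) refl r′ r q′)
      (trans (cong (_* q′) rr′≡1) (ℚ.*-identityˡ q′)))
    (*-monoˡ-< 0<r′ (*-monoʳ-< 0<q′ q<r))

  loc : ∀ {q r} → q < r →
        (∃ λ b → U X b × q * b < 1ℚ) ⊎ (∃ λ a → L X a × 0ℚ < a × 1ℚ < a * r)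
  loc {q} {r} q<r = [ positive-case , nonpositive-case ]′ (<-or-≥ 0ℚ q)
    where
    nonpositive-case : q ≤ 0ℚ → _
    nonpositive-case q≤0 =
      let b , Ub = U-inh X in inj₁ (b , Ub ,
      ≤-<-trans (ℚ.*-monoʳ-≤-nonNeg b {{nonNegative (<⇒≤ (U⇒0< x Ub))}} q≤0)
        (subst (_< 1ℚ) (sym (ℚ.*-zeroˡ b)) 0<1))

    positive-case : 0ℚ < q → _
    positive-case 0<q =
      let 0<r = <-trans 0<q q<r
          q′ , 0<q′ , qq′≡1 = inverse 0<q
          r′ , 0<r′ , rr′≡1 = inverse 0<r
      in Sum.swap (Sum.map
        (λ Lr′ → let a , r′<a , La = L-open X Lr′ in
          a , La , <-trans 0<r′ r′<a ,
          subst (_< a * r) (trans (ℚ.*-comm r′ r) rr′≡1) (*-monoʳ-< 0<r r′<a))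
        (λ Uq′ → let b , b<q′ , Ub = U-open X Uq′ in
          b , Ub , subst (q * b <_) qq′≡1 (*-monoˡ-< 0<q b<q′))
        (located X (inverse-< q r q′ r′ qq′≡1 rr′≡1 0<q′ 0<r′ q<r)))

------------------------------------------------------------------------
-- Natural logarithm

-- For rational q, exp q is the supremum of (1 + q/M)^M over M ≥ 1 with
-- 1 + q/M > 0, and the infimum of (1 - q/M)^(-M) over M ≥ 1 with 1 - q/M > 0.
-- Below M = m + 1.

infix 4 _<exp_ _exp<_

_<exp_ : ℚ → ℚ → Set
y <exp q = ∃ λ m → 0ℚ < 1ℚ + q * 1/suc m × y < (1ℚ + q * 1/suc m) ^ suc m

_exp<_ : ℚ → ℚ → Set
q exp< y = ∃ λ m → 0ℚ < 1ℚ - q * 1/suc m × 1ℚ < y * (1ℚ - q * 1/suc m) ^ suc m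

*1/suc*suc : ∀ p m → p * fromℕ (suc m) * 1/suc m ≡ p
*1/suc*suc p m = trans (ℚ.*-assoc p (fromℕ (suc m)) (1/suc m))
  (trans (cong (p *_) (suc*1/suc m)) (ℚ.*-identityʳ p))

*suc*1/suc : ∀ p m → p * 1/suc m * fromℕ (suc m) ≡ p
*suc*1/suc p m = trans
  (solve 3 (λ p i n → p :* i :* n := p :* n :* i) refl p (1/suc m) (fromℕ (suc m)))
  (*1/suc*suc p m)

*-pos-cancelʳ : ∀ {p q} → 0ℚ < q → 0ℚ < p * q → 0ℚ < p
*-pos-cancelʳ {p} {q} 0<q 0<pq = ℚ.*-cancelʳ-<-nonNeg q {{nonNegative (<⇒≤ 0<q)}}
  (subst (_< p * q) (sym (ℚ.*-zeroˡ q)) 0<pq)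

exp<⇒0< : ∀ {q y} → q exp< y → 0ℚ < y
exp<⇒0< (m , 0<s , 1<ysᴹ) = *-pos-cancelʳ (^-pos (suc m) 0<s) (<-trans 0<1 1<ysᴹ)

<exp-up : ∀ {p q y} → p < q → y <exp p → y <exp q
<exp-up {p} {q} p<q (m , 0<s , y<sᴹ) =
  m , <-trans 0<s s<s′ , <-≤-trans y<sᴹ (^-mono-≤ (suc m) 0<s (<⇒≤ s<s′))
  where
  s<s′ : 1ℚ + p * 1/suc m < 1ℚ + q * 1/suc m
  s<s′ = ℚ.+-monoʳ-< 1ℚ (*-monoʳ-< (0<1/suc m) p<q)

exp<-down : ∀ {p q y} → p < q → q exp< y → p exp< y
exp<-down {p} {q} {y} p<q h@(m , 0<s , 1<ysᴹ) =
  m , <-trans 0<s s<s′ ,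
  <-≤-trans 1<ysᴹ (ℚ.*-monoˡ-≤-nonNeg y {{nonNegative (<⇒≤ (exp<⇒0< {q} {y} h))}}
    (^-mono-≤ (suc m) 0<s (<⇒≤ s<s′)))
  where
  s<s′ : 1ℚ - q * 1/suc m < 1ℚ - p * 1/suc m
  s<s′ = ℚ.+-monoʳ-< 1ℚ (ℚ.neg-antimono-< (*-monoʳ-< (0<1/suc m) p<q))

<exp-open : ∀ {q y} → y <exp q → ∃ λ p → p < q × y <exp p
<exp-open {q} {y} (m , 0<s , y<sᴹ) =
  let s′ , 0<s′ , s′<s , y<s′ᴹ = ^-open (suc m) 0<s y<sᴹ
  in (s′ - 1ℚ) * fromℕ (suc m) ,
     subst ((s′ - 1ℚ) * fromℕ (suc m) <_) s-eq
       (*-monoʳ-< (0<fromℕ-suc m) (ℚ.+-monoˡ-< (- 1ℚ) s′<s)) ,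
     m , subst (0ℚ <_) (s′-eq s′) 0<s′ ,
     subst (λ p → y < p ^ suc m) (s′-eq s′) y<s′ᴹ
  where
  s-eq : (1ℚ + q * 1/suc m - 1ℚ) * fromℕ (suc m) ≡ q
  s-eq = trans (solve 2 (λ p n → (con 1ℚ :+ p :- con 1ℚ) :* n := p :* n)
                 refl (q * 1/suc m) (fromℕ (suc m)))
               (*suc*1/suc q m)
  s′-eq : ∀ s → s ≡ 1ℚ + (s - 1ℚ) * fromℕ (suc m) * 1/suc m
  s′-eq s = sym (trans (cong (λ p → 1ℚ + p) (*1/suc*suc (s - 1ℚ) m))
    (solve 1 (λ s → con 1ℚ :+ (s :- con 1ℚ) := s) refl s))

exp<-open : ∀ {q y} → q exp< y → ∃ λ r → q < r × r exp< y
exp<-open {q} {y} h@(m , 0<s , 1<ysᴹ) =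
  let s = 1ℚ - q * 1/suc m
      z , 0<z , yz≡1 = inverse (exp<⇒0< {q} {y} h)
      s′ , 0<s′ , s′<s , z<s′ᴹ = ^-open (suc m) 0<s
        (subst₂ _<_ (ℚ.*-identityʳ z) (cancel z (s ^ suc m) yz≡1)
          (*-monoˡ-< 0<z 1<ysᴹ))
  in (1ℚ - s′) * fromℕ (suc m) ,
     subst (_< (1ℚ - s′) * fromℕ (suc m)) s-eq
       (*-monoʳ-< (0<fromℕ-suc m) (ℚ.+-monoʳ-< 1ℚ (ℚ.neg-antimono-< s′<s))) ,
     m , subst (0ℚ <_) (s′-eq s′) 0<s′ ,
     subst₂ _<_ yz≡1 (cong (λ p → y * p ^ suc m) (s′-eq s′))
       (*-monoˡ-< (exp<⇒0< {q} {y} h) z<s′ᴹ)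
  where
  cancel : ∀ z w → y * z ≡ 1ℚ → z * (y * w) ≡ w
  cancel z w yz≡1 = trans (solve 3 (λ y z w → z :* (y :* w) := y :* z :* w) refl y z w)
    (trans (cong (_* w) yz≡1) (ℚ.*-identityˡ w))
  s-eq : (1ℚ - (1ℚ - q * 1/suc m)) * fromℕ (suc m) ≡ q
  s-eq = trans (solve 2 (λ p n → (con 1ℚ :- (con 1ℚ :- p)) :* n := p :* n)
                 refl (q * 1/suc m) (fromℕ (suc m)))
               (*suc*1/suc q m)
  s′-eq : ∀ s → s ≡ 1ℚ - (1ℚ - s) * fromℕ (suc m) * 1/suc m
  s′-eq s = sym (trans (cong (λ p → 1ℚ - p) (*1/suc*suc (1ℚ - s) m))
    (solve 1 (λ s → con 1ℚ :- (con 1ℚ :- s) := s) refl s))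

^-refine : ∀ x m n → 0ℚ < 1ℚ + x →
           0ℚ < 1ℚ + x * 1/suc n ×
           (1ℚ + x) ^ suc m ≤ (1ℚ + x * 1/suc n) ^ (suc n ℕ.* suc m)
^-refine x m n 0<1+x = 0<1+t ,
  subst ((1ℚ + x) ^ suc m ≤_) (^-assocʳ (1ℚ + t) (suc n) (suc m))
    (^-mono-≤ (suc m) 0<1+x
      (subst (_≤ (1ℚ + t) ^ suc n) (cong (λ p → 1ℚ + p) n*t≡x) (bernoulli (suc n) 0<1+t)))
  where
  t = x * 1/suc n
  n*t≡x : fromℕ (suc n) * t ≡ x
  n*t≡x = trans (ℚ.*-comm (fromℕ (suc n)) t) (*suc*1/suc x n)
  0<1+t : 0ℚ < 1ℚ + t
  0<1+t = *-pos-cancelʳ (0<fromℕ-suc n)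
    (<-≤-trans 0<1+x
      (subst₂ _≤_ (cong (λ p → p + x) (ℚ.+-identityʳ 1ℚ)) eq
        (ℚ.+-monoˡ-≤ x (ℚ.+-monoʳ-≤ 1ℚ (0≤fromℕ n)))))
    where
    eq : (1ℚ + fromℕ n) + x ≡ (1ℚ + t) * fromℕ (suc n)
    eq = trans (cong₂ _+_ (sym (fromℕ-suc n)) (sym (*suc*1/suc x n)))
      (solve 2 (λ n t → n :+ t :* n := (con 1ℚ :+ t) :* n) refl (fromℕ (suc n)) t)

<exp<-trans : ∀ {x y q} → x <exp q → q exp< y → x < y
<exp<-trans {x} {y} {q} (m , 0<s , x<sᴹ) h@(n , 0<s′ , 1<ys′ᴺ) =
  ℚ.*-cancelʳ-<-nonNeg w {{nonNegative (<⇒≤ 0<w)}}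
    (<-trans (*-monoʳ-< 0<w x<sᴹ) (≤-<-trans vw≤1 1<ys′ᴺ))
  where
  a = 1/suc m
  b = 1/suc n
  t = q * a * b
  v = (1ℚ + q * a) ^ suc m
  w = (1ℚ - q * b) ^ suc n
  0<w = ^-pos (suc n) 0<s′
  k = suc n ℕ.* suc m

  -t-eq : - (q * b) * a ≡ - t
  -t-eq = solve 3 (λ q a b → (:- (q :* b)) :* a := :- (q :* a :* b)) refl q a b

  0<1+t : 0ℚ < 1ℚ + t
  0<1+t = proj₁ (^-refine (q * a) m n 0<s)
  0<1-t : 0ℚ < 1ℚ - t
  0<1-t = subst (λ p → 0ℚ < 1ℚ + p) -t-eq (proj₁ (^-refine (- (q * b)) n m 0<s′))
  v≤ : v ≤ (1ℚ + t) ^ k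
  v≤ = proj₂ (^-refine (q * a) m n 0<s)
  w≤ : w ≤ (1ℚ - t) ^ k
  w≤ = subst₂ (λ p l → w ≤ (1ℚ + p) ^ l) -t-eq (ℕ.*-comm (suc m) (suc n))
    (proj₂ (^-refine (- (q * b)) n m 0<s′))

  [1+t][1-t]≤1 : (1ℚ + t) * (1ℚ - t) ≤ 1ℚ
  [1+t][1-t]≤1 = subst₂ _≤_
    (solve 1 (λ t → con 1ℚ :+ (:- (t :* t)) := (con 1ℚ :+ t) :* (con 1ℚ :- t)) refl t)
    (ℚ.+-identityʳ 1ℚ)
    (ℚ.+-monoʳ-≤ 1ℚ (ℚ.neg-antimono-≤ (0≤p*p t)))

  vw≤1 : v * w ≤ 1ℚ
  vw≤1 = ≤-trans
    (*-mono-≤-pos (<⇒≤ (^-pos (suc m) 0<s)) (<⇒≤ (^-pos k 0<1-t)) v≤ w≤)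
    (subst₂ _≤_ (^-distrib-* (1ℚ + t) (1ℚ - t) k) (1^n≡1 k)
      (^-mono-≤ k (*-pos 0<1+t 0<1-t) [1+t][1-t]≤1))

exp-gap : ∀ {q r} → q < r → ∃₂ λ y z → q exp< y × y < z × z <exp r
exp-gap {q} {r} q<r =
  let y , i<y , y<A = <-dense i<A
      z , y<z , z<A = <-dense y<A
  in y , z ,
     (m , 0<s′ , subst (_< y * B) (trans (ℚ.*-comm i B) Bi≡1) (*-monoʳ-< 0<B i<y)) ,
     y<z , (m , 0<s , z<A)
  where
  d   = inverse (diff⁺ q<r)
  e   = proj₁ d
  c   = r * q * e

  m₁ = proj₁ (archimedean q)
  m₂ = proj₁ (archimedean (- r))
  m₃ = proj₁ (archimedean c)
  m  = m₁ ℕ.⊔ (m₂ ℕ.⊔ m₃)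
  a  = 1/suc m
  M  = fromℕ (suc m)

  fromℕ-mono : ∀ {i j} → i ℕ.≤ j → fromℕ (suc i) ≤ fromℕ (suc j)
  fromℕ-mono {i} {j} i≤j = ℚ.toℚᵘ-cancel-≤
    (ℚᵘ.≤-respˡ-≃ (ℚᵘ.≃-sym (ℚ.toℚᵘ-fromℚᵘ (ℚᵘ.mkℚᵘ (+ suc i) 0)))
      (ℚᵘ.≤-respʳ-≃ (ℚᵘ.≃-sym (ℚ.toℚᵘ-fromℚᵘ (ℚᵘ.mkℚᵘ (+ suc j) 0)))
        (ℚᵘ.*≤* (ℤ.*-monoʳ-≤-nonNeg (+ 1) (ℤ.+≤+ (ℕ.s≤s i≤j))))))

  q<M : q < M
  q<M = <-≤-trans (proj₂ (archimedean q)) (fromℕ-mono (ℕ.m≤m⊔n m₁ _))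
  -r<M : - r < M
  -r<M = <-≤-trans (proj₂ (archimedean (- r)))
    (fromℕ-mono (ℕ.≤-trans (ℕ.m≤m⊔n m₂ m₃) (ℕ.m≤n⊔m m₁ _)))
  c<M : c < M
  c<M = <-≤-trans (proj₂ (archimedean c))
    (fromℕ-mono (ℕ.≤-trans (ℕ.m≤n⊔m m₂ m₃) (ℕ.m≤n⊔m m₁ _)))

  scaled : ∀ {p} → p < M → p * a < 1ℚ
  scaled {p} p<M = subst (p * a <_) (suc*1/suc m) (*-monoʳ-< (0<1/suc m) p<M)

  0<s′ : 0ℚ < 1ℚ - q * a
  0<s′ = diff⁺ (scaled q<M)
  0<s : 0ℚ < 1ℚ + r * a
  0<s = subst (0ℚ <_)
    (solve 2 (λ r a → con 1ℚ :- (:- r) :* a := con 1ℚ :+ r :* a) refl r a)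
    (diff⁺ (scaled -r<M))

  rqa<r-q : r * q * a < r - q
  rqa<r-q = subst₂ _<_
    (trans (solve 5 (λ r q e a d → d :* (r :* q :* e :* a) := d :* e :* (r :* q :* a))
             refl r q e a (r - q))
      (trans (cong (_* (r * q * a)) (proj₂ (proj₂ d))) (ℚ.*-identityˡ _)))
    (ℚ.*-identityʳ (r - q))
    (*-monoˡ-< (diff⁺ q<r) (scaled c<M))

  1<ss′ : 1ℚ < (1ℚ + r * a) * (1ℚ - q * a)
  1<ss′ = diff⁻ (subst (0ℚ <_)
    (solve 3 (λ r q a → a :* (r :- q :- r :* q :* a)
       := (con 1ℚ :+ r :* a) :* (con 1ℚ :- q :* a) :- con 1ℚ) refl r q a)
    (*-pos (0<1/suc m) (diff⁺ rqa<r-q)))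

  A = (1ℚ + r * a) ^ suc m
  B = (1ℚ - q * a) ^ suc m
  0<B = ^-pos (suc m) 0<s′
  i    = proj₁ (inverse 0<B)
  0<i  = proj₁ (proj₂ (inverse 0<B))
  Bi≡1 = proj₂ (proj₂ (inverse 0<B))

  1<AB : 1ℚ < A * B
  1<AB = <-≤-trans 1<ss′ (subst₂ _≤_ (ℚ.*-identityʳ _)
    (^-distrib-* (1ℚ + r * a) (1ℚ - q * a) (suc m))
    (ℚ.*-monoˡ-≤-nonNeg p {{nonNegative (<⇒≤ (<-trans 0<1 1<ss′))}}
      (subst (_≤ p ^ m) (1^n≡1 m) (^-mono-≤ m 0<1 (<⇒≤ 1<ss′)))))
    where p = (1ℚ + r * a) * (1ℚ - q * a)

  i<A : i < A
  i<A = subst₂ _<_ (ℚ.*-identityˡ i)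
    (trans (ℚ.*-assoc A B i) (trans (cong (A *_) Bi≡1) (ℚ.*-identityʳ A)))
    (*-monoʳ-< 0<i 1<AB)

-- ln x is the cut { q : exp q < x }, { q : x < exp q }.

ln : ℝ⁺ → ℝ
ln x = record
  { L       = λ q → ∃ λ y → L X y × q exp< y
  ; U       = λ q → ∃ λ y → U X y × y <exp q
  ; L-inh   =
      let y , 0<y , Ly = pos x
          i , _ , yi≡1 = inverse 0<y
      in - i , y , Ly , 0 , L-bound y i yi≡1 0<y
  ; U-inh   =
      let y , Uy = U-inh X
      in y , y , Uy , 0 , U-bound y (U⇒0< x Uy)
  ; L-down  = λ p<q (y , Ly , h) → y , Ly , exp<-down {y = y} p<q h
  ; U-up    = λ p<q (y , Uy , h) → y , Uy , <exp-up {y = y} p<q h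
  ; L-open  = λ {q} (y , Ly , h) → let r , q<r , h′ = exp<-open {q} {y} h in r , q<r , y , Ly , h′
  ; U-open  = λ {q} (y , Uy , h) → let p , p<q , h′ = <exp-open {q} {y} h in p , p<q , y , Uy , h′
  ; disj    = λ {q} (y , Ly , h) (z , Uz , h′) →
      ℚ.<-asym (L<U X Ly Uz) (<exp<-trans {z} {y} {q} h′ h)
  ; located = λ q<r →
      let y , z , h , y<z , h′ = exp-gap q<r
      in Sum.map (λ Ly → y , Ly , h) (λ Uz → z , Uz , h′) (located X y<z)
  }
  where
  X = value x

  L-bound : ∀ y i → y * i ≡ 1ℚ → 0ℚ < y →
            0ℚ < 1ℚ - (- i) * 1ℚ × 1ℚ < y * (1ℚ - (- i) * 1ℚ) ^ 1
  L-bound y i yi≡1 0<y =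
    ℚ.*-cancelˡ-<-nonNeg y {{nonNegative (<⇒≤ 0<y)}}
      (subst₂ _<_ (sym (ℚ.*-zeroʳ y)) eq (+-pos 0<y 0<1)) ,
    subst₂ _<_ (ℚ.+-identityˡ 1ℚ)
      (trans eq (cong (y *_) (sym (ℚ.*-identityʳ _)))) (ℚ.+-monoˡ-< 1ℚ 0<y)
    where
    eq : y + 1ℚ ≡ y * (1ℚ - (- i) * 1ℚ)
    eq = trans (cong (λ p → y + p) (sym yi≡1))
      (solve 2 (λ y i → y :+ y :* i := y :* (con 1ℚ :- (:- i) :* con 1ℚ)) refl y i)

  U-bound : ∀ y → 0ℚ < y → 0ℚ < 1ℚ + y * 1ℚ × y < (1ℚ + y * 1ℚ) ^ 1
  U-bound y 0<y = <-trans 0<y y<1+y , subst (y <_) (sym (ℚ.*-identityʳ _)) y<1+y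
    where
    y<1+y : y < 1ℚ + y * 1ℚ
    y<1+y = subst₂ _<_ (ℚ.+-identityˡ y) (cong (λ p → 1ℚ + p) (sym (ℚ.*-identityʳ y)))
      (ℚ.+-monoˡ-< y 0<1)

------------------------------------------------------------------------
-- Markov chains on Fin N with rational transition probabilities

Matrix : ℕ → Set
Matrix N = Fin N → Fin N → ℚ

identity : ∀ {N} → Matrix N
identity x y with x ≟ y
... | yes _ = 1ℚ
... | no  _ = 0ℚ

power : ∀ {N} → Matrix N → ℕ → Matrix N
power P zero    = identity
power P (suc l) = λ x y → sum λ z → P x z * power P l z y

tvDistance : ∀ {N} → (Fin N → ℚ) → (Fin N → ℚ) → ℚ
tvDistance μ ν = ½ * sum λ y → ∣ μ y - ν y ∣

module _ {N} (P : Matrix N) (π : Fin N → ℚ) (ε : ℝ) where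

  MixedFrom : Fin N → ℕ → Set
  MixedFrom x t = ∀ l → t ℕ.≤ l → fromℚ (tvDistance (power P l x) π) ≤ℝ ε

  IsMixingTimeFrom : Fin N → ℕ → Set
  IsMixingTimeFrom x t = MixedFrom x t × (∀ s → MixedFrom x s → t ℕ.≤ s)

  -- τ is the maximum over x of the least t with MixedFrom x t.

  IsMixingTime : ℕ → Set
  IsMixingTime τ =
    (∀ x → ∃ λ t → IsMixingTimeFrom x t × t ℕ.≤ τ) ×
    (∃ λ x → IsMixingTimeFrom x τ)

-- Division of naturals with the junk value 0 for m / 0, which is never used
-- below: the degrees are those of adjacent vertices, and Fin N is inhabited.

_÷₀_ : ℕ → ℕ → ℚ
m ÷₀ zero  = 0ℚ
m ÷₀ suc n = + m / suc n

module _ {N} (H : Graph N) where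

  moveProbability : Matrix N
  moveProbability v u with adj? H v u
  ... | yes _ = ½ * (1 ÷₀ degree H v) * (1ℚ ⊓ (degree H v ÷₀ degree H u))
  ... | no  _ = 0ℚ

  -- The remaining probability (laziness and rejected moves) is spent at v.

  lazyMetropolis : Matrix N
  lazyMetropolis v u with v ≟ u
  ... | yes _ = 1ℚ - sum (moveProbability v)
  ... | no  _ = moveProbability v u

uniform : ∀ {N} → Fin N → ℚ
uniform {N} _ = 1 ÷₀ N

MCMCSampling : ∀ {n} (G : Graph n) k → Matrix (numStates G k)
MCMCSampling G k = lazyMetropolis (stateGraph G k)

{-# OPTIONS --safe #-}
module Submission where

-- Write N for the number of states, d for the maximum degree of the state graph
-- and L = D + k - 1. Moves have the symmetric probabilities M v u = 1 / (2 max (deg v) (deg u)).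
--
-- Spectral gap. Any two states are joined by a walk of length at most L, so summing
-- over the edges of simple paths gives the Poincaré inequality
-- ⟨f,f⟩ ≤ N L d (⟨f,f⟩ - ⟨Pf,f⟩) for f of mean zero. Laziness makes P positive
-- semidefinite, hence ∥Pf∥ ≤ (1 - 1/(N L d)) ∥f∥ on mean-zero functions, and the total
-- variation distance after l steps is at most ½ N (1 - 1/(N L d))ˡ.
--
-- Counting. A connected (j+1)-set has two vertices whose removal leaves a connected
-- j-set, so 2 N_{j+1} ≤ j Δ N_j and 2^{k-1} N ≤ (k-1)! Δ^{k-1} n. With
-- d ≤ k (k-1) Δ and 2 (k-1) ≤ 2^{k-1} this yields 2 N L d ≤ K = k! Δ^k L n.
--
-- The bounds on τ leave no room for rounding up, but the factor ½ together with
-- N ≤ nᵏ does: the distance after l steps is at most ε as soon as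
-- ½ K (k ln n + ln ε⁻¹) < l + 1.

open import Data.Nat as ℕ using (ℕ; zero; suc; _!)
import Data.Nat.Properties as ℕ
open import Data.Nat.Solver using () renaming (module +-*-Solver to ℕ-Solver)
import Data.Integer as ℤ
import Data.Integer.Properties as ℤ
import Data.Rational as ℚ
import Data.Rational.Properties as ℚ
import Data.Rational.Unnormalised as ℚᵘ
import Data.Rational.Unnormalised.Properties as ℚᵘ
open import Data.Rational.Properties using (+-0-commutativeMonoid; +-*-commutativeRing)
open import Data.Rational.Solver using () renaming (module +-*-Solver to ℚ-Solver)
open import Data.Fin using (Fin; zero; suc; _≟_; remQuot; combine)
open import Data.Fin.Properties using (any?; injective⇒≤; combine-remQuot)
import Data.Fin.Subset as Subset
open import Data.List using (List; []; _∷_; lookup; length; map; concatMap; filter; tabulate; allFin)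
open import Data.List.Properties using (length-map; length-++; length-tabulate)
open import Data.List.Extrema.Nat using (xs≤max)
import Data.List.Membership.Propositional as List
import Data.List.Membership.Propositional.Properties as List
import Data.List.Membership.DecPropositional as DecMembership
open import Data.List.Membership.Setoid.Properties using (index-injective)
open import Data.List.Relation.Unary.Any as Any using (here; there)
open import Data.List.Relation.Unary.Any.Properties using (lookup-index)
open import Data.List.Relation.Unary.All as All using (All; []; _∷_)
open import Data.List.Relation.Unary.All.Properties using (¬Any⇒All¬; All¬⇒¬Any)
open import Data.List.Relation.Unary.AllPairs using ([]; _∷_)
open import Data.List.Relation.Unary.Unique.Propositional using (Unique)
import Data.List.Relation.Unary.Unique.Propositional.Properties as Unique
open import Data.Vec using ([]; _∷_; here; there)
open import Data.Vec.Properties using (∷-injectiveʳ)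
open import Data.Product using (∃; ∃₂; _×_; _,_; proj₁; proj₂)
open import Data.Sum using (_⊎_; inj₁; inj₂; [_,_]′)
open import Algebra using (CommutativeRing)
open import Algebra.Properties.CommutativeMonoid.Sum +-0-commutativeMonoid
  using (sum; sum-cong-≗; ∑-distrib-+; ∑-comm)
open import Algebra.Properties.Semiring.Sum (CommutativeRing.semiring +-*-commutativeRing)
  using (*-distribˡ-sum)
open import Function using (_∘_; id)
open import Level using (0ℓ)
open import Relation.Binary using (Rel)
open import Relation.Binary.PropositionalEquality
open import Relation.Nullary using (Dec; yes; no; contradiction; ¬_; ¬?)
open import Relation.Nullary.Decidable using (_×-dec_; decidable-stable)
open import Relation.Unary using (Decidable)
open import Defs

-- The chain has rational entries, so the analysis stays in ℚ; the cuts of `ε` and `ln` are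
-- consulted only at the end, through rational bounds. Eigenvalues and square roots need not exist
-- in ℚ. Spectral statements therefore appear as inequalities between quadratic forms, and
-- Cauchy-Schwarz as a quadratic inequality with a free parameter.
--
-- The constant leaves little room for the counting. The degree bound costs k (k - 1) Δ, but beyond
-- (k - 1)! Δ^{k-1} the target supplies only k Δ. The surplus k - 1, together with the 2 demanded by
-- the ½ in the claim, is paid by the powers of two that come from having two noncut vertices
-- instead of one.
--
-- The mixing time is an integer while the bound is real. If the bound is below τ = s + 1,
-- minimality is contradicted only by mixing at time s, so l steps must achieve what the rate
-- promises for l + 1 steps. The missing factor θ is taken from the ½ in the total variation
-- distance, because ½ ≤ θ.

module Analysis where

  open import Relation.Binary.Construct.Closure.ReflexiveTransitive using (Star; ε; _◅_)
  open import Data.Rational using (ℚ; 0ℚ; 1ℚ; ½; _+_; _*_; _-_; -_; _<_; _≤_; ∣_∣; _⊓_; _/_; nonNegative; positive)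
  open import Data.Rational.Properties using (≤-refl; ≤-trans; ≤-reflexive; <⇒≤)
  open import Algebra.Properties.CommutativeSemiring.Exp
    (CommutativeRing.commutativeSemiring +-*-commutativeRing) using (_^_; ^-assocʳ; ^-distrib-*)
  open ℚ-Solver using (solve; _:+_; _:*_; _:-_; :-_; _:=_; con)

  -- Sums over finite index sets

  0≤q-p⇒p≤q : ∀ {p q} → 0ℚ ≤ q - p → p ≤ q
  0≤q-p⇒p≤q {p} {q} h = subst₂ _≤_ (ℚ.+-identityʳ p)
    (solve 2 (λ p q → p :+ (q :- p) := q) refl p q) (ℚ.+-monoʳ-≤ p h)

  p≤q⇒0≤q-p : ∀ {p q} → p ≤ q → 0ℚ ≤ q - p
  p≤q⇒0≤q-p {p} {q} h = subst (_≤ q - p) (ℚ.+-inverseʳ p) (ℚ.+-monoˡ-≤ (- p) h)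

  +-nonNeg : ∀ {p q} → 0ℚ ≤ p → 0ℚ ≤ q → 0ℚ ≤ p + q
  +-nonNeg = ℚ.+-mono-≤

  *-nonNeg : ∀ {p q} → 0ℚ ≤ p → 0ℚ ≤ q → 0ℚ ≤ p * q
  *-nonNeg {p} {q} hp hq = subst (_≤ p * q) (ℚ.*-zeroʳ p)
    (ℚ.*-monoˡ-≤-nonNeg p {{nonNegative hp}} hq)

  *-monoˡ : ∀ {r p q} → 0ℚ ≤ r → p ≤ q → r * p ≤ r * q
  *-monoˡ {r} h = ℚ.*-monoˡ-≤-nonNeg r {{nonNegative h}}

  *-monoʳ : ∀ {r p q} → 0ℚ ≤ r → p ≤ q → p * r ≤ q * r
  *-monoʳ {r} h = ℚ.*-monoʳ-≤-nonNeg r {{nonNegative h}}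

  *-cancelˡ : ∀ {r p q} → 0ℚ < r → r * p ≤ r * q → p ≤ q
  *-cancelˡ {r} h = ℚ.*-cancelˡ-≤-pos r {{positive h}}

  0≤½ : 0ℚ ≤ ½
  0≤½ = ℚ.nonNegative⁻¹ ½

  sum-mono : ∀ {n} {f g : Fin n → ℚ} → (∀ x → f x ≤ g x) → sum f ≤ sum g
  sum-mono {zero}  h = ≤-refl
  sum-mono {suc n} h = ℚ.+-mono-≤ (h zero) (sum-mono λ x → h (suc x))

  sum-const : ∀ n c → sum {n} (λ _ → c) ≡ fromℕ n * c
  sum-const zero    c = sym (ℚ.*-zeroˡ c)
  sum-const (suc n) c = trans (cong (λ s → c + s) (sum-const n c))
    (trans (solve 2 (λ c n → c :+ n :* c := (con 1ℚ :+ n) :* c) refl c (fromℕ n))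
      (cong (_* c) (sym (fromℕ-suc n))))

  sum-zero : ∀ n → sum {n} (λ _ → 0ℚ) ≡ 0ℚ
  sum-zero n = trans (sum-const n 0ℚ) (ℚ.*-zeroʳ (fromℕ n))

  sum-nonNeg : ∀ {n} {f : Fin n → ℚ} → (∀ x → 0ℚ ≤ f x) → 0ℚ ≤ sum f
  sum-nonNeg {n} {f} h = subst (_≤ sum f) (sum-zero n) (sum-mono h)

  sum-axpy : ∀ {n} c (f g : Fin n → ℚ) →
             sum (λ x → c * f x + g x) ≡ c * sum f + sum g
  sum-axpy c f g = trans (∑-distrib-+ (λ x → c * f x) g)
    (cong (λ s → s + sum g) (sym (*-distribˡ-sum c f)))

  identity-suc : ∀ {n} (x y : Fin n) → identity (suc x) (suc y) ≡ identity x y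
  identity-suc x y with x ≟ y
  ... | yes _ = refl
  ... | no  _ = refl

  sum-identity : ∀ {n} (x : Fin n) c → sum (λ y → identity x y * c y) ≡ c x
  sum-identity {suc n} zero c = trans
    (cong₂ _+_ (ℚ.*-identityˡ (c zero))
      (trans (sum-cong-≗ λ y → ℚ.*-zeroˡ (c (suc y))) (sum-zero n)))
    (ℚ.+-identityʳ (c zero))
  sum-identity (suc x) c = trans
    (cong₂ _+_ (ℚ.*-zeroˡ (c zero))
      (trans (sum-cong-≗ λ y → cong (_* c (suc y)) (identity-suc x y))
        (sum-identity x (λ y → c (suc y)))))
    (ℚ.+-identityˡ (c (suc x)))

  identity-diag : ∀ {n} (x : Fin n) → identity x x ≡ 1ℚ
  identity-diag x with x ≟ x
  ... | yes _   = refl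
  ... | no  x≢x = contradiction refl x≢x

  identity-off : ∀ {n} {x y : Fin n} → x ≢ y → identity x y ≡ 0ℚ
  identity-off {x = x} {y} x≢y with x ≟ y
  ... | yes x≡y = contradiction x≡y x≢y
  ... | no  _   = refl

  listSum : ∀ {A : Set} → (A → ℚ) → List A → ℚ
  listSum f []       = 0ℚ
  listSum f (x ∷ xs) = f x + listSum f xs

  -- Induction on the list: `f′` is `f` with its value at the head `x` replaced by 0. It is still
  -- nonnegative, agrees with `f` on the tail because the entries are distinct, and its total is
  -- smaller by `f x`.
  listSum≤sum : ∀ {n} (f : Fin n → ℚ) → (∀ x → 0ℚ ≤ f x) →
                ∀ {xs} → Unique xs → listSum f xs ≤ sum f
  listSum≤sum f f≥0 []            = sum-nonNeg f≥0
  listSum≤sum {n} f f≥0 {x ∷ xs} (x∉xs ∷ u) = ≤-trans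
    (ℚ.+-monoʳ-≤ (f x) (≤-trans (≤-reflexive (same x∉xs)) (listSum≤sum f′ f′≥0 u)))
    (≤-reflexive split)
    where
    f′ : Fin n → ℚ
    f′ y = - 1ℚ * (identity x y * f y) + f y

    f′≥0 : ∀ y → 0ℚ ≤ f′ y
    f′≥0 y with x ≟ y
    ... | yes _ = ≤-reflexive (solve 1 (λ p → con 0ℚ := con (- 1ℚ) :* (con 1ℚ :* p) :+ p) refl (f y))
    ... | no  _ = ≤-trans (f≥0 y)
      (≤-reflexive (solve 1 (λ p → p := con (- 1ℚ) :* (con 0ℚ :* p) :+ p) refl (f y)))

    same : ∀ {ys} → All (x ≢_) ys → listSum f ys ≡ listSum f′ ys
    same [] = refl
    same {y ∷ _} (x≢y ∷ h) = cong₂ _+_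
      (trans (solve 1 (λ p → p := con (- 1ℚ) :* (con 0ℚ :* p) :+ p) refl (f y))
        (cong (λ p → - 1ℚ * (p * f y) + f y) (sym (identity-off x≢y))))
      (same h)

    split : f x + sum f′ ≡ sum f
    split = trans
      (cong (λ s → f x + s) (trans (sum-axpy (- 1ℚ) (λ y → identity x y * f y) f)
        (cong (λ p → - 1ℚ * p + sum f) (sum-identity x f))))
      (solve 2 (λ p s → p :+ (con (- 1ℚ) :* p :+ s) := s) refl (f x) (sum f))

  term≤sum : ∀ {n} (f : Fin n → ℚ) → (∀ x → 0ℚ ≤ f x) → ∀ x → f x ≤ sum f
  term≤sum f f≥0 x = ≤-trans (≤-reflexive (sym (ℚ.+-identityʳ (f x))))
    (listSum≤sum f f≥0 {x ∷ []} ([] ∷ []))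

  ⟨_,_⟩ : ∀ {n} → (Fin n → ℚ) → (Fin n → ℚ) → ℚ
  ⟨ f , g ⟩ = sum λ x → f x * g x

  ⟨,⟩-comm : ∀ {n} (f g : Fin n → ℚ) → ⟨ f , g ⟩ ≡ ⟨ g , f ⟩
  ⟨,⟩-comm f g = sum-cong-≗ λ x → ℚ.*-comm (f x) (g x)

  ⟨,⟩-axpyˡ : ∀ {n} c (f g h : Fin n → ℚ) →
              ⟨ (λ x → c * f x + g x) , h ⟩ ≡ c * ⟨ f , h ⟩ + ⟨ g , h ⟩
  ⟨,⟩-axpyˡ c f g h = trans
    (sum-cong-≗ λ x → solve 4 (λ c f g h → (c :* f :+ g) :* h := c :* (f :* h) :+ g :* h)
      refl c (f x) (g x) (h x))
    (sum-axpy c (λ x → f x * h x) (λ x → g x * h x))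

  ⟨,⟩-axpyʳ : ∀ {n} c (f g h : Fin n → ℚ) →
              ⟨ h , (λ x → c * f x + g x) ⟩ ≡ c * ⟨ h , f ⟩ + ⟨ h , g ⟩
  ⟨,⟩-axpyʳ c f g h = trans (⟨,⟩-comm h _)
    (trans (⟨,⟩-axpyˡ c f g h) (cong₂ (λ p q → c * p + q) (⟨,⟩-comm f h) (⟨,⟩-comm g h)))

  -- The Dirichlet form of a symmetric lazy chain

  module Form {N} (M : Matrix N) (M-sym : ∀ x y → M x y ≡ M y x)
              (M≥0 : ∀ x y → 0ℚ ≤ M x y) (row≤½ : ∀ x → sum (M x) ≤ ½) where

    step : (Fin N → ℚ) → Fin N → ℚ
    step f x = f x + sum λ y → M x y * (f y - f x)

    D : (Fin N → ℚ) → (Fin N → ℚ) → ℚ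
    D f g = sum λ x → sum λ y → M x y * ((f x - f y) * (g x - g y))

    -- Summation by parts: `D f g` splits into two sums, both equal to `- ΣA` by the symmetry of `M`
    -- and an exchange of summations. Self-adjointness follows, and so does conservation of the
    -- total, by pairing with the constant 1.
    step-form : ∀ f g → ⟨ step f , g ⟩ ≡ ⟨ f , g ⟩ - ½ * D f g
    step-form f g = trans expand
      (trans (solve 2 (λ p a → p :+ a := p :- con ½ :* (con (- 1ℚ) :* a :+ con (- 1ℚ) :* a)) refl ⟨ f , g ⟩ ΣA)
        (cong (λ d → ⟨ f , g ⟩ - ½ * d) (sym D≡)))
      where
      A : Fin N → Fin N → ℚ
      A x y = M x y * (f y - f x) * g x
      ΣA = sum λ x → sum (A x)

      expand : ⟨ step f , g ⟩ ≡ ⟨ f , g ⟩ + ΣA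
      expand = trans
        (sum-cong-≗ λ x → trans (ℚ.*-distribʳ-+ (g x) (f x) _)
          (cong (λ s → f x * g x + s)
            (trans (ℚ.*-comm _ (g x)) (trans (*-distribˡ-sum (g x) (λ y → M x y * (f y - f x)))
              (sum-cong-≗ λ y → ℚ.*-comm (g x) (M x y * (f y - f x)))))))
        (∑-distrib-+ (λ x → f x * g x) (λ x → sum (A x)))

      D≡ : D f g ≡ - 1ℚ * ΣA + - 1ℚ * ΣA
      D≡ = trans
        (sum-cong-≗ λ x → trans
          (sum-cong-≗ λ y → trans
            (solve 5 (λ m a b c d → m :* ((a :- b) :* (c :- d))
                 := con (- 1ℚ) :* (m :* (b :- a) :* c) :+ con (- 1ℚ) :* (m :* (a :- b) :* d))
               refl (M x y) (f x) (f y) (g x) (g y))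
            (cong (λ m → - 1ℚ * A x y + - 1ℚ * (m * (f x - f y) * g y)) (M-sym x y)))
          (trans (sum-axpy (- 1ℚ) (A x) (λ y → - 1ℚ * A y x))
            (cong (λ s → - 1ℚ * sum (A x) + s) (sym (*-distribˡ-sum (- 1ℚ) (λ y → A y x))))))
        (trans (sum-axpy (- 1ℚ) (λ x → sum (A x)) (λ x → - 1ℚ * sum (λ y → A y x)))
          (cong (λ s → - 1ℚ * ΣA + s)
            (trans (sym (*-distribˡ-sum (- 1ℚ) (λ x → sum λ y → A y x)))
              (cong (λ s → - 1ℚ * s) (sym (∑-comm A))))))

    D-comm : ∀ f g → D f g ≡ D g f
    D-comm f g = sum-cong-≗ λ x → sum-cong-≗ λ y →
      cong (M x y *_) (ℚ.*-comm (f x - f y) (g x - g y))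

    step-selfAdjoint : ∀ f g → ⟨ step f , g ⟩ ≡ ⟨ step g , f ⟩
    step-selfAdjoint f g = trans (step-form f g)
      (trans (cong₂ (λ p d → p - ½ * d) (⟨,⟩-comm f g) (D-comm f g)) (sym (step-form g f)))

    sum-step : ∀ f → sum (step f) ≡ sum f
    sum-step f = trans (trans (sym (⟨,1⟩ (step f))) (step-form f (λ _ → 1ℚ)))
      (trans (cong₂ (λ p d → p - ½ * d) (⟨,1⟩ f)
          (trans (sum-cong-≗ λ x → trans (sum-cong-≗ λ y →
              solve 3 (λ m a b → m :* ((a :- b) :* (con 1ℚ :- con 1ℚ)) := con 0ℚ) refl (M x y) (f x) (f y))
            (sum-zero N)) (sum-zero N)))
        (solve 1 (λ s → s :- con ½ :* con 0ℚ := s) refl (sum f)))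
      where
      ⟨,1⟩ : ∀ h → ⟨ h , (λ _ → 1ℚ) ⟩ ≡ sum h
      ⟨,1⟩ h = sum-cong-≗ λ x → ℚ.*-identityʳ (h x)

    step-axpy : ∀ c f g x → step (λ y → c * f y + g y) x ≡ c * step f x + step g x
    step-axpy c f g x = trans
      (cong (λ s → c * f x + g x + s)
        (trans (sum-cong-≗ λ y →
            solve 6 (λ m c a b p q → m :* ((c :* b :+ q) :- (c :* a :+ p))
              := c :* (m :* (b :- a)) :+ m :* (q :- p)) refl (M x y) c (f x) (f y) (g x) (g y))
          (sum-axpy c (λ y → M x y * (f y - f x)) (λ y → M x y * (g y - g x)))))
      (solve 5 (λ c a p s t → c :* a :+ p :+ (c :* s :+ t) := c :* (a :+ s) :+ (p :+ t))
        refl c (f x) (g x) _ _)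

    -- Laziness enters here: (a - b)² ≤ 2a² + 2b², and since each row of `M` has mass at most ½,
    -- either half contributes at most ⟨f,f⟩.
    D≤2⟨f,f⟩ : ∀ f → D f f ≤ ⟨ f , f ⟩ + ⟨ f , f ⟩
    D≤2⟨f,f⟩ f = ≤-trans
      (sum-mono λ x → sum-mono λ y → pointwise x y)
      (≤-trans (≤-reflexive regroup) (ℚ.+-mono-≤ bound bound))
      where
      A : Fin N → Fin N → ℚ
      A x y = M x y * ((1ℚ + 1ℚ) * (f x * f x))
      ΣA = sum λ x → sum (A x)

      pointwise : ∀ x y → M x y * ((f x - f y) * (f x - f y)) ≤ A x y + A y x
      pointwise x y = ≤-trans
        (0≤q-p⇒p≤q (subst (0ℚ ≤_)
          (solve 3 (λ m a b → m :* ((a :+ b) :* (a :+ b))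
            := m :* (con (1ℚ + 1ℚ) :* (a :* a)) :+ m :* (con (1ℚ + 1ℚ) :* (b :* b)) :- m :* ((a :- b) :* (a :- b)))
            refl (M x y) (f x) (f y))
          (*-nonNeg (M≥0 x y) (0≤p*p (f x + f y)))))
        (≤-reflexive (cong (λ m → A x y + m * ((1ℚ + 1ℚ) * (f y * f y))) (M-sym x y)))

      regroup : (sum λ x → sum λ y → A x y + A y x) ≡ ΣA + ΣA
      regroup = trans
        (sum-cong-≗ λ x → ∑-distrib-+ (A x) (λ y → A y x))
        (trans (∑-distrib-+ (λ x → sum (A x)) (λ x → sum λ y → A y x))
          (cong (λ s → ΣA + s) (sym (∑-comm A))))

      bound : ΣA ≤ ⟨ f , f ⟩
      bound = sum-mono λ x → ≤-trans
        (≤-reflexive (trans (sum-cong-≗ λ y → ℚ.*-comm (M x y) _)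
          (sym (*-distribˡ-sum ((1ℚ + 1ℚ) * (f x * f x)) (M x)))))
        (≤-trans (*-monoˡ (*-nonNeg (ℚ.nonNegative⁻¹ (1ℚ + 1ℚ)) (0≤p*p (f x))) (row≤½ x))
          (≤-reflexive (solve 1 (λ p → con (1ℚ + 1ℚ) :* p :* con ½ := p) refl (f x * f x))))

    step-psd : ∀ f → 0ℚ ≤ ⟨ step f , f ⟩
    step-psd f = subst (0ℚ ≤_) (sym (step-form f f)) (p≤q⇒0≤q-p
      (≤-trans (*-monoˡ 0≤½ (D≤2⟨f,f⟩ f))
        (≤-reflexive (solve 1 (λ p → con ½ :* (p :+ p) := p) refl ⟨ f , f ⟩))))

    -- Expand 0 ≤ ⟨ step h , h ⟩ for h = step f - θ f.
    step-contracts : ∀ {θ} → 0ℚ < θ →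
      (∀ f → sum f ≡ 0ℚ → ⟨ step f , f ⟩ ≤ θ * ⟨ f , f ⟩) →
      ∀ f → sum f ≡ 0ℚ → ⟨ step f , step f ⟩ ≤ θ * θ * ⟨ f , f ⟩
    step-contracts {θ} 0<θ H f Σf≡0 = *-cancelˡ 0<θ (0≤q-p⇒p≤q (≤-trans
      (subst (0ℚ ≤_) expand (step-psd h))
      (≤-trans (ℚ.+-mono-≤ (H F (trans (sum-step f) Σf≡0))
          (ℚ.+-monoʳ-≤ (- θ * b + - θ * b) (*-monoˡ (0≤p*p θ) (H f Σf≡0))))
        (≤-reflexive (solve 3 (λ t b a → t :* b :+ (:- t :* b :+ :- t :* b :+ t :* t :* (t :* a))
            := t :* (t :* t :* a) :- t :* b) refl θ b ⟨ f , f ⟩)))))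
      where
      F = step f
      b = ⟨ F , F ⟩
      h : Fin N → ℚ
      h x = - θ * f x + F x

      expand : ⟨ step h , h ⟩ ≡ ⟨ step F , F ⟩ + (- θ * b + - θ * b + θ * θ * ⟨ step f , f ⟩)
      expand = trans
        (sum-cong-≗ λ x → cong (_* h x) (step-axpy (- θ) f F x))
        (trans (⟨,⟩-axpyˡ (- θ) F (step F) h)
          (trans (cong₂ (λ p q → - θ * p + q) (⟨,⟩-axpyʳ (- θ) f F F) (⟨,⟩-axpyʳ (- θ) f F (step F)))
            (trans (cong (λ p → - θ * (- θ * ⟨ F , f ⟩ + b) + (- θ * p + ⟨ step F , F ⟩)) (step-selfAdjoint F f))
              (solve 4 (λ t a b c → :- t :* (:- t :* a :+ b) :+ (:- t :* b :+ c)
                  := c :+ (:- t :* b :+ :- t :* b :+ t :* t :* a)) refl θ ⟨ F , f ⟩ b ⟨ step F , F ⟩))))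

  -- Simple paths, the Poincaré inequality and convergence

  module _ {n} {R : Rel (Fin n) 0ℓ} where
    open DecMembership (_≟_ {n}) using (_∈?_)

    vertices : ∀ {u v} → Star R u v → List (Fin n)
    vertices {u} ε       = u ∷ []
    vertices {u} (_ ◅ p) = u ∷ vertices p

    start∈vertices : ∀ {u v} (p : Star R u v) → u List.∈ vertices p
    start∈vertices ε       = here refl
    start∈vertices (_ ◅ _) = here refl

    suffix : ∀ {u v w} (p : Star R u v) → Unique (vertices p) → w List.∈ vertices p →
             ∃ λ (q : Star R w v) → Unique (vertices q) × walkLength q ℕ.≤ walkLength p
    suffix ε       u       (here refl) = ε , u , ℕ.≤-refl
    suffix (r ◅ p) u       (here refl) = r ◅ p , u , ℕ.≤-refl
    suffix (r ◅ p) (_ ∷ u) (there w∈p) =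
      let q , uq , le = suffix p u w∈p in q , uq , ℕ.m≤n⇒m≤1+n le

    loopErase : ∀ {u v} (p : Star R u v) →
                ∃ λ (q : Star R u v) → Unique (vertices q) × walkLength q ℕ.≤ walkLength p
    loopErase ε = ε , [] ∷ [] , ℕ.≤-refl
    loopErase {u} (r ◅ p) with loopErase p
    ... | q , uq , le with u ∈? vertices q
    ...   | yes u∈q = let q′ , uq′ , le′ = suffix q uq u∈q in
                      q′ , uq′ , ℕ.m≤n⇒m≤1+n (ℕ.≤-trans le′ le)
    ...   | no  u∉q = r ◅ q , ¬Any⇒All¬ _ u∉q ∷ uq , ℕ.s≤s le

    module _ (h : Fin n → Fin n → ℚ) (h-sym : ∀ x y → h x y ≡ h y x)
             (h≥0 : ∀ x y → 0ℚ ≤ h x y) where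

      edgeSum : ∀ {u v} → Star R u v → ℚ
      edgeSum ε                   = 0ℚ
      edgeSum (_◅_ {u} {w} _ p)   = h u w + edgeSum p

      row : Fin n → ℚ
      row x = sum (h x)

      twoEdges≤row : ∀ {x y z} → y ≢ z → h x y + h x z ≤ row x
      twoEdges≤row {x} {y} {z} y≢z = ≤-trans
        (≤-reflexive (cong (λ p → h x y + p) (sym (ℚ.+-identityʳ (h x z)))))
        (listSum≤sum (h x) (h≥0 x) {y ∷ z ∷ []} ((y≢z ∷ []) ∷ [] ∷ []))

      -- The invariant for a path entered from `w`: the row of `u` pays for the edge back to `w` and
      -- for the edge ahead. As `w` is not on the path, these are two different entries of that row.
      edgeSum-after : ∀ {u v w} (p : Star R u v) → Unique (vertices p) → w List.∉ vertices p →
                      h u w + (edgeSum p + edgeSum p) ≤ listSum row (vertices p)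
      edgeSum-after {u} {w = w} ε _ _ = ℚ.+-mono-≤ (term≤sum (h u) (h≥0 u) w) ≤-refl
      edgeSum-after {u} {w = w} (_◅_ {j = u′} r p) (u∉p ∷ up) w∉ = ≤-trans
        (≤-reflexive (trans
          (solve 3 (λ a b c → a :+ (b :+ c :+ (b :+ c)) := (a :+ b) :+ (b :+ (c :+ c)))
            refl (h u w) (h u u′) (edgeSum p))
          (cong (λ e → h u w + h u u′ + (e + (edgeSum p + edgeSum p))) (h-sym u u′))))
        (ℚ.+-mono-≤ (twoEdges≤row λ { refl → w∉ (there (start∈vertices p)) })
          (edgeSum-after p up (All¬⇒¬Any u∉p)))

      -- Each inner vertex of a simple path accounts for the two path edges at it.
      edgeSum≤½total : ∀ {u v} (p : Star R u v) → Unique (vertices p) →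
                       edgeSum p + edgeSum p ≤ sum row
      edgeSum≤½total p up = ≤-trans (bound p up)
        (listSum≤sum row (λ x → sum-nonNeg (h≥0 x)) up)
        where
        bound : ∀ {u v} (p : Star R u v) → Unique (vertices p) →
                edgeSum p + edgeSum p ≤ listSum row (vertices p)
        bound {u} ε _ = ℚ.+-mono-≤ (sum-nonNeg (h≥0 u)) ≤-refl
        bound {u} (_◅_ {j = u′} r p) (u∉p ∷ up) = ≤-trans
          (≤-reflexive (trans
            (solve 2 (λ b c → b :+ c :+ (b :+ c) := b :+ (b :+ (c :+ c))) refl (h u u′) (edgeSum p))
            (cong (λ e → h u u′ + (e + (edgeSum p + edgeSum p))) (h-sym u u′))))
          (ℚ.+-mono-≤ (term≤sum (h u) (h≥0 u) u′) (edgeSum-after p up (All¬⇒¬Any u∉p)))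

      module _ (f : Fin n → ℚ) (c : ℚ)
               (h-edge : ∀ {x y} → R x y → (f x - f y) * (f x - f y) ≤ c * h x y) where

        -- Cauchy-Schwarz along a walk in additive form: 2tδ ≤ t² + δ² is applied to each edge with
        -- the same `t`, so the bound survives induction. Minimising over `t` afterwards recovers
        -- the product form.
        telescope : ∀ t {u v} (p : Star R u v) →
          (t + t) * (f u - f v) ≤ fromℕ (walkLength p) * (t * t) + c * edgeSum p
        telescope t {u} ε = ≤-reflexive
          (solve 3 (λ t a c → (t :+ t) :* (a :- a) := con 0ℚ :* (t :* t) :+ c :* con 0ℚ) refl t (f u) c)
        telescope t {u} {v} (_◅_ {j = w} r p) = ≤-trans
          (≤-reflexive (solve 4 (λ t a b d → (t :+ t) :* (a :- d) := (t :+ t) :* (a :- b) :+ (t :+ t) :* (b :- d))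
            refl t (f u) (f w) (f v)))
          (≤-trans (ℚ.+-mono-≤ amgm (telescope t p))
            (≤-reflexive (trans
              (solve 5 (λ m t c a b → (t :* t :+ c :* a) :+ (m :* (t :* t) :+ c :* b)
                  := (con 1ℚ :+ m) :* (t :* t) :+ c :* (a :+ b))
                refl (fromℕ (walkLength p)) t c (h u w) (edgeSum p))
              (cong (λ m → m * (t * t) + c * (h u w + edgeSum p)) (sym (fromℕ-suc (walkLength p)))))))
          where
          amgm : (t + t) * (f u - f w) ≤ t * t + c * h u w
          amgm = ≤-trans
            (0≤q-p⇒p≤q (subst (0ℚ ≤_)
              (solve 2 (λ t a → (t :- a) :* (t :- a) := (t :* t :+ a :* a) :- (t :+ t) :* a) refl t (f u - f w))
              (0≤p*p (t - (f u - f w)))))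
            (ℚ.+-monoʳ-≤ (t * t) (h-edge r))

  fromℕ-mono-≤ : ∀ {m n} → m ℕ.≤ n → fromℕ m ≤ fromℕ n
  fromℕ-mono-≤ {n = n} ℕ.z≤n     = 0≤fromℕ n
  fromℕ-mono-≤ (ℕ.s≤s {m} {n} h) = subst₂ _≤_ (sym (fromℕ-suc m)) (sym (fromℕ-suc n))
    (ℚ.+-monoʳ-≤ 1ℚ (fromℕ-mono-≤ h))

  ∣p∣≤q : ∀ {p q} → 0ℚ ≤ q → p * p ≤ q * q → ∣ p ∣ ≤ q
  ∣p∣≤q {p} {q} 0≤q p²≤q² = ℚ.≮⇒≥ λ q<∣p∣ → ℚ.<-irrefl refl
    (ℚ.<-≤-trans (ℚ.≤-<-trans (*-monoˡ 0≤q (<⇒≤ q<∣p∣)) (*-monoʳ-< (ℚ.≤-<-trans 0≤q q<∣p∣) q<∣p∣))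
      (≤-trans (≤-reflexive ∣p∣²) p²≤q²))
    where
    ∣p∣² : ∣ p ∣ * ∣ p ∣ ≡ p * p
    ∣p∣² with ℚ.∣p∣≡p∨∣p∣≡-p p
    ... | inj₁ eq = cong₂ _*_ eq eq
    ... | inj₂ eq = trans (cong₂ _*_ eq eq) (solve 1 (λ p → :- p :* :- p := p :* p) refl p)

  -- The cross term is a multiple of the square of `sum f`. This is how the mean-zero condition
  -- enters the Poincaré inequality.
  sumSquaredDifferences : ∀ {n} (f : Fin n → ℚ) → sum f ≡ 0ℚ →
    (sum λ x → sum λ y → (f x - f y) * (f x - f y)) ≡ (1ℚ + 1ℚ) * (fromℕ n * ⟨ f , f ⟩)
  sumSquaredDifferences {n} f Σf≡0 = trans
    (sum-cong-≗ λ x → trans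
      (sum-cong-≗ λ y → solve 2 (λ a b → (a :- b) :* (a :- b)
          := (:- (a :+ a)) :* b :+ (b :* b :+ a :* a)) refl (f x) (f y))
      (trans (sum-axpy (- (f x + f x)) f (λ y → f y * f y + f x * f x))
        (trans (cong₂ (λ p q → - (f x + f x) * p + q) Σf≡0
            (trans (∑-distrib-+ (λ y → f y * f y) (λ _ → f x * f x))
              (cong (λ q → ⟨ f , f ⟩ + q) (sum-const n (f x * f x)))))
          (solve 4 (λ a s n q → (:- (a :+ a)) :* con 0ℚ :+ (s :+ n :* q) := n :* q :+ s)
            refl (f x) ⟨ f , f ⟩ (fromℕ n) (f x * f x)))))
    (trans (sum-axpy (fromℕ n) (λ x → f x * f x) (λ _ → ⟨ f , f ⟩))
      (trans (cong (λ q → fromℕ n * ⟨ f , f ⟩ + q) (sum-const n ⟨ f , f ⟩))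
        (solve 2 (λ n s → n :* s :+ n :* s := (con (1ℚ + 1ℚ)) :* (n :* s)) refl (fromℕ n) ⟨ f , f ⟩)))

  module Convergence
    {N} (M : Matrix N) (M-sym : ∀ x y → M x y ≡ M y x)
    (M≥0 : ∀ x y → 0ℚ ≤ M x y) (row≤½ : ∀ x → sum (M x) ≤ ½)
    {R : Rel (Fin N) 0ℓ} (c : ℚ) (0≤c : 0ℚ ≤ c) (M-edge : ∀ {x y} → R x y → 1ℚ ≤ c * M x y)
    (ℓ : ℕ) (walk : ∀ x y → ∃ λ (p : Star R x y) → walkLength p ℕ.≤ suc ℓ) where

    open Form M M-sym M≥0 row≤½

    Λ = fromℕ (suc ℓ)

    -- telescope is used with the optimal t = (f x - f y) / Λ.
    difference²≤ : ∀ f x y → (f x - f y) * (f x - f y) ≤ Λ * (c * (½ * D f f))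
    difference²≤ f x y =
      let p , p≤Λ     = walk x y
          q , uq , le = loopErase p
          i , 0<i , Li≡1 = inverse (0<fromℕ-suc ℓ)
      in conclude i Li≡1
        (≤-trans (telescope h h-sym h≥0 f c h-edge (s * i) q)
          (ℚ.+-mono-≤ (*-monoʳ (0≤p*p (s * i)) (fromℕ-mono-≤ (ℕ.≤-trans le p≤Λ)))
            (*-monoˡ 0≤c (≤-trans
              (≤-reflexive (solve 1 (λ e → e := con ½ :* (e :+ e)) refl (edgeSum h h-sym h≥0 q)))
              (*-monoˡ 0≤½ (edgeSum≤½total h h-sym h≥0 q uq))))))
      where
      s = f x - f y

      h : Fin N → Fin N → ℚ
      h x y = M x y * ((f x - f y) * (f x - f y))

      h-sym : ∀ x y → h x y ≡ h y x
      h-sym x y = trans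
        (solve 3 (λ m a b → m :* ((a :- b) :* (a :- b)) := m :* ((b :- a) :* (b :- a))) refl (M x y) (f x) (f y))
        (cong (_* ((f y - f x) * (f y - f x))) (M-sym x y))

      h≥0 : ∀ x y → 0ℚ ≤ h x y
      h≥0 x y = *-nonNeg (M≥0 x y) (0≤p*p (f x - f y))

      h-edge : ∀ {x y} → R x y → (f x - f y) * (f x - f y) ≤ c * h x y
      h-edge {x} {y} r = ≤-trans
        (≤-reflexive (sym (ℚ.*-identityˡ _)))
        (≤-trans (*-monoʳ (0≤p*p (f x - f y)) (M-edge r))
          (≤-reflexive (ℚ.*-assoc c (M x y) _)))

      conclude : ∀ i → Λ * i ≡ 1ℚ →
        (s * i + s * i) * s ≤ Λ * (s * i * (s * i)) + c * (½ * D f f) →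
        s * s ≤ Λ * (c * (½ * D f f))
      conclude i Li≡1 le = 0≤q-p⇒p≤q (subst (0ℚ ≤_)
        (trans
          (solve 4 (λ Λ s i e → Λ :* (Λ :* (s :* i :* (s :* i)) :+ e :- (s :* i :+ s :* i) :* s)
              := Λ :* e :+ (Λ :* i) :* ((Λ :* i) :* (s :* s)) :- (Λ :* i :+ Λ :* i) :* (s :* s))
            refl Λ s i e)
          (trans (cong (λ j → Λ * e + j * (j * (s * s)) - (j + j) * (s * s)) Li≡1)
            (solve 3 (λ Λ s e → Λ :* e :+ con 1ℚ :* (con 1ℚ :* (s :* s)) :- (con 1ℚ :+ con 1ℚ) :* (s :* s)
                := Λ :* e :- s :* s) refl Λ s e)))
        (*-nonNeg (0≤fromℕ (suc ℓ)) (p≤q⇒0≤q-p le)))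
        where e = c * (½ * D f f)

    -- Each of the N² pairs is charged the whole Dirichlet form. The squared differences add up to
    -- 2N⟨f,f⟩, so one factor N cancels; the given state shows that N is positive.
    poincare : Fin N → ∀ f → sum f ≡ 0ℚ →
               (1ℚ + 1ℚ) * ⟨ f , f ⟩ ≤ fromℕ N * Λ * c * (½ * D f f)
    poincare x₀ f Σf≡0 = *-cancelˡ (0<N x₀) (≤-trans
      (≤-reflexive (trans (solve 2 (λ n s → n :* (con (1ℚ + 1ℚ) :* s) := con (1ℚ + 1ℚ) :* (n :* s)) refl (fromℕ N) ⟨ f , f ⟩)
        (sym (sumSquaredDifferences f Σf≡0))))
      (≤-trans (sum-mono λ x → ≤-trans (sum-mono λ y → difference²≤ f x y)
          (≤-reflexive (sum-const N _)))
        (≤-reflexive (trans (sum-const N _)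
          (solve 4 (λ n l c d → n :* (n :* (l :* (c :* d))) := n :* (n :* l :* c :* d))
            refl (fromℕ N) Λ c (½ * D f f))))))
      where
      0<N : ∀ {n} → Fin n → 0ℚ < fromℕ n
      0<N {suc n} _ = 0<fromℕ-suc n

    module _ (P : Matrix N) (P-step : ∀ f x → sum (λ y → P x y * f y) ≡ step f x)
             (u : ℚ) (Nu≡1 : fromℕ N * u ≡ 1ℚ) (x₀ : Fin N)
             (γ : ℚ) (0<1-γ : 0ℚ < 1ℚ - γ) (0≤γ : 0ℚ ≤ γ)
             (γ-bound : fromℕ N * Λ * c * γ ≤ 1ℚ + 1ℚ) where

      θ = 1ℚ - γ

      step≤θ : ∀ f → sum f ≡ 0ℚ → ⟨ step f , f ⟩ ≤ θ * ⟨ f , f ⟩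
      step≤θ f Σf≡0 = ≤-trans (≤-reflexive (step-form f f))
        (0≤q-p⇒p≤q (subst (0ℚ ≤_)
          (solve 3 (λ s d g → d :- g :* s := (con 1ℚ :- g) :* s :- (s :- d)) refl ⟨ f , f ⟩ (½ * D f f) γ)
          (p≤q⇒0≤q-p gap)))
        where
        2>0 : 0ℚ < 1ℚ + 1ℚ
        2>0 = ℚ.positive⁻¹ (1ℚ + 1ℚ)
        0≤½D : 0ℚ ≤ ½ * D f f
        0≤½D = *-nonNeg 0≤½ (sum-nonNeg λ x → sum-nonNeg λ y → *-nonNeg (M≥0 x y) (0≤p*p (f x - f y)))
        gap : γ * ⟨ f , f ⟩ ≤ ½ * D f f
        gap = *-cancelˡ 2>0 (≤-trans
          (≤-reflexive (solve 2 (λ g s → con (1ℚ + 1ℚ) :* (g :* s) := g :* (con (1ℚ + 1ℚ) :* s)) refl γ ⟨ f , f ⟩))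
          (≤-trans (*-monoˡ 0≤γ (poincare x₀ f Σf≡0))
            (≤-trans (≤-reflexive (solve 3 (λ g k d → g :* (k :* d) := k :* g :* d) refl γ (fromℕ N * Λ * c) (½ * D f f)))
              (*-monoʳ 0≤½D γ-bound))))

      module _ (y : Fin N) where

        -- The target `y` is fixed and the starting state varies: `power` multiplies by `P` on the
        -- left, so columns, not rows, evolve by `step`. Columns of the powers sum to 1 by symmetry,
        -- hence a deviation has mean zero.
        deviation : ℕ → Fin N → ℚ
        deviation l x = - u * 1ℚ + power P l x y

        step-const : ∀ x → step (λ _ → 1ℚ) x ≡ 1ℚ
        step-const x = cong (λ s → 1ℚ + s) (trans
          (sum-cong-≗ λ z → solve 1 (λ m → m :* (con 1ℚ :- con 1ℚ) := con 0ℚ) refl (M x z))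
          (sum-zero N))

        deviation-suc : ∀ l x → deviation (suc l) x ≡ step (deviation l) x
        deviation-suc l x = trans (cong₂ (λ p q → - u * p + q) (sym (step-const x)) (P-step (λ z → power P l z y) x))
          (sym (step-axpy (- u) (λ _ → 1ℚ) (λ z → power P l z y) x))

        sum-deviation-suc : ∀ l → sum (deviation (suc l)) ≡ sum (deviation l)
        sum-deviation-suc l = trans (sum-cong-≗ (deviation-suc l)) (sum-step (deviation l))

        identity-sym : ∀ x → identity x y ≡ identity y x
        identity-sym x with x ≟ y | y ≟ x
        ... | yes _ | yes _ = refl
        ... | no  _ | no  _ = refl
        ... | yes e | no ne = contradiction (sym e) ne
        ... | no ne | yes e = contradiction (sym e) ne

        sum-column : ∀ (f : Fin N → ℚ) → sum (λ x → identity x y * f x) ≡ f y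
        sum-column f = trans (sum-cong-≗ λ x → cong (_* f x) (identity-sym x)) (sum-identity y f)

        sum-[-u] : sum {N} (λ _ → - u * 1ℚ) ≡ - 1ℚ
        sum-[-u] = trans (sum-const N _) (trans (solve 2 (λ n u → n :* (:- u :* con 1ℚ) := :- (n :* u)) refl (fromℕ N) u)
          (cong -_ Nu≡1))

        sum-deviation : ∀ l → sum (deviation l) ≡ 0ℚ
        sum-deviation zero = trans (∑-distrib-+ (λ _ → - u * 1ℚ) (λ x → identity x y))
          (cong₂ _+_ sum-[-u] (trans (sum-cong-≗ λ x → sym (ℚ.*-identityʳ (identity x y))) (sum-column (λ _ → 1ℚ))))
        sum-deviation (suc l) = trans (sum-deviation-suc l) (sum-deviation l)

        0≤u : 0ℚ ≤ u
        0≤u = ℚ.≮⇒≥ λ u<0 → ℚ.<-irrefl refl (ℚ.<-≤-trans (ℚ.positive⁻¹ 1ℚ)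
          (≤-trans (≤-reflexive (sym Nu≡1)) (≤-trans (*-monoˡ (0≤fromℕ N) (<⇒≤ u<0)) (≤-reflexive (ℚ.*-zeroʳ (fromℕ N))))))

        -- At time 0 this is a point mass minus the uniform vector, of squared norm 1 - u; each
        -- further step contracts by θ².
        norm-deviation : ∀ l → ⟨ deviation l , deviation l ⟩ ≤ θ ^ l * θ ^ l
        norm-deviation zero = ≤-trans
          (≤-reflexive (trans (⟨,⟩-axpyʳ (- u) (λ _ → 1ℚ) (λ x → identity x y) (deviation 0))
            (cong₂ (λ p q → - u * p + q)
              (trans (sum-cong-≗ λ x → ℚ.*-identityʳ (deviation 0 x)) (sum-deviation 0))
              (trans (⟨,⟩-comm (deviation 0) (λ x → identity x y)) (sum-column (deviation 0))))))
          (≤-trans (≤-reflexive (trans (cong (λ i → - u * 0ℚ + (- u * 1ℚ + i)) (identity-diag y))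
              (solve 1 (λ u → :- u :* con 0ℚ :+ (:- u :* con 1ℚ :+ con 1ℚ) := con 1ℚ :- u) refl u)))
            (0≤q-p⇒p≤q (subst (0ℚ ≤_) (solve 1 (λ u → u := con 1ℚ :- (con 1ℚ :- u)) refl u) 0≤u)))
        norm-deviation (suc l) = ≤-trans
          (≤-reflexive (sum-cong-≗ λ x → cong₂ _*_ (deviation-suc l x) (deviation-suc l x)))
          (≤-trans (step-contracts 0<1-γ step≤θ (deviation l) (sum-deviation l))
            (≤-trans (*-monoˡ (0≤p*p θ) (norm-deviation l))
              (≤-reflexive (solve 2 (λ t p → t :* t :* (p :* p) := t :* p :* (t :* p)) refl θ (θ ^ l)))))

        ∣deviation∣≤ : ∀ l x → ∣ power P l x y - u ∣ ≤ θ ^ l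
        ∣deviation∣≤ l x = subst (λ p → ∣ p ∣ ≤ θ ^ l)
          (solve 2 (λ u p → :- u :* con 1ℚ :+ p := p :- u) refl u (power P l x y))
          (∣p∣≤q (<⇒≤ (^-pos l 0<1-γ)) (≤-trans
            (term≤sum (λ z → deviation l z * deviation l z) (λ z → 0≤p*p (deviation l z)) x)
            (norm-deviation l)))

      -- Bounding every coordinate by the norm costs a factor N where Cauchy-Schwarz would give √N.
      -- The term k ln n can absorb it, as N ≤ nᵏ.
      tvDistance≤ : ∀ l x → tvDistance (power P l x) (λ _ → u) ≤ ½ * (fromℕ N * θ ^ l)
      tvDistance≤ l x = *-monoˡ 0≤½ (≤-trans (sum-mono λ y → ∣deviation∣≤ y l x)
        (≤-reflexive (sum-const N (θ ^ l))))

  -- The lazy Metropolis chain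

  when : {A : Set} → Dec A → ℚ → ℚ
  when (yes _) c = c
  when (no  _) _ = 0ℚ

  sum-when : ∀ {A : Set} {Q : A → Set} (Q? : Decidable Q) c {n} (f : Fin n → A) →
             sum (λ x → when (Q? (f x)) c) ≡ fromℕ (length (filter Q? (tabulate f))) * c
  sum-when Q? c {zero}  f = sym (ℚ.*-zeroˡ c)
  sum-when Q? c {suc n} f with Q? (f zero)
  ... | no  _ = trans (ℚ.+-identityˡ _) (sum-when Q? c (λ x → f (suc x)))
  ... | yes _ = trans (cong (λ s → c + s) (sum-when Q? c (λ x → f (suc x))))
    (trans (solve 2 (λ m c → c :+ m :* c := (con 1ℚ :+ m) :* c) refl (fromℕ m) c)
      (cong (_* c) (sym (fromℕ-suc m))))
    where m = length (filter Q? (tabulate (λ x → f (suc x))))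

  ÷₀≡* : ∀ m n → m ÷₀ suc n ≡ fromℕ m * 1/suc n
  ÷₀≡* m n = ℚ.toℚᵘ-injective (begin
    ℚ.toℚᵘ (ℤ.+ m / suc n)                          ≈⟨ ℚ.toℚᵘ-fromℚᵘ (ℚᵘ.mkℚᵘ (ℤ.+ m) n) ⟩
    ℚᵘ.mkℚᵘ (ℤ.+ m) n                               ≈⟨ ℚᵘ.*≡* (cong₂ (ℤ._*_) (sym (ℤ.*-identityʳ (ℤ.+ m))) (ℤ.*-identityˡ (ℤ.+ suc n))) ⟩
    ℚᵘ.mkℚᵘ (ℤ.+ m) 0 ℚᵘ.* ℚᵘ.mkℚᵘ (ℤ.+ 1) n          ≈⟨ ℚᵘ.*-cong (ℚᵘ.≃-sym (ℚ.toℚᵘ-fromℚᵘ (ℚᵘ.mkℚᵘ (ℤ.+ m) 0))) (ℚᵘ.≃-sym (ℚ.toℚᵘ-fromℚᵘ (ℚᵘ.mkℚᵘ (ℤ.+ 1) n))) ⟩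
    ℚ.toℚᵘ (fromℕ m) ℚᵘ.* ℚ.toℚᵘ (1/suc n)        ≈⟨ ℚᵘ.≃-sym (ℚ.toℚᵘ-homo-* (fromℕ m) (1/suc n)) ⟩
    ℚ.toℚᵘ (fromℕ m * 1/suc n)                    ∎)
    where open ℚᵘ.≃-Reasoning

  module LazyMetropolis {N} (H : Graph N) where

    M : Matrix N
    M = moveProbability H

    degree-pos : ∀ {v u} → Adj H v u → ∃ λ a → degree H v ≡ suc a
    degree-pos {v} {u} e with degree H v | List.∈-length (List.∈-filter⁺ (adj? H v) (List.∈-allFin u) e)
    ... | suc a | _ = a , refl

    -- Multiplying 1/deg v into the minimum gives an expression symmetric in the two degrees:
    -- detailed balance for the uniform distribution.
    M-adj : ∀ {v u a b} → Adj H v u → degree H v ≡ suc a → degree H u ≡ suc b →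
            M v u ≡ ½ * (1/suc a ⊓ 1/suc b)
    M-adj {v} {u} {a} {b} e dv du with adj? H v u
    ... | no ¬e = contradiction e ¬e
    ... | yes _ rewrite dv | du = trans (ℚ.*-assoc ½ (1/suc a) _)
      (cong (½ *_) (trans (ℚ.*-distribˡ-⊓-nonNeg (1/suc a) {{nonNegative (<⇒≤ (0<1/suc a))}} 1ℚ (suc a ÷₀ suc b))
        (cong₂ _⊓_ (ℚ.*-identityʳ (1/suc a))
          (trans (cong (1/suc a *_) (÷₀≡* (suc a) b))
            (trans (solve 3 (λ i A j → i :* (A :* j) := A :* i :* j) refl (1/suc a) (fromℕ (suc a)) (1/suc b))
              (trans (cong (_* 1/suc b) (suc*1/suc a)) (ℚ.*-identityˡ (1/suc b))))))))

    M-nonadj : ∀ {v u} → ¬ Adj H v u → M v u ≡ 0ℚ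
    M-nonadj {v} {u} ¬e with adj? H v u
    ... | yes e = contradiction e ¬e
    ... | no  _ = refl

    M-sym : ∀ v u → M v u ≡ M u v
    M-sym v u = go (adj? H v u)
      where
      go : Dec (Adj H v u) → M v u ≡ M u v
      go (no ¬e) = trans (M-nonadj ¬e) (sym (M-nonadj λ e → ¬e (symm H e)))
      go (yes e) =
        let a , da = degree-pos e ; b , db = degree-pos (symm H e)
        in trans (M-adj e da db) (trans (cong (½ *_) (ℚ.⊓-comm (1/suc a) (1/suc b)))
             (sym (M-adj (symm H e) db da)))

    M≥0 : ∀ v u → 0ℚ ≤ M v u
    M≥0 v u = go (adj? H v u)
      where
      go : Dec (Adj H v u) → 0ℚ ≤ M v u
      go (no ¬e) = ≤-reflexive (sym (M-nonadj ¬e))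
      go (yes e) =
        let a , da = degree-pos e ; b , db = degree-pos (symm H e)
        in subst (0ℚ ≤_) (sym (M-adj e da db))
             (*-nonNeg 0≤½ (ℚ.⊓-glb (<⇒≤ (0<1/suc a)) (<⇒≤ (0<1/suc b))))

    row≤½ : ∀ v → sum (M v) ≤ ½
    row≤½ v with degree H v in dv
    ... | zero = ≤-trans (≤-reflexive (trans
        (sum-cong-≗ {N} {M v} λ u → M-nonadj λ e → ℕ.0≢1+n (trans (sym dv) (proj₂ (degree-pos e))))
        (sum-zero N))) 0≤½
    ... | suc a = ≤-trans (sum-mono bound) (≤-reflexive (trans
        (sum-when (adj? H v) (½ * 1/suc a) (λ u → u))
        (trans (cong (λ d → fromℕ d * (½ * 1/suc a)) dv)
          (trans (solve 2 (λ A i → A :* (con ½ :* i) := con ½ :* (A :* i)) refl (fromℕ (suc a)) (1/suc a))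
            (trans (cong (½ *_) (suc*1/suc a)) (ℚ.*-identityʳ ½))))))
      where
      bound : ∀ u → M v u ≤ when (adj? H v u) (½ * 1/suc a)
      bound u = go (adj? H v u)
        where
        go : (d : Dec (Adj H v u)) → M v u ≤ when d (½ * 1/suc a)
        go (no ¬e) = ≤-reflexive (M-nonadj ¬e)
        go (yes e) =
          let b , db = degree-pos (symm H e)
          in ≤-trans (≤-reflexive (M-adj e dv db)) (*-monoˡ 0≤½ (ℚ.p⊓q≤p (1/suc a) (1/suc b)))

    M-edge : ∀ {d} → (∀ v → degree H v ℕ.≤ d) → ∀ {v u} → Adj H v u →
             1ℚ ≤ (1ℚ + 1ℚ) * fromℕ d * M v u
    M-edge {d} deg≤d {v} {u} e =
      let a , da = degree-pos e ; b , db = degree-pos (symm H e)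
      in subst (1ℚ ≤_)
           (trans (solve 2 (λ d m → d :* m := con (1ℚ + 1ℚ) :* d :* (con ½ :* m)) refl (fromℕ d) (1/suc a ⊓ 1/suc b))
             (cong ((1ℚ + 1ℚ) * fromℕ d *_) (sym (M-adj e da db))))
           (subst (1ℚ ≤_)
             (sym (ℚ.*-distribˡ-⊓-nonNeg (fromℕ d) {{nonNegative (0≤fromℕ d)}} (1/suc a) (1/suc b)))
             (ℚ.⊓-glb (1≤ a (subst (ℕ._≤ d) da (deg≤d v))) (1≤ b (subst (ℕ._≤ d) db (deg≤d u)))))
      where
      1≤ : ∀ a → suc a ℕ.≤ d → 1ℚ ≤ fromℕ d * 1/suc a
      1≤ a a<d = subst (_≤ fromℕ d * 1/suc a) (suc*1/suc a)
        (*-monoʳ (<⇒≤ (0<1/suc a)) (fromℕ-mono-≤ a<d))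

    open Form M M-sym M≥0 row≤½ using (step)

    -- The holding probability 1 - m turns the weighted average into `f v` plus weighted
    -- differences. On the diagonal `M` vanishes, because no state is adjacent to itself.
    lazyMetropolis-step : ∀ f v → sum (λ u → lazyMetropolis H v u * f u) ≡ step f v
    lazyMetropolis-step f v = trans
      (trans (sum-cong-≗ entry) (sum-axpy (1ℚ - m) (λ u → identity v u * f u) (λ u → M v u * f u)))
      (trans (cong (λ s → (1ℚ - m) * s + sum (λ u → M v u * f u)) (sum-identity v f))
        (trans (solve 3 (λ m a s → (con 1ℚ :- m) :* a :+ s := a :+ (:- a :* m :+ s)) refl m (f v) (sum (λ u → M v u * f u)))
          (cong (λ s → f v + s) (trans (sym (sum-axpy (- f v) (M v) (λ u → M v u * f u)))
            (sum-cong-≗ λ u → solve 3 (λ m a b → :- a :* m :+ m :* b := m :* (b :- a)) refl (M v u) (f v) (f u))))))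
      where
      m = sum (M v)
      entry : ∀ u → lazyMetropolis H v u * f u ≡ (1ℚ - m) * (identity v u * f u) + M v u * f u
      entry u with v ≟ u
      ... | no  _    = solve 3 (λ m p a → p :* a := (con 1ℚ :- m) :* (con 0ℚ :* a) :+ p :* a) refl m (M v u) (f u)
      ... | yes refl = trans
        (solve 2 (λ m a → (con 1ℚ :- m) :* a := (con 1ℚ :- m) :* (con 1ℚ :* a) :+ con 0ℚ :* a) refl m (f v))
        (cong (λ p → (1ℚ - m) * (1ℚ * f v) + p * f v) (sym (M-nonadj (irrefl H))))

  -- The exponential

  fromℕ-+ : ∀ m n → fromℕ (m ℕ.+ n) ≡ fromℕ m + fromℕ n
  fromℕ-+ zero    n = sym (ℚ.+-identityˡ (fromℕ n))
  fromℕ-+ (suc m) n = trans (fromℕ-suc (m ℕ.+ n)) (trans (cong (λ s → 1ℚ + s) (fromℕ-+ m n))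
    (trans (sym (ℚ.+-assoc 1ℚ (fromℕ m) (fromℕ n))) (cong (λ s → s + fromℕ n) (sym (fromℕ-suc m)))))

  fromℕ-* : ∀ m n → fromℕ (m ℕ.* n) ≡ fromℕ m * fromℕ n
  fromℕ-* zero    n = sym (ℚ.*-zeroˡ (fromℕ n))
  fromℕ-* (suc m) n = trans (fromℕ-+ n (m ℕ.* n)) (trans (cong (λ s → fromℕ n + s) (fromℕ-* m n))
    (trans (solve 2 (λ m n → n :+ m :* n := (con 1ℚ :+ m) :* n) refl (fromℕ m) (fromℕ n))
      (cong (_* fromℕ n) (sym (fromℕ-suc m)))))

  fromℕ-^ : ∀ m k → fromℕ (m ℕ.^ k) ≡ fromℕ m ^ k
  fromℕ-^ m zero    = refl
  fromℕ-^ m (suc k) = trans (fromℕ-* m (m ℕ.^ k)) (cong (fromℕ m *_) (fromℕ-^ m k))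

  -- Every admissible `m` gives an upper bound (1 - p/M)⁻ᴹ of the exponential. The freedom in `m`
  -- matters: `decay` takes M to be the number of steps plus one.
  <exp⇒*≤1 : ∀ {x p} m → x <exp p → 0ℚ < 1ℚ - p * 1/suc m →
             x * (1ℚ - p * 1/suc m) ^ suc m ≤ 1ℚ
  <exp⇒*≤1 {x} {p} m x<eᵖ 0<s = ℚ.≮⇒≥ λ 1<xsᴹ →
    ℚ.<-irrefl refl (<exp<-trans {x} {x} {p} x<eᵖ (m , 0<s , 1<xsᴹ))

  exp<∧<exp⇒≤ : ∀ {x p q} → p exp< x → x <exp q → p ≤ q
  exp<∧<exp⇒≤ {x} {p} {q} eᵖ<x x<e^q = ℚ.≮⇒≥ λ q<p →
    ℚ.<-irrefl refl (<exp<-trans {x} {x} {p} (<exp-up {q} {p} {x} q<p x<e^q) eᵖ<x)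

  1<⇒0exp< : ∀ {x} → 1ℚ < x → 0ℚ exp< x
  1<⇒0exp< {x} 1<x = 0 , 0<1 , subst (1ℚ <_) (sym (ℚ.*-identityʳ x)) 1<x

  -- Already M = 1 gives exp ½ ≤ 2 < 3. The value ½ is chosen because k ≥ 2 then makes k ln n at
  -- least 1, which lets a fixed ln ε⁻¹ be absorbed.
  ½exp<fromℕ : ∀ {n} → 3 ℕ.≤ n → ½ exp< fromℕ n
  ½exp<fromℕ {n} 3≤n = 0 , ℚ.positive⁻¹ (1ℚ - ½ * 1ℚ) ,
    ℚ.<-≤-trans {1ℚ} {fromℕ 3 * (1ℚ - ½ * 1ℚ) ^ 1} (diff⁻ (ℚ.positive⁻¹ (fromℕ 3 * (1ℚ - ½ * 1ℚ) ^ 1 - 1ℚ)))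
      (*-monoʳ (ℚ.nonNegative⁻¹ ((1ℚ - ½ * 1ℚ) ^ 1)) (fromℕ-mono-≤ 3≤n))

  ≤⇒0<1- : ∀ {p q} → p ≤ q → 0ℚ < 1ℚ - q → 0ℚ < 1ℚ - p
  ≤⇒0<1- p≤q h = ℚ.<-≤-trans h (ℚ.+-monoʳ-≤ 1ℚ (ℚ.neg-antimono-≤ p≤q))

  -- 1 - γ ≤ 1 - (k b + c) / M ≤ (1 - b / M)ᵏ (1 - c / M) for M = l + 1.
  decay : ∀ {n a z b c γ} k l → 0 ℕ.< n → 0 ℕ.< k → 0ℚ ≤ b → 0ℚ ≤ c →
          fromℕ n <exp b → z <exp c → 0ℚ < a → 1ℚ < a * z → 0ℚ < 1ℚ - γ →
          fromℕ k * b + c ≤ γ * fromℕ (suc l) →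
          fromℕ n ^ k * (1ℚ - γ) ^ suc l ≤ a
  decay {n} {a} {z} {b} {c} {γ} k l 0<n 0<k 0≤b 0≤c n<eᵇ z<eᶜ 0<a 1<az 0<1-γ le = ≤-trans
    (*-monoˡ (<⇒≤ (^-pos k 0<fn)) (^-mono-≤ (suc l) 0<1-γ 1-γ≤))
    (≤-trans (≤-reflexive regroup)
      (≤-trans (*-mono-≤-pos (<⇒≤ (^-pos k (*-pos 0<fn (^-pos (suc l) 0<1-p)))) (<⇒≤ 0<a) nᵏ≤1 w≤a)
        (≤-reflexive (ℚ.*-identityˡ a))))
    where
    i = 1/suc l
    p = b * i
    q = c * i
    0≤i = <⇒≤ (0<1/suc l)
    0≤p = *-nonNeg 0≤b 0≤i
    0≤q = *-nonNeg 0≤c 0≤i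
    0<fn : 0ℚ < fromℕ n
    0<fn = ℚ.<-≤-trans 0<1 (fromℕ-mono-≤ 0<n)

    kp+q≤γ : fromℕ k * p + q ≤ γ
    kp+q≤γ = ≤-trans
      (≤-reflexive (solve 4 (λ k b c i → k :* (b :* i) :+ c :* i := (k :* b :+ c) :* i) refl (fromℕ k) b c i))
      (≤-trans (*-monoʳ 0≤i le) (≤-reflexive (*1/suc*suc γ l)))

    kp≤ : fromℕ k * p ≤ fromℕ k * p + q
    kp≤ = subst (_≤ fromℕ k * p + q) (ℚ.+-identityʳ _) (ℚ.+-monoʳ-≤ (fromℕ k * p) 0≤q)
    p≤kp : p ≤ fromℕ k * p
    p≤kp = subst (_≤ fromℕ k * p) (ℚ.*-identityˡ p) (*-monoʳ 0≤p (fromℕ-mono-≤ 0<k))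
    q≤ : q ≤ fromℕ k * p + q
    q≤ = subst (_≤ fromℕ k * p + q) (ℚ.+-identityˡ q)
      (ℚ.+-monoˡ-≤ q (*-nonNeg (0≤fromℕ k) 0≤p))

    0<1-p : 0ℚ < 1ℚ - p
    0<1-p = ≤⇒0<1- (≤-trans p≤kp (≤-trans kp≤ kp+q≤γ)) 0<1-γ
    0<1-q : 0ℚ < 1ℚ - q
    0<1-q = ≤⇒0<1- (≤-trans q≤ kp+q≤γ) 0<1-γ

    1-γ≤ : 1ℚ - γ ≤ (1ℚ - p) ^ k * (1ℚ - q)
    1-γ≤ = ≤-trans (ℚ.+-monoʳ-≤ 1ℚ (ℚ.neg-antimono-≤ kp+q≤γ))
      (≤-trans (0≤q-p⇒p≤q (subst (0ℚ ≤_)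
          (solve 3 (λ k p q → k :* p :* q := (con 1ℚ :+ k :* (:- p)) :* (con 1ℚ :- q) :- (con 1ℚ :- (k :* p :+ q)))
            refl (fromℕ k) p q)
          (*-nonNeg (*-nonNeg (0≤fromℕ k) 0≤p) 0≤q)))
        (*-monoʳ (<⇒≤ 0<1-q) (bernoulli k 0<1-p)))

    v = (1ℚ - p) ^ suc l
    w = (1ℚ - q) ^ suc l

    regroup : fromℕ n ^ k * ((1ℚ - p) ^ k * (1ℚ - q)) ^ suc l ≡ (fromℕ n * v) ^ k * w
    regroup = trans
      (cong (fromℕ n ^ k *_) (trans (^-distrib-* ((1ℚ - p) ^ k) (1ℚ - q) (suc l))
        (cong (_* w) (trans (^-assocʳ (1ℚ - p) k (suc l))
          (trans (cong ((1ℚ - p) ^_) (ℕ.*-comm k (suc l))) (sym (^-assocʳ (1ℚ - p) (suc l) k)))))))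
      (trans (sym (ℚ.*-assoc (fromℕ n ^ k) (v ^ k) w))
        (cong (_* w) (sym (^-distrib-* (fromℕ n) v k))))

    nᵏ≤1 : (fromℕ n * v) ^ k ≤ 1ℚ
    nᵏ≤1 = subst ((fromℕ n * v) ^ k ≤_) (1^n≡1 k)
      (^-mono-≤ k (*-pos 0<fn (^-pos (suc l) 0<1-p)) (<exp⇒*≤1 {fromℕ n} {b} l n<eᵇ 0<1-p))

    w≤a : w ≤ a
    w≤a = ≤-trans
      (≤-trans (≤-reflexive (sym (ℚ.*-identityˡ w))) (*-monoʳ (<⇒≤ (^-pos (suc l) 0<1-q)) (<⇒≤ 1<az)))
      (≤-trans (≤-reflexive (ℚ.*-assoc a z w))
        (≤-trans (*-monoˡ (<⇒≤ 0<a) (<exp⇒*≤1 {z} {c} l z<eᶜ 0<1-q)) (≤-reflexive (ℚ.*-identityʳ a))))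

module Combinatorics where

  open import Relation.Binary.Construct.Closure.ReflexiveTransitive as Star using (Star; ε; _◅_; _◅◅_)
  open import Data.Fin.Subset.Properties
  open import Data.Nat using (_+_; _*_; _^_; _≤_; _<_; z≤n; s≤s)
  open Subset using (Subset; inside; outside; _∈_; _∉_; _⊆_; _∪_; _∩_; _-_; ⊥; ⁅_⁆; ∣_∣; Nonempty)

  -- Connected vertex sets

  x∉p-x : ∀ {n} (p : Subset n) x → x ∉ p - x
  x∉p-x (s ∷ p) (suc x) (there h) = x∉p-x p x h

  ∈-remove⁻ : ∀ {n} (p : Subset n) x {y} → y ∈ p - x → y ∈ p × y ≢ x
  ∈-remove⁻ p x h = p─q⊆p p ⁅ x ⁆ h , λ { refl → x∉p-x p x h }

  ∈-insert⁺ : ∀ {n} (p : Subset n) x → x ∈ p ∪ ⁅ x ⁆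
  ∈-insert⁺ p x = q⊆p∪q p ⁅ x ⁆ (x∈⁅x⁆ x)

  ⊆-insert : ∀ {n} (p : Subset n) x → p ⊆ p ∪ ⁅ x ⁆
  ⊆-insert p x = p⊆p∪q {p = p} ⁅ x ⁆

  ∈-insert⁻ : ∀ {n} (p : Subset n) x {y} → y ∈ p ∪ ⁅ x ⁆ → y ∈ p ⊎ y ≡ x
  ∈-insert⁻ p x h with x∈p∪q⁻ p ⁅ x ⁆ h
  ... | inj₁ y∈p = inj₁ y∈p
  ... | inj₂ y∈x = inj₂ (x∈⁅y⁆⇒x≡y x y∈x)

  insert-⊆ : ∀ {n} (p q : Subset n) x → p ⊆ q → x ∈ q → p ∪ ⁅ x ⁆ ⊆ q
  insert-⊆ p q x p⊆q x∈q h = [ p⊆q , (λ eq → subst (_∈ q) (sym eq) x∈q) ]′ (∈-insert⁻ p x h)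

  singleton-⊆ : ∀ {n} (p : Subset n) x → x ∈ p → ⁅ x ⁆ ⊆ p
  singleton-⊆ p x x∈p h = subst (_∈ p) (sym (x∈⁅y⁆⇒x≡y x h)) x∈p

  ∣p∣≡1+∣p-x∣ : ∀ {n} (p : Subset n) x → x ∈ p → ∣ p ∣ ≡ suc ∣ p - x ∣
  ∣p∣≡1+∣p-x∣ (inside ∷ p)  zero    here      = cong (suc ∘ ∣_∣) (sym (p─⊥≡p p))
  ∣p∣≡1+∣p-x∣ (inside ∷ p)  (suc x) (there h) = cong suc (∣p∣≡1+∣p-x∣ p x h)
  ∣p∣≡1+∣p-x∣ (outside ∷ p) (suc x) (there h) = ∣p∣≡1+∣p-x∣ p x h

  insert-remove : ∀ {n} (p : Subset n) x → x ∉ p → (p ∪ ⁅ x ⁆) - x ≡ p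
  insert-remove p x x∉p = ⊆-antisym
    (λ h → let h′ , y≢x = ∈-remove⁻ (p ∪ ⁅ x ⁆) x h in
      [ id , (λ y≡x → contradiction y≡x y≢x) ]′ (∈-insert⁻ p x h′))
    (λ h → x∈p∧x≢y⇒x∈p-y (⊆-insert p x h) λ { refl → x∉p h })

  remove-insert : ∀ {n} (p : Subset n) x → x ∈ p → (p - x) ∪ ⁅ x ⁆ ≡ p
  remove-insert p x x∈p = ⊆-antisym (insert-⊆ (p - x) p x (p─q⊆p p ⁅ x ⁆) x∈p) from
    where
    from : p ⊆ (p - x) ∪ ⁅ x ⁆
    from {y} h with y ≟ x
    ... | yes refl = ∈-insert⁺ (p - x) x
    ... | no  y≢x  = ⊆-insert (p - x) x (x∈p∧x≢y⇒x∈p-y h y≢x)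

  ∣p∪x∣≡1+∣p∣ : ∀ {n} (p : Subset n) x → x ∉ p → ∣ p ∪ ⁅ x ⁆ ∣ ≡ suc ∣ p ∣
  ∣p∪x∣≡1+∣p∣ p x x∉p = trans (∣p∣≡1+∣p-x∣ (p ∪ ⁅ x ⁆) x (∈-insert⁺ p x))
    (cong (λ q → suc ∣ q ∣) (insert-remove p x x∉p))

  ∣p∣<∣q∣⇒∃ : ∀ {n} (p q : Subset n) → ∣ p ∣ < ∣ q ∣ → ∃ λ x → x ∈ q × x ∉ p
  ∣p∣<∣q∣⇒∃ p q lt with any? (λ x → (x ∈? q) ×-dec ¬? (x ∈? p))
  ... | yes e = e
  ... | no ¬e = contradiction
    (p⊆q⇒∣p∣≤∣q∣ {p = q} {p} λ {x} x∈q → decidable-stable (x ∈? p) λ x∉p → ¬e (x , x∈q , x∉p))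
    (ℕ.<⇒≱ lt)

  ⊆∧∣∣≤⇒≡ : ∀ {n} (p q : Subset n) → p ⊆ q → ∣ q ∣ ≤ ∣ p ∣ → p ≡ q
  ⊆∧∣∣≤⇒≡ p q p⊆q le = ⊆-antisym p⊆q λ {x} x∈q →
    decidable-stable (x ∈? p) λ x∉p → ℕ.<⇒≱ (p⊂q⇒∣p∣<∣q∣ {p = p} {q} (p⊆q , x , x∈q , x∉p)) le

  0<∣p∣⇒Nonempty : ∀ {n} (p : Subset n) → 0 < ∣ p ∣ → Nonempty p
  0<∣p∣⇒Nonempty {n} p lt =
    let x , x∈p , _ = ∣p∣<∣q∣⇒∃ ⊥ p (subst (_< ∣ p ∣) (sym (∣⊥∣≡0 n)) lt) in x , x∈p

  module _ {n} (G : Graph n) where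

    connectedOn-mono : ∀ {S T u v} → S ⊆ T → Star (InducedAdj G S) u v → Star (InducedAdj G T) u v
    connectedOn-mono S⊆T = Star.map λ (a , b , e) → S⊆T a , S⊆T b , e

    connectedOn-singleton : ∀ x → ConnectedOn G ⁅ x ⁆
    connectedOn-singleton x u v u∈ v∈ with x∈⁅y⁆⇒x≡y x u∈ | x∈⁅y⁆⇒x≡y x v∈
    ... | refl | refl = ε

    connectedOn-insert : ∀ S {a} v → ConnectedOn G S → a ∈ S → Adj G a v → ConnectedOn G (S ∪ ⁅ v ⁆)
    connectedOn-insert S {a} v conn a∈S e u w u∈ w∈ with ∈-insert⁻ S v u∈ | ∈-insert⁻ S v w∈
    ... | inj₁ u∈S  | inj₁ w∈S  = connectedOn-mono (⊆-insert S v) (conn u w u∈S w∈S)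
    ... | inj₁ u∈S  | inj₂ refl = connectedOn-mono (⊆-insert S v) (conn u a u∈S a∈S)
                                    ◅◅ ((⊆-insert S v a∈S , ∈-insert⁺ S v , e) ◅ ε)
    ... | inj₂ refl | inj₁ w∈S  = (∈-insert⁺ S v , ⊆-insert S v a∈S , symm G e)
                                    ◅ connectedOn-mono (⊆-insert S v) (conn a w a∈S w∈S)
    ... | inj₂ refl | inj₂ refl = ε

    exit : ∀ {A X a x} → a ∈ A → x ∉ A → Star (InducedAdj G X) a x →
           ∃₂ λ p v → p ∈ A × v ∈ X × v ∉ A × Adj G p v
    exit a∈A x∉A ε = contradiction a∈A x∉A
    exit {A} {a = a} a∈A x∉A (_◅_ {j = b} (_ , b∈X , e) p) with b ∈? A
    ... | yes b∈A = exit b∈A x∉A p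
    ... | no  b∉A = a , b , a∈A , b∈X , b∉A , e

    grow : ∀ A X {a} → A ⊆ X → ConnectedOn G X → a ∈ A → ∣ A ∣ < ∣ X ∣ →
           ∃₂ λ p v → p ∈ A × v ∈ X × v ∉ A × Adj G p v
    grow A X {a} A⊆X connX a∈A lt =
      let x , x∈X , x∉A = ∣p∣<∣q∣⇒∃ A X lt in exit a∈A x∉A (connX a x (A⊆X a∈A) x∈X)

    -- Grow A inside X one vertex at a time: the last vertex added is not a cut vertex.
    noncutVertex-aux : ∀ m A X {a} → ∣ X ∣ ≡ suc (m + ∣ A ∣) → A ⊆ X → ConnectedOn G A → a ∈ A →
                       ConnectedOn G X → ∃ λ x → x ∈ X × x ∉ A × ConnectedOn G (X - x)
    noncutVertex-aux m A X {a} ∣X∣ A⊆X connA a∈A connX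
      with grow A X A⊆X connX a∈A (ℕ.≤-trans (s≤s (ℕ.m≤n+m ∣ A ∣ m)) (ℕ.≤-reflexive (sym ∣X∣)))
    ... | p , v , p∈A , v∈X , v∉A , e = go m ∣X∣
      where
      A⁺ = A ∪ ⁅ v ⁆
      A⁺⊆X : A⁺ ⊆ X
      A⁺⊆X = insert-⊆ A X v A⊆X v∈X
      go : ∀ m → ∣ X ∣ ≡ suc (m + ∣ A ∣) → ∃ λ x → x ∈ X × x ∉ A × ConnectedOn G (X - x)
      go zero ∣X∣ = v , v∈X , v∉A , subst (ConnectedOn G) A≡X-v connA
        where
        A≡X-v : A ≡ X - v
        A≡X-v = trans (sym (insert-remove A v v∉A)) (cong (_- v)
          (⊆∧∣∣≤⇒≡ A⁺ X A⁺⊆X (ℕ.≤-reflexive (trans ∣X∣ (sym (∣p∪x∣≡1+∣p∣ A v v∉A))))))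
      go (suc m) ∣X∣ =
        let x , x∈X , x∉A⁺ , conn = noncutVertex-aux m A⁺ X
              (trans ∣X∣ (cong suc (trans (sym (ℕ.+-suc m ∣ A ∣)) (cong (m +_) (sym (∣p∪x∣≡1+∣p∣ A v v∉A))))))
              A⁺⊆X (connectedOn-insert A v connA p∈A e) (⊆-insert A v a∈A) connX
        in x , x∈X , (λ x∈A → x∉A⁺ (⊆-insert A v x∈A)) , conn

    noncutVertex : ∀ A X {a} → ∣ A ∣ < ∣ X ∣ → A ⊆ X → ConnectedOn G A → a ∈ A →
                   ConnectedOn G X → ∃ λ x → x ∈ X × x ∉ A × ConnectedOn G (X - x)
    noncutVertex A X lt = noncutVertex-aux (∣ X ∣ ℕ.∸ suc ∣ A ∣) A X
      (trans (sym (ℕ.m∸n+n≡m lt)) (ℕ.+-suc _ ∣ A ∣))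

  -- Enumerating the states

  ∈-allSubsets : ∀ {n} (S : Subset n) → S List.∈ allSubsets n
  ∈-allSubsets []            = Any.here refl
  ∈-allSubsets (outside ∷ S) = List.∈-++⁺ˡ (List.∈-map⁺ (outside ∷_) (∈-allSubsets S))
  ∈-allSubsets (inside ∷ S)  = List.∈-++⁺ʳ _ (List.∈-map⁺ (inside ∷_) (∈-allSubsets S))

  allSubsets-unique : ∀ n → Unique (allSubsets n)
  allSubsets-unique zero    = [] ∷ []
  allSubsets-unique (suc n) = Unique.++⁺
    (Unique.map⁺ ∷-injectiveʳ (allSubsets-unique n)) (Unique.map⁺ ∷-injectiveʳ (allSubsets-unique n))
    λ (a , b) → clash (proj₂ (proj₂ (List.∈-map⁻ (outside ∷_) a))) (proj₂ (proj₂ (List.∈-map⁻ (inside ∷_) b)))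
    where
    clash : ∀ {S : Subset (suc n)} {A B} → S ≡ outside ∷ A → ¬ (S ≡ inside ∷ B)
    clash refl ()

  lookup-injective : ∀ {A : Set} {xs : List A} → Unique xs → ∀ {i j} → lookup xs i ≡ lookup xs j → i ≡ j
  lookup-injective (_ ∷ _)  {zero}  {zero}  _  = refl
  lookup-injective {xs = _ ∷ xs} (x∉ ∷ _) {zero}  {suc j} eq = contradiction eq (All.lookup x∉ (List.∈-lookup {xs = xs} j))
  lookup-injective {xs = _ ∷ xs} (x∉ ∷ _) {suc i} {zero}  eq = contradiction (sym eq) (All.lookup x∉ (List.∈-lookup {xs = xs} i))
  lookup-injective (_ ∷ u)  {suc i} {suc j} eq = cong suc (lookup-injective u eq)

  walkLength-◅◅ : ∀ {A : Set} {R : A → A → Set} {u v w} (p : Star R u v) (q : Star R v w) →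
                  walkLength (p ◅◅ q) ≡ walkLength p + walkLength q
  walkLength-◅◅ ε       q = refl
  walkLength-◅◅ (_ ◅ p) q = cong suc (walkLength-◅◅ p q)

  -- Walks in the state graph

  module States {n} (G : Graph n) (k : ℕ) where

    H = stateGraph G k

    ∣state∣ : ∀ i → ∣ state G k i ∣ ≡ k
    ∣state∣ i = proj₁ (state-isConnectedSubgraph G k i)

    state-connected : ∀ i → ConnectedOn G (state G k i)
    state-connected i = proj₂ (state-isConnectedSubgraph G k i)

    state-injective : ∀ {i j} → state G k i ≡ state G k j → i ≡ j
    state-injective = lookup-injective (Unique.filter⁺ (isConnectedSubgraph? G k) (allSubsets-unique n))

    ∈-states : ∀ {S} → IsConnectedSubgraph G k S → S List.∈ states G k
    ∈-states h = List.∈-filter⁺ (isConnectedSubgraph? G k) (∈-allSubsets _) h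

    state-surjective : ∀ {S} → IsConnectedSubgraph G k S → ∃ λ i → S ≡ state G k i
    state-surjective h = Any.index (∈-states h) , lookup-index (∈-states h)

    Reach : ℕ → Fin (numStates G k) → Fin (numStates G k) → Set
    Reach m i j = ∃ λ (p : Star (Adj H) i j) → walkLength p ≤ m

    reach-trans : ∀ {l m i j j′} → Reach l i j → Reach m j j′ → Reach (l + m) i j′
    reach-trans (p , p≤l) (q , q≤m) =
      p ◅◅ q , ℕ.≤-trans (ℕ.≤-reflexive (walkLength-◅◅ p q)) (ℕ.+-mono-≤ p≤l q≤m)

    -- If `v` is missing, it is traded for a noncut vertex of the state outside `A`. What remains is
    -- connected and still contains `p`, to which `v` attaches, so one move keeps `A` and gains `v`.
    absorb : ∀ A {p} v i → A ⊆ state G k i → ConnectedOn G A → ∣ A ∣ < k → p ∈ A → Adj G p v →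
             ∃ λ j → A ∪ ⁅ v ⁆ ⊆ state G k j × Reach 1 i j
    absorb A {p} v i A⊆X connA lt p∈A e with v ∈? state G k i
    ... | yes v∈X = i , insert-⊆ A (state G k i) v A⊆X v∈X , ε , z≤n
    ... | no  v∉X = exchange
      (noncutVertex G A X (subst (∣ A ∣ <_) (sym (∣state∣ i)) lt) A⊆X connA p∈A (state-connected i))
      where
      X = state G k i
      exchange : (∃ λ x → x ∈ X × x ∉ A × ConnectedOn G (X - x)) →
                 ∃ λ j → A ∪ ⁅ v ⁆ ⊆ state G k j × Reach 1 i j
      exchange (x , x∈X , x∉A , conn) =
        let j , eq = state-surjective (∣Y∣ , connectedOn-insert G (X - x) v conn (A⊆X-x p∈A) e)
        in j , subst (A ∪ ⁅ v ⁆ ⊆_) eq A⁺⊆Y , (adj j eq ◅ ε) , ℕ.≤-refl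
        where
        Y = (X - x) ∪ ⁅ v ⁆
        A⊆X-x : A ⊆ X - x
        A⊆X-x y∈A = x∈p∧x≢y⇒x∈p-y (A⊆X y∈A) λ { refl → x∉A y∈A }
        A⁺⊆Y : A ∪ ⁅ v ⁆ ⊆ Y
        A⁺⊆Y = insert-⊆ A Y v (λ y∈A → ⊆-insert (X - x) v (A⊆X-x y∈A)) (∈-insert⁺ (X - x) v)
        ∣X-x∣ : suc ∣ X - x ∣ ≡ k
        ∣X-x∣ = trans (sym (∣p∣≡1+∣p-x∣ X x x∈X)) (∣state∣ i)
        ∣Y∣ : ∣ Y ∣ ≡ k
        ∣Y∣ = trans (∣p∪x∣≡1+∣p∣ (X - x) v (λ h → v∉X (p─q⊆p X ⁅ x ⁆ h))) ∣X-x∣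
        X∩Y : X ∩ Y ≡ X - x
        X∩Y = ⊆-antisym
          (λ h → let y∈X , y∈Y = x∈p∩q⁻ X Y h in
            [ id , (λ y≡v → contradiction (subst (_∈ X) y≡v y∈X) v∉X) ]′ (∈-insert⁻ (X - x) v y∈Y))
          (λ h → x∈p∩q⁺ (p─q⊆p X ⁅ x ⁆ h , ⊆-insert (X - x) v h))
        adj : ∀ j → Y ≡ state G k j → Adj H i j
        adj j eq = trans (cong (λ Z → suc ∣ X ∩ Z ∣) (sym eq)) (trans (cong (λ Z → suc ∣ Z ∣) X∩Y) ∣X-x∣)

    -- Each edge of the walk costs at most one move. With k > 1 the singleton of the current vertex
    -- is smaller than the state, so some other vertex can be given up.
    moveAlong : 1 < k → ∀ {s t} (p : Walk G s t) i → s ∈ state G k i →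
                ∃ λ j → t ∈ state G k j × Reach (walkLength p) i j
    moveAlong 1<k ε i s∈X = i , s∈X , ε , z≤n
    moveAlong 1<k (_◅_ {s} {s′} e p) i s∈X =
      let j , A⊆Y , r = absorb ⁅ s ⁆ s′ i (singleton-⊆ (state G k i) s s∈X)
                          (connectedOn-singleton G s) (subst (_< k) (sym (∣⁅x⁆∣≡1 s)) 1<k) (x∈⁅x⁆ s) e
          j′ , t∈Z , r′ = moveAlong 1<k p j (A⊆Y (∈-insert⁺ ⁅ s ⁆ s′))
      in j′ , t∈Z , reach-trans r r′

    -- `A` is a connected part common to both states, and `m` counts the vertices still missing. The
    -- next one is chosen inside the target and adjacent to `A`, so it costs at most one move;
    -- starting from a singleton this takes k - 1 moves.
    fillUp : ∀ m A {a} i t → m + ∣ A ∣ ≡ k → A ⊆ state G k i → A ⊆ state G k t → ConnectedOn G A → a ∈ A →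
             Reach m i t
    fillUp zero A i t ∣A∣ A⊆X A⊆T connA a∈A = subst (Reach 0 i) (state-injective
      (trans (sym (⊆∧∣∣≤⇒≡ A (state G k i) A⊆X (le i))) (⊆∧∣∣≤⇒≡ A (state G k t) A⊆T (le t)))) (ε , z≤n)
      where
      le : ∀ j → ∣ state G k j ∣ ≤ ∣ A ∣
      le j = ℕ.≤-reflexive (trans (∣state∣ j) (sym ∣A∣))
    fillUp (suc m) A i t ∣A∣ A⊆X A⊆T connA a∈A =
      let p , v , p∈A , v∈T , v∉A , e =
            grow G A (state G k t) A⊆T (state-connected t) a∈A (subst (∣ A ∣ <_) (sym (∣state∣ t)) lt)
          j , A⁺⊆Y , r = absorb A v i A⊆X connA lt p∈A e
      in reach-trans r (fillUp m (A ∪ ⁅ v ⁆) j t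
           (trans (cong (m +_) (∣p∪x∣≡1+∣p∣ A v v∉A)) (trans (ℕ.+-suc m ∣ A ∣) ∣A∣))
           A⁺⊆Y (insert-⊆ A (state G k t) v A⊆T v∈T) (connectedOn-insert G A v connA p∈A e) (⊆-insert A v a∈A))
      where
      lt : ∣ A ∣ < k
      lt = ℕ.≤-trans (s≤s (ℕ.m≤n+m ∣ A ∣ m)) (ℕ.≤-reflexive ∣A∣)

  -- The walk first carries a vertex of one state to one of the other, then absorbs the target.
  diameter-bound : ∀ {n} (G : Graph n) k {D} → IsDiameter G D → ∀ i j →
                   States.Reach G (2 + k) (suc (D + k)) i j
  diameter-bound G k {D} (dist , _) i j =
    let s , s∈X = 0<∣p∣⇒Nonempty X (subst (0 <_) (sym (∣state∣ i)) (s≤s z≤n))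
        t , t∈T = 0<∣p∣⇒Nonempty T (subst (0 <_) (sym (∣state∣ j)) (s≤s z≤n))
        d , ((p , ∣p∣≡d) , _) , d≤D = dist s t
        i′ , t∈Y , r = moveAlong (s≤s (s≤s z≤n)) p i s∈X
        q , q≤ = reach-trans r (fillUp (suc k) ⁅ t ⁆ i′ j
          (trans (cong (suc k +_) (∣⁅x⁆∣≡1 t)) (ℕ.+-comm (suc k) 1))
          (singleton-⊆ (state G (2 + k) i′) t t∈Y) (singleton-⊆ T t t∈T) (connectedOn-singleton G t) (x∈⁅x⁆ t))
    in q , ℕ.≤-trans q≤ (ℕ.≤-trans (ℕ.+-monoˡ-≤ (suc k) (ℕ.≤-trans (ℕ.≤-reflexive ∣p∣≡d) d≤D))
                           (ℕ.≤-reflexive (ℕ.+-suc D k)))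
    where
    open States G (2 + k)
    X = state G (2 + k) i
    T = state G (2 + k) j

  -- Counting states and their neighbours

  injection⇒≤length : ∀ {m} {B : Set} {ys : List B} (f : Fin m → B) → (∀ {i j} → f i ≡ f j → i ≡ j) →
                      (∀ i → f i List.∈ ys) → m ≤ length ys
  injection⇒≤length {B = B} f f-inj f∈ = injective⇒≤ {f = λ i → Any.index (f∈ i)}
    λ {i} {j} eq → f-inj (index-injective (setoid B) (f∈ i) (f∈ j) eq)

  injection₂⇒≤length : ∀ {l m} {B : Set} {ys : List B} (g : Fin l × Fin m → B) →
                       (∀ q r → g q ≡ g r → q ≡ r) → (∀ q → g q List.∈ ys) → l * m ≤ length ys
  injection₂⇒≤length {l} {m} g g-inj g∈ = injection⇒≤length (λ q → g (remQuot {l} m q))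
    (λ {q} {r} eq → trans (sym (combine-remQuot {l} m q))
      (trans (cong (λ (b , i) → combine {l} {m} b i) (g-inj _ _ eq)) (combine-remQuot {l} m r)))
    (λ q → g∈ (remQuot {l} m q))

  length-concatMap≤ : ∀ {A B : Set} {c} (g : A → List B) xs → (∀ {x} → x List.∈ xs → length (g x) ≤ c) →
                      length (concatMap g xs) ≤ length xs * c
  length-concatMap≤ g []       h = z≤n
  length-concatMap≤ g (x ∷ xs) h = ℕ.≤-trans (ℕ.≤-reflexive (length-++ (g x)))
    (ℕ.+-mono-≤ (h (Any.here refl)) (length-concatMap≤ g xs (λ y∈ → h (Any.there y∈))))

  ∈-concatMap : ∀ {A B : Set} (g : A → List B) {xs x y} → x List.∈ xs → y List.∈ g x → y List.∈ concatMap g xs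
  ∈-concatMap g x∈ y∈ = List.∈-concatMap⁺ g (List.lose x∈ y∈)

  elements : ∀ {n} → Subset n → List (Fin n)
  elements []            = []
  elements (inside ∷ S)  = zero ∷ map suc (elements S)
  elements (outside ∷ S) = map suc (elements S)

  length-elements : ∀ {n} (S : Subset n) → length (elements S) ≡ ∣ S ∣
  length-elements []            = refl
  length-elements (inside ∷ S)  = cong suc (trans (length-map suc (elements S)) (length-elements S))
  length-elements (outside ∷ S) = trans (length-map suc (elements S)) (length-elements S)

  ∈-elements⁺ : ∀ {n} {S : Subset n} {x} → x ∈ S → x List.∈ elements S
  ∈-elements⁺ here                          = Any.here refl
  ∈-elements⁺ {S = inside ∷ S}  (there x∈S) = Any.there (List.∈-map⁺ suc (∈-elements⁺ x∈S))
  ∈-elements⁺ {S = outside ∷ S} (there x∈S) = List.∈-map⁺ suc (∈-elements⁺ x∈S)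

  ∈-elements⁻ : ∀ {n} {S : Subset n} {x} → x List.∈ elements S → x ∈ S
  ∈-elements⁻ {S = inside ∷ S}  (Any.here refl) = here
  ∈-elements⁻ {S = inside ∷ S}  (Any.there h) with List.∈-map⁻ suc h
  ... | _ , h′ , refl = there (∈-elements⁻ h′)
  ∈-elements⁻ {S = outside ∷ S} h with List.∈-map⁻ suc h
  ... | _ , h′ , refl = there (∈-elements⁻ h′)

  module _ {n} (G : Graph n) where

    Δ = maxDegree G

    neighbours : Fin n → List (Fin n)
    neighbours v = filter (adj? G v) (allFin n)

    degree≤Δ : ∀ v → degree G v ≤ Δ
    degree≤Δ v = All.lookup (xs≤max 0 (map (degree G) (allFin n))) (List.∈-map⁺ (degree G) (List.∈-allFin v))

    neighbourhood : Subset n → List (Fin n)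
    neighbourhood S = concatMap neighbours (elements S)

    length-neighbourhood : ∀ S → length (neighbourhood S) ≤ ∣ S ∣ * Δ
    length-neighbourhood S = ℕ.≤-trans
      (length-concatMap≤ neighbours (elements S) (λ {v} _ → degree≤Δ v))
      (ℕ.≤-reflexive (cong (_* Δ) (length-elements S)))

    ∈-neighbourhood : ∀ S {v w} → v ∈ S → Adj G v w → w List.∈ neighbourhood S
    ∈-neighbourhood S {v} {w} v∈S e =
      ∈-concatMap neighbours (∈-elements⁺ v∈S) (List.∈-filter⁺ (adj? G v) (List.∈-allFin w) e)

    -- An edge that leaves `T - x` within `T` can only end at `x`.
    attached : ∀ T x → x ∈ T → ConnectedOn G T → 1 < ∣ T ∣ → ∃ λ v → v ∈ T - x × Adj G v x
    attached T x x∈T connT 1<∣T∣ =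
      let a , a∈ = 0<∣p∣⇒Nonempty (T - x) (ℕ.≤-pred (subst (1 <_) (∣p∣≡1+∣p-x∣ T x x∈T) 1<∣T∣))
          p , v , p∈ , v∈T , v∉ , e = grow G (T - x) T (p─q⊆p T ⁅ x ⁆) connT a∈
            (subst (∣ T - x ∣ <_) (sym (∣p∣≡1+∣p-x∣ T x x∈T)) ℕ.≤-refl)
      in p , p∈ , subst (Adj G p) (decidable-stable (v ≟ x) λ v≢x → v∉ (x∈p∧x≢y⇒x∈p-y v∈T v≢x)) e

    -- Indexing the pair by `Fin 2` makes it a factor of the product `Fin 2 × Fin N`, whose size is
    -- the doubled count.
    record TwoNoncutVertices (T : Subset n) : Set where
      field
        vertex           : Fin 2 → Fin n
        vertex∈          : ∀ b → vertex b ∈ T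
        noncut           : ∀ b → ConnectedOn G (T - vertex b)
        vertex-injective : ∀ {b c} → vertex b ≡ vertex c → b ≡ c

    -- A noncut vertex can be found away from any prescribed vertex: growing from that vertex never
    -- adds it last. Doing this again with the vertex just found as the prescribed one gives a
    -- second, different vertex.
    twoNoncutVertices : ∀ T → ConnectedOn G T → 1 < ∣ T ∣ → TwoNoncutVertices T
    twoNoncutVertices T connT 1<∣T∣ with 0<∣p∣⇒Nonempty T (ℕ.<-trans (s≤s z≤n) 1<∣T∣)
    ... | a , a∈T = first (avoid a a∈T)
      where
      Avoids : Fin n → Set
      Avoids a = ∃ λ x → x ∈ T × x ∉ ⁅ a ⁆ × ConnectedOn G (T - x)

      avoid : ∀ a → a ∈ T → Avoids a
      avoid a a∈T = noncutVertex G ⁅ a ⁆ T (subst (_< ∣ T ∣) (sym (∣⁅x⁆∣≡1 a)) 1<∣T∣)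
        (singleton-⊆ T a a∈T) (connectedOn-singleton G a) (x∈⁅x⁆ a) connT

      pair : Fin n → Fin n → Fin 2 → Fin n
      pair x y zero    = x
      pair x y (suc _) = y

      pair-injective : ∀ x y → x ≢ y → ∀ {b c} → pair x y b ≡ pair x y c → b ≡ c
      pair-injective x y x≢y {zero}     {zero}     _  = refl
      pair-injective x y x≢y {zero}     {suc zero} eq = contradiction eq x≢y
      pair-injective x y x≢y {suc zero} {zero}     eq = contradiction (sym eq) x≢y
      pair-injective x y x≢y {suc zero} {suc zero} _  = refl

      second : ∀ x → x ∈ T → ConnectedOn G (T - x) → Avoids x → TwoNoncutVertices T
      second x x∈T connx (y , y∈T , y∉x , conny) = record
        { vertex           = pair x y
        ; vertex∈          = λ { zero → x∈T ; (suc _) → y∈T }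
        ; noncut           = λ { zero → connx ; (suc _) → conny }
        ; vertex-injective = pair-injective x y (x∉⁅y⁆⇒x≢y y∉x ∘ sym)
        }

      first : ∀ {a} → Avoids a → TwoNoncutVertices T
      first (x , x∈T , _ , connx) = second x x∈T connx (avoid x x∈T)

    -- Every connected (j+1)-set arises in two ways by adding a vertex to a connected
    -- j-set S; targets S lists the candidates for that vertex.
    numStates-suc : ∀ j c (targets : Subset n → List (Fin n)) →
      (∀ S → ∣ S ∣ ≡ suc j → length (targets S) ≤ c) →
      (∀ S {v w} → v ∈ S → Adj G v w → w List.∈ targets S) →
      2 * numStates G (2 + j) ≤ numStates G (suc j) * c
    numStates-suc j c targets len≤ ∈-targets = ℕ.≤-trans
      (injection₂⇒≤length g g-injective g∈)
      (length-concatMap≤ pairs (states G (suc j)) λ {S} S∈ →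
        ℕ.≤-trans (ℕ.≤-reflexive (length-map (S ,_) (targets S)))
          (len≤ S (proj₁ (proj₂ (List.∈-filter⁻ (isConnectedSubgraph? G (suc j)) {xs = allSubsets n} S∈)))))
      where
      open States G (2 + j)

      pairs : Subset n → List (Subset n × Fin n)
      pairs S = map (S ,_) (targets S)

      1<∣state∣ : ∀ i → 1 < ∣ state G (2 + j) i ∣
      1<∣state∣ i = subst (1 <_) (sym (∣state∣ i)) (s≤s (s≤s z≤n))

      open module Ends i = TwoNoncutVertices
        (twoNoncutVertices (state G (2 + j) i) (state-connected i) (1<∣state∣ i))

      g : Fin 2 × Fin (numStates G (2 + j)) → Subset n × Fin n
      g (b , i) = state G (2 + j) i - vertex i b , vertex i b

      -- Reinserting the second component into the first recovers the (j+2)-set; the removed vertex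
      -- then tells which of its two noncut vertices was used.
      g-injective : ∀ q r → g q ≡ g r → q ≡ r
      g-injective (b , i) (b′ , i′) eq = same-state {i} {i′} {b} {b′}
        (state-injective {i} {i′} (trans
          (sym (remove-insert (state G (2 + j) i) (vertex i b) (vertex∈ i b)))
          (trans (cong (λ (S , x) → S ∪ ⁅ x ⁆) eq)
            (remove-insert (state G (2 + j) i′) (vertex i′ b′) (vertex∈ i′ b′)))))
        (cong proj₂ eq)
        where
        same-state : ∀ {i i′ b b′} → i ≡ i′ → vertex i b ≡ vertex i′ b′ → (b , i) ≡ (b′ , i′)
        same-state {i} refl eq = cong (_, i) (vertex-injective i eq)

      pair∈ : ∀ T x → x ∈ T → IsConnectedSubgraph G (2 + j) T → ConnectedOn G (T - x) →
              (T - x , x) List.∈ concatMap pairs (states G (suc j))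
      pair∈ T x x∈T (∣T∣ , connT) conn =
        let v , v∈ , e = attached T x x∈T connT (subst (1 <_) (sym ∣T∣) (s≤s (s≤s z≤n)))
        in ∈-concatMap pairs {x = T - x}
             (States.∈-states G (suc j) {T - x} (ℕ.suc-injective (trans (sym (∣p∣≡1+∣p-x∣ T x x∈T)) ∣T∣) , conn))
             (List.∈-map⁺ (T - x ,_) (∈-targets (T - x) v∈ e))

      g∈ : ∀ q → g q List.∈ concatMap pairs (states G (suc j))
      g∈ (b , i) = pair∈ (state G (2 + j) i) (vertex i b) (vertex∈ i b)
        (state-isConnectedSubgraph G (2 + j) i) (noncut i b)

    numStates-1 : numStates G 1 ≤ n
    numStates-1 = ℕ.≤-trans (injection⇒≤length (λ i → proj₁ (vertex i)) injective (λ i → List.∈-allFin _))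
      (ℕ.≤-reflexive (length-tabulate (λ x → x)))
      where
      open States G 1
      vertex : ∀ i → ∃ (_∈ state G 1 i)
      vertex i = 0<∣p∣⇒Nonempty (state G 1 i) (subst (0 <_) (sym (∣state∣ i)) (s≤s z≤n))
      is-singleton : ∀ i → ⁅ proj₁ (vertex i) ⁆ ≡ state G 1 i
      is-singleton i = ⊆∧∣∣≤⇒≡ _ _ (singleton-⊆ (state G 1 i) _ (proj₂ (vertex i)))
        (ℕ.≤-reflexive (trans (∣state∣ i) (sym (∣⁅x⁆∣≡1 (proj₁ (vertex i))))))
      injective : ∀ {i j} → proj₁ (vertex i) ≡ proj₁ (vertex j) → i ≡ j
      injective {i} {j} eq = state-injective (trans (sym (is-singleton i)) (trans (cong ⁅_⁆ eq) (is-singleton j)))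

    -- The same recursion with all n vertices as candidates, its factor 2 discarded. This cruder
    -- bound has logarithm k ln n, the form in which the number of states enters the claim.
    numStates≤ : ∀ j → numStates G (suc j) ≤ n ^ suc j
    numStates≤ zero    = ℕ.≤-trans numStates-1 (ℕ.≤-reflexive (sym (ℕ.*-identityʳ n)))
    numStates≤ (suc j) = ℕ.≤-trans (ℕ.m≤n*m (numStates G (2 + j)) 2)
      (ℕ.≤-trans (numStates-suc j n (λ _ → allFin n) (λ _ _ → ℕ.≤-reflexive (length-tabulate (λ x → x)))
          (λ _ {_} {w} _ _ → List.∈-allFin w))
        (ℕ.≤-trans (ℕ.*-monoˡ-≤ n (numStates≤ j)) (ℕ.≤-reflexive (ℕ.*-comm (n ^ suc j) n))))

    2^*numStates≤ : ∀ j → 2 ^ j * numStates G (suc j) ≤ j ! * Δ ^ j * n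
    2^*numStates≤ zero    = ℕ.≤-trans (ℕ.≤-reflexive (ℕ.+-identityʳ _))
      (ℕ.≤-trans numStates-1 (ℕ.≤-reflexive (sym (ℕ.+-identityʳ n))))
    2^*numStates≤ (suc j) = ℕ.≤-trans
      (ℕ.≤-reflexive (solve 2 (λ p s → con 2 :* p :* s := p :* (con 2 :* s)) refl (2 ^ j) (numStates G (2 + j))))
      (ℕ.≤-trans (ℕ.*-monoʳ-≤ (2 ^ j) (numStates-suc j (suc j * Δ) neighbourhood
          (λ S eq → subst (λ c → length (neighbourhood S) ≤ c * Δ) eq (length-neighbourhood S))
          ∈-neighbourhood))
        (ℕ.≤-trans (ℕ.≤-reflexive (sym (ℕ.*-assoc (2 ^ j) (numStates G (suc j)) (suc j * Δ))))
          (ℕ.≤-trans (ℕ.*-monoˡ-≤ (suc j * Δ) (2^*numStates≤ j))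
            (ℕ.≤-reflexive (solve 5 (λ f p m s d → f :* p :* m :* (s :* d) := s :* f :* (d :* p) :* m)
              refl (j !) (Δ ^ j) n (suc j) Δ)))))
      where open ℕ-Solver

    -- Degrees in the state graph

    swaps : Subset n → List (Fin n × Fin n)
    swaps S = concatMap (λ u → map (u ,_) (neighbourhood (S - u))) (elements S)

    length-swaps : ∀ {j} S → ∣ S ∣ ≡ suc j → length (swaps S) ≤ suc j * (j * Δ)
    length-swaps {j} S ∣S∣ = ℕ.≤-trans
      (length-concatMap≤ (λ u → map (u ,_) (neighbourhood (S - u))) (elements S) λ {u} u∈ →
        ℕ.≤-trans (ℕ.≤-reflexive (length-map (u ,_) (neighbourhood (S - u))))
          (ℕ.≤-trans (length-neighbourhood (S - u))
            (ℕ.≤-reflexive (cong (_* Δ) (ℕ.suc-injective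
              (trans (sym (∣p∣≡1+∣p-x∣ S u (∈-elements⁻ u∈))) ∣S∣))))))
      (ℕ.≤-reflexive (cong (_* (j * Δ)) (trans (length-elements S) ∣S∣)))

    ∩≡remove : ∀ {m} (S T : Subset n) x → ∣ S ∣ ≡ m → suc ∣ S ∩ T ∣ ≡ m → x ∈ S → x ∉ S ∩ T → S ∩ T ≡ S - x
    ∩≡remove S T x ∣S∣ e x∈S x∉ = ⊆∧∣∣≤⇒≡ (S ∩ T) (S - x)
      (λ h → x∈p∧x≢y⇒x∈p-y (proj₁ (x∈p∩q⁻ S T h)) λ { refl → x∉ h })
      (ℕ.≤-pred (ℕ.≤-reflexive (trans (sym (∣p∣≡1+∣p-x∣ S x x∈S)) (trans ∣S∣ (sym e)))))

    -- Connectivity of `T` attaches `w` to `T - w`, which is the common part and hence equals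
    -- `S - u`. Looking for `w` next to `S - u` instead of `S` gives the factor k - 1 in place of k.
    swap : ∀ {j} S T → ∣ S ∣ ≡ 2 + j → IsConnectedSubgraph G (2 + j) T → suc ∣ S ∩ T ∣ ≡ 2 + j →
           ∃ λ ((u , w) : Fin n × Fin n) → (S - u) ∪ ⁅ w ⁆ ≡ T × (u , w) List.∈ swaps S
    swap S T ∣S∣ (∣T∣ , connT) e =
      let u , u∈S , u∉ = ∣p∣<∣q∣⇒∃ (S ∩ T) S (ℕ.≤-reflexive (trans e (sym ∣S∣)))
          w , w∈T , w∉ = ∣p∣<∣q∣⇒∃ (T ∩ S) T (ℕ.≤-reflexive (trans e′ (sym ∣T∣)))
      in (u , w) , exchange u w u∈S u∉ w∈T w∉
      where
      e′ = trans (cong (λ U → suc ∣ U ∣) (∩-comm T S)) e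
      exchange : ∀ u w → u ∈ S → u ∉ S ∩ T → w ∈ T → w ∉ T ∩ S →
                 (S - u) ∪ ⁅ w ⁆ ≡ T × (u , w) List.∈ swaps S
      exchange u w u∈S u∉ w∈T w∉ =
        trans (cong (_∪ ⁅ w ⁆) (sym T-w≡S-u)) (remove-insert T w w∈T) ,
        found (attached T w w∈T connT (subst (1 <_) (sym ∣T∣) (s≤s (s≤s z≤n))))
        where
        T-w≡S-u : T - w ≡ S - u
        T-w≡S-u = trans (sym (∩≡remove T S w ∣T∣ e′ w∈T w∉))
          (trans (∩-comm T S) (∩≡remove S T u ∣S∣ e u∈S u∉))
        found : (∃ λ v → v ∈ T - w × Adj G v w) → (u , w) List.∈ swaps S
        found (v , v∈ , a) = ∈-concatMap _ {x = u} (∈-elements⁺ u∈S)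
          (List.∈-map⁺ (u ,_) (∈-neighbourhood (S - u) (subst (v ∈_) T-w≡S-u v∈) a))

    stateGraph-degree≤ : ∀ j i → degree (stateGraph G (2 + j)) i ≤ (2 + j) * (suc j * Δ)
    stateGraph-degree≤ j i = ℕ.≤-trans
      (injection⇒≤length (λ q → proj₁ (swapAt q)) injective (λ q → proj₂ (proj₂ (swapAt q))))
      (length-swaps S (∣state∣ i))
      where
      open States G (2 + j)
      S = state G (2 + j) i
      js = filter (adj? H i) (allFin (numStates G (2 + j)))

      swapAt : ∀ q → ∃ λ ((u , w) : Fin n × Fin n) →
               (S - u) ∪ ⁅ w ⁆ ≡ state G (2 + j) (lookup js q) × (u , w) List.∈ swaps S
      swapAt q = swap S (state G (2 + j) (lookup js q)) (∣state∣ i) (state-isConnectedSubgraph G (2 + j) (lookup js q))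
        (proj₂ (List.∈-filter⁻ (adj? H i) {xs = allFin (numStates G (2 + j))} (List.∈-lookup {xs = js} q)))

      injective : ∀ {q r} → proj₁ (swapAt q) ≡ proj₁ (swapAt r) → q ≡ r
      injective {q} {r} eq = lookup-injective {xs = js} (Unique.filter⁺ (adj? H i) (Unique.allFin⁺ _)) {q} {r}
        (state-injective {lookup js q} {lookup js r} (trans (sym (proj₁ (proj₂ (swapAt q))))
          (trans (cong (λ (u , w) → (S - u) ∪ ⁅ w ⁆) eq) (proj₁ (proj₂ (swapAt r))))))

  2*suc≤2^ : ∀ j → 2 * suc j ≤ 2 ^ suc j
  2*suc≤2^ j = ℕ.*-monoʳ-≤ 2 (aux j)
    where
    aux : ∀ j → suc j ≤ 2 ^ j
    aux zero    = s≤s z≤n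
    aux (suc j) = ℕ.≤-trans (s≤s (aux j))
      (ℕ.≤-trans (ℕ.+-monoˡ-≤ (2 ^ j) (ℕ.^-monoʳ-≤ 2 (z≤n {j}))) (ℕ.≤-reflexive (cong (2 ^ j +_) (sym (ℕ.+-identityʳ (2 ^ j))))))

  -- The factor 2 (k - 1) is covered by the 2^{k-1} of the double counting; the remaining k Δ raises
  -- (k - 1)! Δ^{k-1} to k! Δᵏ.
  2*numStates*degree≤ : ∀ {n} (G : Graph n) j →
    2 * (numStates G (2 + j) * ((2 + j) * (suc j * maxDegree G))) ≤ (2 + j) ! * maxDegree G ^ (2 + j) * n
  2*numStates*degree≤ {n} G j = ℕ.≤-trans
    (ℕ.≤-reflexive (solve 4 (λ N a b d → con 2 :* (N :* (a :* (b :* d))) := con 2 :* b :* N :* (a :* d))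
      refl N (2 + j) (suc j) d))
    (ℕ.≤-trans (ℕ.*-monoˡ-≤ ((2 + j) * d) (ℕ.*-monoˡ-≤ N (2*suc≤2^ j)))
      (ℕ.≤-trans (ℕ.*-monoˡ-≤ ((2 + j) * d) (2^*numStates≤ G (suc j)))
        (ℕ.≤-reflexive (solve 5 (λ f p m s d → f :* p :* m :* (s :* d) := s :* f :* (d :* p) :* m)
              refl (suc j !) (d ^ suc j) n (2 + j) d))))
    where
    open ℕ-Solver
    N = numStates G (2 + j)
    d = maxDegree G

-- The contraction rate and the mixing time

module MixingTime where

  open import Data.Rational using (ℚ; 0ℚ; 1ℚ; ½; _+_; _*_; _-_; -_; _<_; _≤_)
  open import Data.Rational.Properties using (≤-refl; ≤-trans; ≤-reflexive; <⇒≤)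
  open import Algebra.Properties.CommutativeSemiring.Exp
    (CommutativeRing.commutativeSemiring +-*-commutativeRing) using (_^_)
  open ℚ-Solver using (solve; _:+_; _:*_; _:-_; :-_; _:=_; con)

  open Analysis
  open Combinatorics

  2ℚ : ℚ
  2ℚ = 1ℚ + 1ℚ

  0≤2 : 0ℚ ≤ 2ℚ
  0≤2 = ℚ.nonNegative⁻¹ 2ℚ

  N*uniform≡1 : ∀ {N} → Fin N → fromℕ N * (1 ÷₀ N) ≡ 1ℚ
  N*uniform≡1 {suc N} _ = suc*1/suc N

  Bound : ∀ {n} → Graph n → ℕ → ℕ → ℕ
  Bound {n} G k D = k ! ℕ.* maxDegree G ℕ.^ k ℕ.* (D ℕ.+ k ℕ.∸ 1) ℕ.* n

  module Rate {n} (G : Graph n) (k D : ℕ) (diam : IsDiameter G D) (k<n : 2 ℕ.+ k ℕ.< n)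
              (x₀ : Fin (numStates G (2 ℕ.+ k))) where

    N = numStates G (2 ℕ.+ k)
    H = stateGraph G (2 ℕ.+ k)
    d = (2 ℕ.+ k) ℕ.* (suc k ℕ.* maxDegree G)
    K = Bound G (2 ℕ.+ k) D

    L≡ : D ℕ.+ (2 ℕ.+ k) ℕ.∸ 1 ≡ suc (D ℕ.+ k)
    L≡ = trans (cong (ℕ._∸ 1) (ℕ.+-suc D (suc k))) (ℕ.+-suc D k)

    N*L*d≤K : 2 ℕ.* (N ℕ.* suc (D ℕ.+ k) ℕ.* d) ℕ.≤ K
    N*L*d≤K = ℕ.≤-trans
      (ℕ.≤-reflexive (ℕ-Solver.solve 3 (λ N L d → con′ 2 :*′ (N :*′ L :*′ d) :=′ con′ 2 :*′ (N :*′ d) :*′ L)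
        refl N (suc (D ℕ.+ k)) d))
      (ℕ.≤-trans (ℕ.*-monoˡ-≤ (suc (D ℕ.+ k)) (2*numStates*degree≤ G k))
        (ℕ.≤-reflexive (trans
          (ℕ-Solver.solve 4 (λ f p n L → f :*′ p :*′ n :*′ L :=′ f :*′ p :*′ L :*′ n)
            refl ((2 ℕ.+ k) !) (maxDegree G ℕ.^ (2 ℕ.+ k)) n (suc (D ℕ.+ k)))
          (cong (λ L → (2 ℕ.+ k) ! ℕ.* maxDegree G ℕ.^ (2 ℕ.+ k) ℕ.* L ℕ.* n) (sym L≡)))))
      where
      open ℕ-Solver using () renaming (con to con′; _:*_ to _:*′_; _:=_ to _:=′_)

    -- The state `x₀` is connected with at least two vertices, so it contains an edge.
    0<Δ : 0 ℕ.< maxDegree G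
    0<Δ =
      let t , t∈ = 0<∣p∣⇒Nonempty X (ℕ.<-trans (ℕ.s≤s ℕ.z≤n) 1<∣X∣)
          v , _ , e = attached G X t t∈ (state-connected x₀) 1<∣X∣
          a , dv = LazyMetropolis.degree-pos G e
      in ℕ.≤-trans (ℕ.s≤s ℕ.z≤n) (subst (ℕ._≤ maxDegree G) dv (degree≤Δ G v))
      where
      open States G (2 ℕ.+ k) using (∣state∣; state-connected)
      X = state G (2 ℕ.+ k) x₀
      1<∣X∣ : 1 ℕ.< Subset.∣ X ∣
      1<∣X∣ = subst (1 ℕ.<_) (sym (∣state∣ x₀)) (ℕ.s≤s (ℕ.s≤s ℕ.z≤n))

    -- The threshold 4 is what makes 2/K ≤ ½ and thus ½ ≤ θ. It holds because k! ≥ 2 and n ≥ 3,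
    -- while the other factors are at least 1.
    4≤K : 4 ℕ.≤ K
    4≤K = ℕ.≤-trans (ℕ.m≤m+n 4 2) (ℕ.*-mono-≤ {2 ℕ.* 1 ℕ.* 1} {_} {3}
      (ℕ.*-mono-≤ {2 ℕ.* 1}
        (ℕ.*-mono-≤ {2} (ℕ.*-mono-≤ {2} {2 ℕ.+ k} {1} (ℕ.s≤s (ℕ.s≤s ℕ.z≤n)) (ℕ.1≤n! (suc k)))
          (ℕ.m^n>0 (maxDegree G) {{ℕ.>-nonZero 0<Δ}} (2 ℕ.+ k)))
        (subst (1 ℕ.≤_) (sym L≡) (ℕ.s≤s ℕ.z≤n)))
      (ℕ.≤-trans (ℕ.s≤s (ℕ.s≤s (ℕ.s≤s ℕ.z≤n))) k<n))

    0<K : 0ℚ < fromℕ K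
    0<K = ℚ.<-≤-trans (0<fromℕ-suc 3) (fromℕ-mono-≤ 4≤K)

    i = proj₁ (inverse 0<K)
    0<i = proj₁ (proj₂ (inverse 0<K))
    Ki≡1 = proj₂ (proj₂ (inverse 0<K))

    -- The rate is 2/K, which is at most the gap 1/(N L d) by `N*L*d≤K`.
    γ = 2ℚ * i
    θ = 1ℚ - γ

    γ≤½ : γ ≤ ½
    γ≤½ = *-cancelˡ 0<K (≤-trans
      (≤-reflexive (trans (solve 2 (λ K i → K :* (con 2ℚ :* i) := con 2ℚ :* (K :* i)) refl (fromℕ K) i)
        (cong (2ℚ *_) Ki≡1)))
      (*-monoʳ 0≤½ (fromℕ-mono-≤ 4≤K)))

    ½≤θ : ½ ≤ θ
    ½≤θ = ℚ.+-monoʳ-≤ 1ℚ (ℚ.neg-antimono-≤ γ≤½)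

    0<θ : 0ℚ < θ
    0<θ = ℚ.<-≤-trans (ℚ.positive⁻¹ ½) ½≤θ

    0≤γ : 0ℚ ≤ γ
    0≤γ = *-nonNeg 0≤2 (<⇒≤ 0<i)

    P = MCMCSampling G (2 ℕ.+ k)

    tvDistance≤½Nθˡ : ∀ l x → tvDistance (power P l x) uniform ≤ ½ * (fromℕ N * θ ^ l)
    tvDistance≤½Nθˡ = tvDistance≤ P lazyMetropolis-step (1 ÷₀ N) (N*uniform≡1 x₀) x₀ γ 0<θ 0≤γ γ-bound
      where
      open LazyMetropolis H
      open Convergence M M-sym M≥0 row≤½ {Adj H} (2ℚ * fromℕ d) (*-nonNeg 0≤2 (0≤fromℕ d))
        (M-edge (stateGraph-degree≤ G k)) (D ℕ.+ k) (diameter-bound G k diam)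
      γ-bound : fromℕ N * fromℕ (suc (D ℕ.+ k)) * (2ℚ * fromℕ d) * γ ≤ 2ℚ
      γ-bound = ≤-trans
        (≤-reflexive (trans
          (solve 4 (λ N L d g → N :* L :* (con 2ℚ :* d) :* g := con 2ℚ :* (N :* L :* d) :* g)
            refl (fromℕ N) (fromℕ (suc (D ℕ.+ k))) (fromℕ d) γ)
          (cong (_* γ) (sym (trans (fromℕ-* 2 (N ℕ.* suc (D ℕ.+ k) ℕ.* d))
            (cong (2ℚ *_) (trans (fromℕ-* (N ℕ.* suc (D ℕ.+ k)) d)
              (cong (_* fromℕ d) (fromℕ-* N (suc (D ℕ.+ k)))))))))))
        (≤-trans (*-monoʳ 0≤γ (fromℕ-mono-≤ N*L*d≤K))
          (≤-reflexive (trans (solve 2 (λ K i → K :* (con 2ℚ :* i) := con 2ℚ :* (K :* i)) refl (fromℕ K) i)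
            (cong (2ℚ *_) Ki≡1))))

    -- By ½ ≤ θ, the product ½ θˡ is at most the next power of θ. Hence the hypothesis may involve
    -- `suc l` although only `l` steps are taken.
    tvDistance≤a : ∀ {a z b c} l x → 0ℚ ≤ b → 0ℚ ≤ c → fromℕ n <exp b → z <exp c → 0ℚ < a → 1ℚ < a * z →
      fromℕ K * (fromℕ (2 ℕ.+ k) * b + c) ≤ 2ℚ * fromℕ (suc l) →
      tvDistance (power P l x) uniform ≤ a
    tvDistance≤a {a} {z} {b} {c} l x 0≤b 0≤c n<eᵇ z<eᶜ 0<a 1<az le = ≤-trans (tvDistance≤½Nθˡ l x)
      (≤-trans (*-monoˡ 0≤½ (*-monoʳ 0≤θˡ (≤-trans (fromℕ-mono-≤ (numStates≤ G (suc k)))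
          (≤-reflexive (fromℕ-^ n (2 ℕ.+ k))))))
        (≤-trans (≤-reflexive (solve 2 (λ m t → con ½ :* (m :* t) := m :* (con ½ :* t)) refl nᵏ (θ ^ l)))
          (≤-trans (*-monoˡ (subst (0ℚ ≤_) (fromℕ-^ n (2 ℕ.+ k)) (0≤fromℕ (n ℕ.^ (2 ℕ.+ k)))) (*-monoʳ 0≤θˡ ½≤θ))
            (decay {n} {a} {z} {b} {c} {γ} (2 ℕ.+ k) l (ℕ.≤-trans (ℕ.s≤s ℕ.z≤n) k<n) (ℕ.s≤s ℕ.z≤n)
              0≤b 0≤c n<eᵇ z<eᶜ 0<a 1<az 0<θ scaled))))
      where
      nᵏ = fromℕ n ^ (2 ℕ.+ k)
      0≤θˡ : 0ℚ ≤ θ ^ l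
      0≤θˡ = <⇒≤ (^-pos l 0<θ)
      scaled : fromℕ (2 ℕ.+ k) * b + c ≤ γ * fromℕ (suc l)
      scaled = *-cancelˡ 0<K (≤-trans le (≤-reflexive (sym (trans
        (solve 3 (λ K i l → K :* (con 2ℚ :* i :* l) := K :* i :* (con 2ℚ :* l)) refl (fromℕ K) i (fromℕ (suc l)))
        (trans (cong (_* (2ℚ * fromℕ (suc l))) Ki≡1) (ℚ.*-identityˡ _))))))

  -- Rational upper bounds b of ln n and c of ln ε⁻¹ such that ½ K (k b + c) ≤ r.
  record Certificate (ε : ℝ) (n k K : ℕ) (r : ℚ) : Set where
    field
      {a z b c} : ℚ
      La   : L ε a
      0<a  : 0ℚ < a
      1<az : 1ℚ < a * z
      n<eᵇ : fromℕ n <exp b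
      z<eᶜ : z <exp c
      0≤b  : 0ℚ ≤ b
      0≤c  : 0ℚ ≤ c
      le   : fromℕ K * (fromℕ k * b + c) ≤ 2ℚ * r

  -- For q < r < τ, locatedness of `B` yields either the desired `L B q` or `U B r`. The second is
  -- refuted by a certificate for r, since τ is the least mixing time from some state `x`.
  mixingTime≤ : ∀ (ε : ℝ) {n} (G : Graph n) k D → IsDiameter G D → 2 ℕ.+ k ℕ.< n →
    ∀ τ → IsMixingTime (MCMCSampling G (2 ℕ.+ k)) uniform ε τ →
    (B : ℝ) → (∀ {r} → U B r → Certificate ε n (2 ℕ.+ k) (Bound G (2 ℕ.+ k) D) r) →
    fromℚ (fromℕ τ) ≤ℝ B
  mixingTime≤ ε {n} G k D diam k<n τ (_ , x , _ , minimal) B cert q q<τ = conclude (ℚ.<-dense q<τ)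
    where
    impossible : ∀ τ → (∀ s → MixedFrom (MCMCSampling G (2 ℕ.+ k)) uniform ε x s → τ ℕ.≤ s) →
                 ∀ {r} → r < fromℕ τ → U B r → L B q
    -- With τ = 0 there is no earlier time to contradict; instead the certificate forces r ≥ 0.
    impossible zero _ r<0 Ur = contradiction
      (ℚ.≤-<-trans
        (≤-trans (*-nonNeg (0≤fromℕ (Bound G (2 ℕ.+ k) D)) (+-nonNeg (*-nonNeg (0≤fromℕ (2 ℕ.+ k)) 0≤b) 0≤c)) le)
        (*-monoˡ-< (ℚ.positive⁻¹ 2ℚ) r<0))
      (ℚ.<-irrefl refl)
      where open Certificate (cert Ur)
    impossible (suc s) minimal {r} r<τ Ur = contradiction (minimal s mixed) ℕ.1+n≰n
      where
      open Certificate (cert Ur)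
      mixed : MixedFrom (MCMCSampling G (2 ℕ.+ k)) uniform ε x s
      -- Here r < s + 1 ≤ l + 1, so no rounding up is needed.
      mixed l s≤l p p<tv = L-down ε (ℚ.<-≤-trans p<tv
        (Rate.tvDistance≤a G k D diam k<n x {a} {z} {b} {c} l x 0≤b 0≤c n<eᵇ z<eᶜ 0<a 1<az
          (≤-trans le (*-monoˡ 0≤2 (≤-trans (<⇒≤ r<τ) (fromℕ-mono-≤ (ℕ.s≤s s≤l))))))) La

    conclude : (∃ λ r → q < r × r < fromℕ τ) → L B q
    conclude (r , q<r , r<τ) with located B q<r
    ... | inj₁ Lq = Lq
    ... | inj₂ Ur = impossible τ minimal r<τ Ur

  -- Bounds on the logarithms and the two final estimates

  module _ (ε : ℝ⁺) (ε<1 : value ε <ℝ fromℚ 1ℚ) where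

    -- An upper bound of ε⁻¹ comes with a lower bound `a` of ε such that az > 1. From ε < 1 follows
    -- a < 1, hence z > 1, and the logarithm bound is nonnegative.
    U-ln-ε⁻¹ : ∀ {c} → U (ln (ε ⁻¹)) c →
      ∃ λ a → ∃ λ z → L (value ε) a × 0ℚ < a × 1ℚ < a * z × z <exp c × 0ℚ ≤ c
    U-ln-ε⁻¹ {c} (z , (a , La , 0<a , 1<az) , z<eᶜ) =
      a , z , La , 0<a , 1<az , z<eᶜ , exp<∧<exp⇒≤ {z} {0ℚ} {c} (1<⇒0exp< 1<z) z<eᶜ
      where
      a<1 : a < 1ℚ
      a<1 = let q , Uq , q<1 = ε<1 in ℚ.<-trans (ℝ.L<U (value ε) La Uq) q<1
      1<z : 1ℚ < z
      1<z = ℚ.≰⇒> λ z≤1 → ℚ.<-irrefl refl (ℚ.<-trans 1<az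
        (ℚ.≤-<-trans (≤-trans (*-monoˡ (<⇒≤ 0<a) z≤1) (≤-reflexive (ℚ.*-identityʳ a))) a<1))

    U-ln-n : ∀ {n b} → 3 ℕ.≤ suc n → U (ln (fromℕ⁺ (suc n))) b → fromℕ (suc n) <exp b × ½ ≤ b
    U-ln-n {n} {b} 3≤n (y , n<y , m , 0<s , y<sᴹ) =
      n<eᵇ , exp<∧<exp⇒≤ {fromℕ (suc n)} {½} {b} (½exp<fromℕ 3≤n) n<eᵇ
      where
      n<eᵇ : fromℕ (suc n) <exp b
      n<eᵇ = m , 0<s , ℚ.<-trans n<y y<sᴹ

    explicit-bound : ∀ {n} .{{_ : ℕ.NonZero n}} (G : Graph n) (k D : ℕ) → IsDiameter G D →
      1 ℕ.< k → k ℕ.< n → ∀ τ → IsMixingTime (MCMCSampling G k) uniform (value ε) τ →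
      fromℚ (fromℕ τ) ≤ℝ scale ½ (Bound G k D · (k · ln (fromℕ⁺ n) +ℝ ln (ε ⁻¹)))
    explicit-bound {suc n} G (suc (suc k)) D diam (ℕ.s≤s (ℕ.s≤s _)) k<n τ isτ =
      mixingTime≤ (value ε) G k D diam k<n τ isτ B certificate
      where
      K = Bound G (2 ℕ.+ k) D
      B = scale ½ (K · ((2 ℕ.+ k) · ln (fromℕ⁺ (suc n)) +ℝ ln (ε ⁻¹)))
      certificate : ∀ {r} → U B r →
                    Certificate (value ε) (suc n) (2 ℕ.+ k) K r
      certificate {r} (t , (t′ , (b′ , c , (b , Ub , kb<b′) , Uc , b′+c<t′) , Kt′<t) , ½t<r) =
        let a , z , La , 0<a , 1<az , z<eᶜ , 0≤c = U-ln-ε⁻¹ {c} Uc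
            n<eᵇ , ½≤b = U-ln-n {n} {b} (ℕ.≤-trans (ℕ.s≤s (ℕ.s≤s (ℕ.s≤s ℕ.z≤n))) k<n) Ub
        in record
          { La = La ; 0<a = 0<a ; 1<az = 1<az ; n<eᵇ = n<eᵇ ; z<eᶜ = z<eᶜ
          ; 0≤b = ≤-trans 0≤½ ½≤b ; 0≤c = 0≤c
          ; le = ≤-trans (*-monoˡ (0≤fromℕ K) (<⇒≤ (ℚ.<-trans (ℚ.+-monoˡ-< c kb<b′) b′+c<t′)))
              (≤-trans (<⇒≤ Kt′<t) (≤-trans (≤-reflexive (solve 1 (λ t → t := con 2ℚ :* (con ½ :* t)) refl t))
                (*-monoˡ 0≤2 (<⇒≤ ½t<r))))
          }

    Constant : ∃ λ c → U (ln (ε ⁻¹)) c × ∃ λ C → c ≤ fromℕ (suc C)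
    Constant = let c , Uc = U-inh (ln (ε ⁻¹)) ; C , c<C = archimedean c in c , Uc , C , <⇒≤ c<C

    O-bound : ∃ λ (C : ℕ) → ∀ {n} .{{_ : ℕ.NonZero n}} (G : Graph n) (k D : ℕ) → IsDiameter G D →
      1 ℕ.< k → k ℕ.< n → ∀ τ → IsMixingTime (MCMCSampling G k) uniform (value ε) τ →
      fromℚ (fromℕ τ) ≤ℝ (C ℕ.* (k ! ℕ.* k ℕ.* maxDegree G ℕ.^ k ℕ.* (D ℕ.+ k) ℕ.* n)) · ln (fromℕ⁺ n)
    -- The upper bound c ≤ C + 1 of ln ε⁻¹ is fixed before the graph. As k b ≥ 1 for every upper
    -- bound b of ln n, it follows that k b + c ≤ (C + 2) k b.
    O-bound = suc (suc C) , bound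
      where
      c = proj₁ Constant
      Uc = proj₁ (proj₂ Constant)
      C = proj₁ (proj₂ (proj₂ Constant))
      c≤C : c ≤ fromℕ (suc C)
      c≤C = proj₂ (proj₂ (proj₂ Constant))

      bound : ∀ {n} .{{_ : ℕ.NonZero n}} (G : Graph n) (k D : ℕ) → IsDiameter G D →
        1 ℕ.< k → k ℕ.< n → ∀ τ → IsMixingTime (MCMCSampling G k) uniform (value ε) τ →
        fromℚ (fromℕ τ) ≤ℝ (suc (suc C) ℕ.* (k ! ℕ.* k ℕ.* maxDegree G ℕ.^ k ℕ.* (D ℕ.+ k) ℕ.* n)) · ln (fromℕ⁺ n)
      bound {suc n} G (suc (suc k)) D diam (ℕ.s≤s (ℕ.s≤s _)) k<n τ isτ =
        mixingTime≤ (value ε) G k D diam k<n τ isτ (W · ln (fromℕ⁺ (suc n))) certificate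
        where
        kk = 2 ℕ.+ k
        K = Bound G kk D
        W = suc (suc C) ℕ.* (kk ! ℕ.* kk ℕ.* maxDegree G ℕ.^ kk ℕ.* (D ℕ.+ kk) ℕ.* suc n)

        K*≤W : K ℕ.* (kk ℕ.* suc (suc C)) ℕ.≤ W
        K*≤W = ℕ.≤-trans
          (ℕ.*-monoˡ-≤ (kk ℕ.* suc (suc C)) (ℕ.*-monoˡ-≤ (suc n)
            (ℕ.*-monoʳ-≤ (kk ! ℕ.* maxDegree G ℕ.^ kk) (ℕ.m∸n≤m (D ℕ.+ kk) 1))))
          (ℕ.≤-reflexive (rearrange (kk !) (maxDegree G ℕ.^ kk) (D ℕ.+ kk) (suc n) kk (suc (suc C))))
          where
          rearrange : ∀ f p L n k C → f ℕ.* p ℕ.* L ℕ.* n ℕ.* (k ℕ.* C) ≡ C ℕ.* (f ℕ.* k ℕ.* p ℕ.* L ℕ.* n)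
          rearrange = ℕ-Solver.solve 6 (λ f p L n k C → f :*′ p :*′ L :*′ n :*′ (k :*′ C) :=′ C :*′ (f :*′ k :*′ p :*′ L :*′ n)) refl
            where open ℕ-Solver using () renaming (_:*_ to _:*′_; _:=_ to _:=′_)

        certificate : ∀ {r} → U (W · ln (fromℕ⁺ (suc n))) r → Certificate (value ε) (suc n) kk K r
        certificate {r} (b , Ub , Wb<r) =
          let a , z , La , 0<a , 1<az , z<eᶜ , 0≤c = U-ln-ε⁻¹ {c} Uc
              n<eᵇ , ½≤b = U-ln-n {n} {b} (ℕ.≤-trans (ℕ.s≤s (ℕ.s≤s (ℕ.s≤s ℕ.z≤n))) k<n) Ub
          in record
            { La = La ; 0<a = 0<a ; 1<az = 1<az ; n<eᵇ = n<eᵇ ; z<eᶜ = z<eᶜ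
            ; 0≤b = ≤-trans 0≤½ ½≤b ; 0≤c = 0≤c ; le = le ½≤b
            }
          where
          module _ (½≤b : ½ ≤ b) where
            0≤b = ≤-trans 0≤½ ½≤b
            1≤kb : 1ℚ ≤ fromℕ kk * b
            1≤kb = *-mono-≤-pos {2ℚ} {fromℕ kk} {½} {b} 0≤2 0≤b (fromℕ-mono-≤ {2} {kk} (ℕ.s≤s (ℕ.s≤s ℕ.z≤n))) ½≤b
            kb+c≤ : fromℕ kk * b + c ≤ fromℕ (suc (suc C)) * (fromℕ kk * b)
            kb+c≤ = ≤-trans
              (ℚ.+-monoʳ-≤ (fromℕ kk * b) (≤-trans c≤C
                (≤-trans (≤-reflexive (sym (ℚ.*-identityʳ (fromℕ (suc C))))) (*-monoˡ (0≤fromℕ (suc C)) 1≤kb))))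
              (≤-reflexive (trans (solve 2 (λ C x → x :+ C :* x := (con 1ℚ :+ C) :* x) refl (fromℕ (suc C)) (fromℕ kk * b))
                (cong (_* (fromℕ kk * b)) (sym (fromℕ-suc (suc C))))))
            0≤r : 0ℚ ≤ r
            0≤r = <⇒≤ (ℚ.≤-<-trans (*-nonNeg (0≤fromℕ W) 0≤b) Wb<r)
            le : fromℕ K * (fromℕ kk * b + c) ≤ 2ℚ * r
            le = ≤-trans (*-monoˡ (0≤fromℕ K) kb+c≤)
              (≤-trans (≤-reflexive (trans
                  (solve 4 (λ K C k b → K :* (C :* (k :* b)) := K :* (k :* C) :* b) refl (fromℕ K) (fromℕ (suc (suc C))) (fromℕ kk) b)
                  (cong (_* b) (sym (trans (fromℕ-* K (kk ℕ.* suc (suc C))) (cong (fromℕ K *_) (fromℕ-* kk (suc (suc C)))))))))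
                (≤-trans (*-monoʳ 0≤b (fromℕ-mono-≤ K*≤W))
                  (≤-trans (<⇒≤ Wb<r) (≤-trans (≤-reflexive (sym (ℚ.*-identityˡ r)))
                    (*-monoʳ 0≤r (ℚ.≤ᵇ⇒≤ {1ℚ} {2ℚ} _))))))

open import Data.Nat using (ℕ; NonZero; _+_; _∸_; _*_; _^_; _!; _<_)
open import Data.Rational using (1ℚ; ½)

lemma3p2 : (ε : ℝ⁺) → value ε <ℝ fromℚ 1ℚ →
    (∀ {n} .{{_ : NonZero n}} (G : Graph n) (k D : ℕ) →
    Connected G → IsDiameter G D → 1 < k → k < n →
    ∀ τ → IsMixingTime (MCMCSampling G k) uniform (value ε) τ →
    fromℚ (fromℕ τ) ≤ℝ
    scale ½ ((k ! * maxDegree G ^ k * (D + k ∸ 1) * n) ·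
    (k · ln (fromℕ⁺ n) +ℝ ln (ε ⁻¹))))
    ×
    (∃ λ (C : ℕ) → ∀ {n} .{{_ : NonZero n}} (G : Graph n) (k D : ℕ) →
    Connected G → IsDiameter G D → 1 < k → k < n →
    ∀ τ → IsMixingTime (MCMCSampling G k) uniform (value ε) τ →
    fromℚ (fromℕ τ) ≤ℝ
    (C * (k ! * k * maxDegree G ^ k * (D + k) * n)) · ln (fromℕ⁺ n))
lemma3p2 ε ε<1 =
  (λ G k D _ → MixingTime.explicit-bound ε ε<1 G k D) ,
  (let C , bound = MixingTime.O-bound ε ε<1 in C , λ G k D _ → bound G k D)
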